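{- For every integer $k \geq 3$, $$gr_k(K_3 : K_{3,3}) = 2k + 14.$$
   Context: $K_{3,3}$ is the complete bipartite graph with both parts of size $3$. A rainbow triangle is a triangle whose three edges have three distinct colors. $gr_k(K_3 : H)$ is the minimum integer $n$ such that every $k$-coloring of the edges of $K_n$ (using all $k$ colors) contains either a rainbow triangle or a monochromatic copy of $H$.
   Formalization: Here gr_k(K_3 : K_{3,3}) is the least N such that the property holds for K_n for every n ≥ N; the literal minimum n would be trivial, since for tiny n no coloring of K_n uses all k colors and the property holds vacuously. -}

module Defs where

open import Data.Nat using (ℕ; _≤_)
open import Data.Fin using (Fin)
open import Data.Product using (Σ; _×_; ∃; ∃-syntax)
open import Data.Sum using (_⊎_)
open import Relation.Binary.PropositionalEquality using (_≡_; _≢_)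

-- An edge k-colouring of the complete graph K_n on vertex set Fin n:
-- a colour for every ordered pair, symmetric on distinct vertices
-- (values on the diagonal are irrelevant).
record Colouring (k n : ℕ) : Set where
  field
    col : Fin n → Fin n → Fin k
    sym : ∀ i j → i ≢ j → col i j ≡ col j i
open Colouring public

UsesAll : ∀ {k n} → Colouring k n → Set
UsesAll {k} {n} c = ∀ (a : Fin k) → ∃[ i ] ∃[ j ] (i ≢ j × col c i j ≡ a)

RainbowTriangle : ∀ {k n} → Colouring k n → Set
RainbowTriangle {k} {n} c =
  ∃[ x ] ∃[ y ] ∃[ z ]
    ((x ≢ y × y ≢ z × x ≢ z) ×
     (col c x y ≢ col c y z × col c y z ≢ col c x z × col c x y ≢ col c x z))

MonoK33 : ∀ {k n} → Colouring k n → Set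
MonoK33 {k} {n} c =
  Σ (Fin 3 → Fin n) λ u → Σ (Fin 3 → Fin n) λ v → Σ (Fin k) λ a →
    ((∀ (i j : Fin 3) → i ≢ j → u i ≢ u j) ×
     (∀ (i j : Fin 3) → i ≢ j → v i ≢ v j) ×
     (∀ (i j : Fin 3) → u i ≢ v j) ×
     (∀ (i j : Fin 3) → col c (u i) (v j) ≡ a))

GRProperty : ℕ → ℕ → Set
GRProperty k n = (c : Colouring k n) → UsesAll c → RainbowTriangle c ⊎ MonoK33 c

GR-K33-is : ℕ → ℕ → Set
GR-K33-is k N =
  (∀ n → N ≤ n → GRProperty k n) ×
  (∀ M → (∀ n → M ≤ n → GRProperty k n) → N ≤ M)

-- Upper bound. Let Z be a smallest set of at least three vertices that every other vertex sees in a
-- single colour. By minimality, a colour that is disconnected on Z occurs there only between twins,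
-- which a count excludes; and at most two colours r, b are connected on Z (Gallai). Every vertex
-- outside Z sees Z in one colour, each colour being used by at most two such vertices, so Z together
-- with those of colour r or b has at least 18 vertices; after recolouring a few harmless edges it is
-- coloured by r and b only.
--
-- So everything rests on R(K₃,₃, K₃,₃) ≤ 18. For a vertex v with at least nine neighbours in a
-- colour, the traces of the other 17 neighbourhoods on N(v) are 17 blocks that pairwise meet in at
-- most two points. On 9 points such blocks have total size at most 68, with equality only if all
-- have size 4; on 10 + i points the total is at most 74 + 7 i. Summing these bounds over all
-- vertices leaves three degree sequences, in each of which some vertex v has too many blocks of
-- size 5 or 6 on N(v).
--
-- Lower bound. Extend the Paley graph on 17 vertices by k - 2 pairs of vertices, each pair being
-- joined to everything before it, and internally, in a new colour.

module Submission where

open import Defs renaming (sym to col-sym)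
open import Data.Bool using (Bool; true; false; not; _∧_; _∨_)
import Data.Bool as Bool
import Data.Bool.Properties as Bool
open import Data.Empty using (⊥; ⊥-elim)
open import Data.Fin using (Fin; zero; suc; punchIn; punchOut; toℕ; fromℕ<; _≟_)
import Data.Fin.Properties as F
open import Data.List using (List; []; _∷_)
open import Data.Nat hiding (_≟_; parity)
import Data.Nat as ℕ
open import Data.Nat.Induction using (<-wellFounded)
open import Data.Nat.Properties hiding (_≟_)
open import Data.Nat.Tactic.RingSolver using (solve-∀)
open import Data.Product using (Σ; _×_; _,_; _,′_; proj₁; proj₂)
open import Data.Sum using (_⊎_; inj₁; inj₂; [_,_]′)
open import Data.Unit using (tt)
import Data.Vec.Functional as V
open import Function using (_∘_; id; case_of_)
open import Induction.WellFounded using (Acc; acc)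
open import Relation.Binary.PropositionalEquality hiding ([_])
open import Relation.Nullary using (¬_; Dec; yes; no; does)
open import Relation.Nullary.Decidable
  using (True; toWitness; from-yes; map′; ¬?; _→-dec_; _⊎-dec_; _×-dec_; dec-true; dec-false)
open import Data.List.Membership.DecPropositional ℕ._≟_ using (_∈?_)
import Algebra.Properties.Semiring.Sum +-*-semiring as S

-- The count has hardly any slack, so single units decide it. Take nine vertices of degree 9 and
-- nine of degree 8 in one colour. Their squared degrees add up to 1305, but the nine-point bound
-- 68, used at every vertex in its colour of degree 9, would still allow 1314. Parity removes the
-- excess: 68 cannot be attained in both colours, so one colour may be given the bound 67. This
-- allows exactly 1305, so the sequence survives as a case of equality, and the structure forced by
-- equality has to be refuted separately. Parity is also what keeps a packing with a block of size 5
-- below 68.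

private variable
  m n : ℕ

-- Finite sums

infixl 10 ∑-syntax

opaque
  ∑ : (Fin n → ℕ) → ℕ
  ∑ = S.sum

∑-syntax : ∀ n → (Fin n → ℕ) → ℕ
∑-syntax n f = ∑ f

syntax ∑-syntax n (λ i → e) = ∑[ i < n ] e

opaque
  unfolding ∑

  ∑-cong : {f g : Fin n → ℕ} → (∀ i → f i ≡ g i) → ∑ f ≡ ∑ g
  ∑-cong = S.sum-cong-≗

  ∑-+ : (f g : Fin n → ℕ) → ∑[ i < n ] (f i + g i) ≡ ∑ f + ∑ g
  ∑-+ = S.∑-distrib-+

  ∑-comm : (f : Fin m → Fin n → ℕ) → ∑[ i < m ] ∑[ j < n ] f i j ≡ ∑[ j < n ] ∑[ i < m ] f i j
  ∑-comm = S.∑-comm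

  *-∑ : ∀ a (f : Fin n → ℕ) → a * ∑ f ≡ ∑[ i < n ] (a * f i)
  *-∑ = S.*-distribˡ-sum

  ∑-* : ∀ a (f : Fin n → ℕ) → ∑ f * a ≡ ∑[ i < n ] (f i * a)
  ∑-* = S.*-distribʳ-sum

  ∑-punchIn : (f : Fin (suc n) → ℕ) (x : Fin (suc n)) → ∑ f ≡ f x + ∑[ i < n ] f (punchIn x i)
  ∑-punchIn f x = S.sum-remove {i = x} f

  ∑-0 : (f : Fin 0 → ℕ) → ∑ f ≡ 0
  ∑-0 f = refl

  ∑-suc : (f : Fin (suc n) → ℕ) → ∑ f ≡ f zero + ∑ (f ∘ suc)
  ∑-suc f = refl

  ∑-mono : {f g : Fin n → ℕ} → (∀ i → f i ≤ g i) → ∑ f ≤ ∑ g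
  ∑-mono {zero}  p = z≤n
  ∑-mono {suc n} p = +-mono-≤ (p zero) (∑-mono (p ∘ suc))

  ∑-const : ∀ n c → ∑[ i < n ] c ≡ n * c
  ∑-const zero    c = refl
  ∑-const (suc n) c = cong (c +_) (∑-const n c)

  ∑-tight : {f g : Fin n → ℕ} → (∀ i → f i ≤ g i) → ∑ g ≤ ∑ f → ∀ i → f i ≡ g i
  ∑-tight {suc n} {f} {g} p q zero = ≤-antisym (p zero)
    (+-cancelʳ-≤ (∑ (g ∘ suc)) _ _ (≤-trans q (+-monoʳ-≤ (f zero) (∑-mono (p ∘ suc)))))
  ∑-tight {suc n} {f} {g} p q (suc i) = ∑-tight (p ∘ suc)
    (+-cancelˡ-≤ (g zero) _ _ (≤-trans q (+-monoˡ-≤ _ (p zero)))) i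

∑-zero : {f : Fin n → ℕ} → (∀ i → f i ≡ 0) → ∑ f ≡ 0
∑-zero {n} p = trans (∑-cong p) (trans (∑-const n 0) (*-zeroʳ n))

∑≥term : (f : Fin n → ℕ) (x : Fin n) → f x ≤ ∑ f
∑≥term {suc n} f x = subst (f x ≤_) (sym (∑-punchIn f x)) (m≤m+n (f x) _)

IsBit : ℕ → Set
IsBit a = a ≡ 0 ⊎ a ≡ 1

bit-≤1 : ∀ {a} → IsBit a → a ≤ 1
bit-≤1 (inj₁ refl) = z≤n
bit-≤1 (inj₂ refl) = s≤s z≤n

bit-* : ∀ {a b} → IsBit a → IsBit b → IsBit (a * b)
bit-* (inj₁ refl) _ = inj₁ refl
bit-* {b = b} (inj₂ refl) q = subst IsBit (sym (+-identityʳ b)) q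

bit-idem : ∀ {a} → IsBit a → a * a ≡ a
bit-idem (inj₁ refl) = refl
bit-idem (inj₂ refl) = refl

⟦_⟧ : Bool → ℕ
⟦ true  ⟧ = 1
⟦ false ⟧ = 0

⟦⟧-bit : ∀ b → IsBit ⟦ b ⟧
⟦⟧-bit true  = inj₂ refl
⟦⟧-bit false = inj₁ refl

ne : Fin n → Fin n → ℕ
ne x y = ⟦ not (does (x ≟ y)) ⟧

ne-bit : (x y : Fin n) → IsBit (ne x y)
ne-bit x y = ⟦⟧-bit _

ne-refl : (x : Fin n) → ne x x ≡ 0
ne-refl x = cong (λ b → ⟦ not b ⟧) (dec-true (x ≟ x) refl)

ne-≢ : {x y : Fin n} → x ≢ y → ne x y ≡ 1
ne-≢ {x = x} {y} p = cong (λ b → ⟦ not b ⟧) (dec-false (x ≟ y) p)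

ne-1 : {x y : Fin n} → ne x y ≡ 1 → x ≢ y
ne-1 {x = x} p refl with () ← trans (sym p) (ne-refl x)

infixl 8 _∖_
_∖_ : (Fin n → ℕ) → Fin n → Fin n → ℕ
(f ∖ x) y = ne x y * f y

∖-bit : {f : Fin n → ℕ} (x : Fin n) → (∀ y → IsBit (f y)) → ∀ y → IsBit ((f ∖ x) y)
∖-bit x b y = bit-* (ne-bit x y) (b y)

∖-≢ : (f : Fin n → ℕ) {x y : Fin n} → x ≢ y → (f ∖ x) y ≡ f y
∖-≢ f {x} {y} p rewrite ne-≢ p = +-identityʳ (f y)

∖-self : (f : Fin n → ℕ) (x : Fin n) → (f ∖ x) x ≡ 0
∖-self f x rewrite ne-refl x = refl

∖-1 : {f : Fin n → ℕ} {x y : Fin n} → (f ∖ x) y ≡ 1 → x ≢ y × f y ≡ 1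
∖-1 {f = f} {x} {y} p = ne-1 (m*n≡1⇒m≡1 (ne x y) (f y) p) , m*n≡1⇒n≡1 (ne x y) (f y) p

∖-≤ : (f : Fin n → ℕ) (x y : Fin n) → (f ∖ x) y ≤ f y
∖-≤ f x y = ≤-trans (*-monoˡ-≤ (f y) (bit-≤1 (ne-bit x y))) (≤-reflexive (*-identityˡ (f y)))

opaque
  unfolding ∑

  ∑-∖ : (f : Fin n → ℕ) (x : Fin n) → ∑ f ≡ f x + ∑ (f ∖ x)
  ∑-∖ {suc n} f zero = cong (f zero +_) (∑-cong (λ i → sym (+-identityʳ (f (suc i)))))
  ∑-∖ {suc n} f (suc x) rewrite ∑-∖ (f ∘ suc) x | +-identityʳ (f zero) =
    trans (sym (+-assoc (f zero) (f (suc x)) _))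
    (trans (cong (_+ ∑ ((f ∘ suc) ∖ x)) (+-comm (f zero) (f (suc x)))) (+-assoc (f (suc x)) (f zero) _))

-- Double counting of tuples of distinct points

falling : ℕ → ℕ → ℕ
falling zero    s = 1
falling (suc t) s = s * falling t (s ∸ 1)

-- Deleting x before the next point is chosen makes the t chosen points distinct.
Cov : ℕ → (Fin m → ℕ) → (Fin m → Fin n → ℕ) → (Fin n → ℕ) → ℕ → Set
Cov zero    c β D C = ∑ c ≤ C
Cov (suc t) c β D C = ∀ x → D x ≡ 1 → Cov t (λ j → c j * β j x) (λ j → β j ∖ x) (D ∖ x) C

-- Double counting of pairs of a block and an ordered `t`-tuple of distinct points in it: a block of
-- size s has `falling t s` such tuples, and `Cov` bounds the total weight of the blocks on any one
-- tuple of `D`. The weights make the induction work: fixing the first point x multiplies the weight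
-- of block j by `β j x`.
Cov-bound : ∀ t (c : Fin m → ℕ) (β : Fin m → Fin n → ℕ) (D : Fin n → ℕ) C →
  (∀ j x → IsBit (β j x)) → (∀ x → IsBit (D x)) → (∀ j x → D x ≡ 0 → β j x ≡ 0) →
  Cov t c β D C → ∑[ j < m ] (c j * falling t (∑ (β j))) ≤ C * falling t (∑ D)
Cov-bound {m} zero c β D C bβ bD sub cov = begin
  ∑[ j < m ] (c j * 1) ≡⟨ ∑-cong (λ j → *-identityʳ (c j)) ⟩
  ∑ c                ≤⟨ cov ⟩
  C                    ≡⟨ sym (*-identityʳ C) ⟩
  C * 1                ∎
  where open ≤-Reasoning
Cov-bound {m} {n} (suc t) c β D C bβ bD sub cov = begin
  ∑[ j < m ] (c j * (∑ (β j) * falling t (∑ (β j) ∸ 1)))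
    ≡⟨ ∑-cong expand ⟩
  ∑[ j < m ] ∑[ x < n ] (c j * β j x * falling t (∑ (β j ∖ x)))
    ≡⟨ ∑-comm (λ j x → c j * β j x * falling t (∑ (β j ∖ x))) ⟩
  ∑[ x < n ] ∑[ j < m ] (c j * β j x * falling t (∑ (β j ∖ x)))
    ≤⟨ ∑-mono point ⟩
  ∑[ x < n ] (D x * (C * falling t (∑ D ∸ 1)))
    ≡⟨ sym (∑-* (C * falling t (∑ D ∸ 1)) D) ⟩
  ∑ D * (C * falling t (∑ D ∸ 1))
    ≡⟨ swap (∑ D) C _ ⟩
  C * (∑ D * falling t (∑ D ∸ 1)) ∎
  where
  open ≤-Reasoning
  swap : ∀ a b c → a * (b * c) ≡ b * (a * c)
  swap = solve-∀
  drop1 : (f : Fin n → ℕ) (x : Fin n) → IsBit (f x) → f x * falling t (∑ f ∸ 1) ≡ f x * falling t (∑ (f ∖ x))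
  drop1 f x b = case b of λ where
    (inj₁ e) → trans (cong (_* falling t (∑ f ∸ 1)) e) (sym (cong (_* falling t (∑ (f ∖ x))) e))
    (inj₂ e) → cong (λ s → f x * falling t s) (trans (cong (_∸ 1) (∑-∖ f x)) (cong (λ a → a + ∑ (f ∖ x) ∸ 1) e))
  expand : ∀ j → c j * (∑ (β j) * falling t (∑ (β j) ∸ 1)) ≡ ∑[ x < n ] (c j * β j x * falling t (∑ (β j ∖ x)))
  expand j = begin-equality
    c j * (∑ (β j) * falling t (∑ (β j) ∸ 1))           ≡⟨ swap (c j) (∑ (β j)) _ ⟩
    ∑ (β j) * (c j * falling t (∑ (β j) ∸ 1))           ≡⟨ ∑-* _ (β j) ⟩
    ∑[ x < n ] (β j x * (c j * falling t (∑ (β j) ∸ 1)))  ≡⟨ ∑-cong (λ x →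
      trans (swap (β j x) (c j) _) (trans (cong (c j *_) (drop1 (β j) x (bβ j x))) (sym (*-assoc (c j) (β j x) _)))) ⟩
    ∑[ x < n ] (c j * β j x * falling t (∑ (β j ∖ x)))    ∎
  point : ∀ x → ∑[ j < m ] (c j * β j x * falling t (∑ (β j ∖ x))) ≤ D x * (C * falling t (∑ D ∸ 1))
  point x with bD x
  ... | inj₁ e = ≤-trans (≤-reflexive (∑-zero λ j →
        trans (cong (λ b → c j * b * falling t (∑ (β j ∖ x))) (sub j x e))
              (cong (_* falling t (∑ (β j ∖ x))) (*-zeroʳ (c j))))) z≤n
  ... | inj₂ e = ≤-trans
        (Cov-bound t (λ j → c j * β j x) (λ j → β j ∖ x) (D ∖ x) C
          (λ j → ∖-bit x (bβ j)) (∖-bit x bD)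
          (λ j y e′ → [ (λ q → cong (_* β j y) q) , (λ q → trans (cong (ne x y *_) (sub j y (trans (sym (*-identityˡ (D y))) (trans (cong (_* D y) (sym q)) e′)))) (*-zeroʳ (ne x y))) ]′ (ne-bit x y))
          (cov x e))
        (≤-reflexive (trans (cong (λ s → C * falling t s) (sym (trans (cong (_∸ 1) (∑-∖ D x)) (cong (λ a → a + ∑ (D ∖ x) ∸ 1) e))))
          (trans (sym (*-identityˡ _)) (cong (_* (C * falling t (∑ D ∸ 1))) (sym e)))))

≤-by-scaling : ∀ k {s q N : ℕ} → k * s ≤ N → N < k * suc q → s ≤ q
≤-by-scaling k {s} {q} h h′ = s≤s⁻¹ (*-cancelˡ-< k s (suc q) (≤-<-trans h h′))

-- Seventeen blocks that pairwise meet in at most two points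

-- `pair` and `trip` are two views of one condition, that no two blocks share three points: `pair`
-- sums over points, `trip` over blocks. The point set is an indicator `D`, so that deleting a point
-- leaves the index type unchanged.
record Packing (β : Fin m → Fin n → ℕ) (D : Fin n → ℕ) : Set where
  field
    bitβ : ∀ j x → IsBit (β j x)
    bitD : ∀ x → IsBit (D x)
    sub  : ∀ j x → D x ≡ 0 → β j x ≡ 0
    pair : ∀ i j → i ≢ j → ∑[ x < n ] (β i x * β j x) ≤ 2
    trip : ∀ x y z → x ≢ y → x ≢ z → y ≢ z → ∑[ j < m ] (β j x * β j y * β j z) ≤ 1
open Packing

size : (Fin m → Fin n → ℕ) → ℕ
size {m} β = ∑[ j < m ] ∑ (β j)

delete : {β : Fin m → Fin n → ℕ} {D : Fin n → ℕ} → Packing β D → ∀ x → Packing (λ j → β j ∖ x) (D ∖ x)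
delete {β = β} {D} P x = record
  { bitβ = λ j → ∖-bit x (bitβ P j)
  ; bitD = ∖-bit x (bitD P)
  ; sub  = λ j y e → [ (λ q → cong (_* β j y) q)
                     , (λ q → trans (cong (ne x y *_) (sub P j y (trans (sym (*-identityˡ (D y))) (trans (cong (_* D y) (sym q)) e))))
                                    (*-zeroʳ (ne x y))) ]′ (ne-bit x y)
  ; pair = λ i j d → ≤-trans (∑-mono λ y → *-mono-≤ (∖-≤ (β i) x y) (∖-≤ (β j) x y)) (pair P i j d)
  ; trip = λ a b c p q r → ≤-trans (∑-mono λ j → *-mono-≤ (*-mono-≤ (∖-≤ (β j) x a) (∖-≤ (β j) x b)) (∖-≤ (β j) x c)) (trip P a b c p q r)
  }

size-delete : (β : Fin m → Fin n → ℕ) (x : Fin n) → size β ≡ ∑[ j < m ] β j x + size (λ j → β j ∖ x)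
size-delete β x = trans (∑-cong (λ j → ∑-∖ (β j) x)) (∑-+ (λ j → β j x) (λ j → ∑ (β j ∖ x)))

sum-delete : {D : Fin n → ℕ} {x : Fin n} {s : ℕ} → ∑ D ≡ suc s → D x ≡ 1 → ∑ (D ∖ x) ≡ s
sum-delete {D = D} {x} e e′ = suc-injective (trans (cong (_+ ∑ (D ∖ x)) (sym e′)) (trans (sym (∑-∖ D x)) e))

-- Tight for the pairs (2,2), (1,3) and (0,4).
block-weight : ∀ k o → k ≤ 2 → o ≤ 4 → 24 * (k + o) ≤ 72 + (3 * (k * k * falling 2 o) + falling 3 o)
block-weight k o p q = subst₂ (λ a b → 24 * (a + b) ≤ 72 + (3 * (a * a * falling 2 b) + falling 3 b))
  {toℕ (fromℕ< (s≤s p))} {k} {toℕ (fromℕ< (s≤s q))} {o} (F.toℕ-fromℕ< (s≤s p)) (F.toℕ-fromℕ< (s≤s q)) (table (fromℕ< (s≤s p)) (fromℕ< (s≤s q)))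
  where
  R : Fin 3 → Fin 5 → Set
  R a b = 24 * (toℕ a + toℕ b) ≤ 72 + (3 * (toℕ a * toℕ a * falling 2 (toℕ b)) + falling 3 (toℕ b))
  R? : ∀ a b → Dec (R a b)
  R? a b = _ ≤? _
  table : ∀ a b → R a b
  table = from-yes (F.all? {P = λ a → ∀ b → R a b} λ a → F.all? {P = R a} (R? a))

∑-linear : ∀ c a (u v : Fin m → ℕ) → ∑[ i < m ] (c + (a * u i + v i)) ≡ m * c + (a * ∑ u + ∑ v)
∑-linear {m} c a u v = trans (∑-+ (λ _ → c) (λ i → a * u i + v i))
  (cong₂ _+_ (∑-const m c) (trans (∑-+ (λ i → a * u i) v) (cong (_+ ∑ v) (sym (*-∑ a u)))))

square≤double : ∀ {k} → k ≤ 2 → k * k ≤ 2 * k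
square≤double {k} h = *-monoˡ-≤ k h

half : ℕ → ℕ
half 2 = 1
half _ = 0

square-half : ∀ {k} → k ≤ 2 → k * k ≡ k + 2 * half k × 2 * half k ≤ k
square-half {0} _ = refl , z≤n
square-half {1} _ = refl , z≤n
square-half {2} _ = refl , ≤-refl
square-half {suc (suc (suc k))} (s≤s (s≤s ()))

-- `half k` is k choose 2, so k² = k + 2 `half k`. As 2 ∑ `half k` w ≤ ∑ k w ≤ 5, parity gives ∑
-- `half k` w ≤ 2 and the total 5 + 4. The plain estimate k² ≤ 2 k would give 10.
squares≤9 : (k w : Fin m → ℕ) → (∀ i → k i ≤ 2) → ∑[ i < m ] (k i * w i) ≤ 5 → ∑[ i < m ] (k i * k i * w i) ≤ 9
squares≤9 {m} k w k≤2 h = begin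
  ∑[ i < m ] (k i * k i * w i)                          ≡⟨ ∑-cong (λ i →
    trans (cong (_* w i) (proj₁ (square-half (k≤2 i)))) (dist (k i) (half (k i)) (w i))) ⟩
  ∑[ i < m ] (k i * w i + 2 * (half (k i) * w i))       ≡⟨ ∑-+ (λ i → k i * w i) _ ⟩
  ∑[ i < m ] (k i * w i) + ∑[ i < m ] (2 * (half (k i) * w i))
    ≡⟨ cong (∑[ i < m ] (k i * w i) +_) (sym (*-∑ 2 (λ i → half (k i) * w i))) ⟩
  ∑[ i < m ] (k i * w i) + 2 * h′
    ≤⟨ +-mono-≤ h (*-monoʳ-≤ 2 (≤-by-scaling 2 {h′} {2} {5} h″ ≤-refl)) ⟩
  9 ∎
  where
  open ≤-Reasoning
  h′ = ∑[ i < m ] (half (k i) * w i)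
  dist : ∀ a b c → (a + 2 * b) * c ≡ a * c + 2 * (b * c)
  dist = solve-∀
  h″ : 2 * h′ ≤ 5
  h″ = ≤-trans (≤-reflexive (*-∑ 2 (λ i → half (k i) * w i)))
       (≤-trans (∑-mono λ i → ≤-trans (≤-reflexive (sym (*-assoc 2 (half (k i)) (w i)))) (*-monoˡ-≤ (w i) (proj₂ (square-half (k≤2 i))))) h)

-- Split the points into the large block Q and its complement O; every other block
-- meets Q in at most two points, and blocks through a pair of O are disjoint on Q.
module LargeBlock {β : Fin 17 → Fin n → ℕ} {D : Fin n → ℕ} (P : Packing β D)
  (D9 : ∑ D ≡ 9) (j₀ : Fin 17) (large : 5 ≤ ∑ (β j₀)) where

  Q O : Fin n → ℕ
  Q = β j₀
  O x = D x ∸ Q x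

  B : Fin 16 → Fin n → ℕ
  B i = β (punchIn j₀ i)

  k o : Fin 16 → ℕ
  k i = ∑[ x < n ] (B i x * Q x)
  o i = ∑[ x < n ] (B i x * O x)

  D≡Q+O : ∀ x → D x ≡ Q x + O x
  D≡Q+O x with bitD P x
  ... | inj₁ e = trans e (sym (cong₂ _+_ (sub P j₀ x e) (trans (cong (_∸ Q x) e) (0∸n≡0 (Q x)))))
  ... | inj₂ e with bitβ P j₀ x
  ...   | inj₁ e′ = trans e (sym (cong₂ (λ a b → a + (b ∸ a)) e′ e))
  ...   | inj₂ e′ = trans e (sym (cong₂ (λ a b → a + (b ∸ a)) e′ e))

  bitO : ∀ x → IsBit (O x)
  bitO x with bitD P x
  ... | inj₁ e = inj₁ (trans (cong (_∸ Q x) e) (0∸n≡0 (Q x)))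
  ... | inj₂ e with bitβ P j₀ x
  ...   | inj₁ e′ = inj₂ (cong₂ _∸_ e e′)
  ...   | inj₂ e′ = inj₁ (cong₂ _∸_ e e′)

  Q+O≡9 : ∑ Q + ∑ O ≡ 9
  Q+O≡9 = trans (sym (∑-+ Q O)) (trans (sym (∑-cong D≡Q+O)) D9)

  O≤4 : ∑ O ≤ 4
  O≤4 = +-cancelˡ-≤ 5 _ _ (≤-trans (+-monoˡ-≤ (∑ O) large) (≤-reflexive Q+O≡9))

  k≤2 : ∀ i → k i ≤ 2
  k≤2 i = pair P (punchIn j₀ i) j₀ (F.punchInᵢ≢i j₀ i)

  o≤O : ∀ i → o i ≤ ∑ O
  o≤O i = ∑-mono λ x → ≤-trans (*-monoˡ-≤ (O x) (bit-≤1 (bitβ P _ x))) (≤-reflexive (*-identityˡ (O x)))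

  B≡k+o : ∀ i → ∑ (B i) ≡ k i + o i
  B≡k+o i = trans (∑-cong point) (∑-+ (λ x → B i x * Q x) (λ x → B i x * O x))
    where
    point : ∀ x → B i x ≡ B i x * Q x + B i x * O x
    point x with bitD P x
    ... | inj₁ e rewrite sub P (punchIn j₀ i) x e = refl
    ... | inj₂ e = trans (sym (*-identityʳ (B i x))) (trans (cong (B i x *_) (trans (sym e) (D≡Q+O x))) (*-distribˡ-+ (B i x) (Q x) (O x)))

  Bo : Fin 16 → Fin n → ℕ
  Bo i x = B i x * O x

  bitBo : ∀ i x → IsBit (Bo i x)
  bitBo i x = bit-* (bitβ P _ x) (bitO x)

  subBo : ∀ i x → O x ≡ 0 → Bo i x ≡ 0
  subBo i x e = trans (cong (B i x *_) e) (*-zeroʳ (B i x))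

  trip′ : ∀ x y z → x ≢ y → x ≢ z → y ≢ z → ∑[ i < 16 ] (B i x * B i y * B i z) ≤ 1
  trip′ x y z p q r = ≤-trans (m≤n+m _ (β j₀ x * β j₀ y * β j₀ z))
    (≤-trans (≤-reflexive (sym (∑-punchIn (λ j → β j x * β j y * β j z) j₀))) (trip P x y z p q r))

  Q≢O : ∀ {x z} → O x ≡ 1 → Q z ≡ 1 → x ≢ z
  Q≢O {x} e e′ refl with () ← trans (sym e) (trans (cong (D x ∸_) e′) (m≤n⇒m∸n≡0 (bit-≤1 (bitD P x))))

  Bo≤B : ∀ i x → Bo i x ≤ B i x
  Bo≤B i x = ≤-trans (*-monoʳ-≤ (B i x) (bit-≤1 (bitO x))) (≤-reflexive (*-identityʳ (B i x)))

  through-pair : ∀ x y → O x ≡ 1 → O y ≡ 1 → x ≢ y → ∑[ i < 16 ] (k i * (Bo i x * Bo i y)) ≤ ∑ Q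
  through-pair x y ex ey x≢y = begin
    ∑[ i < 16 ] (k i * (Bo i x * Bo i y))                    ≤⟨ ∑-mono (λ i → *-monoʳ-≤ (k i) (*-mono-≤ (Bo≤B i x) (Bo≤B i y))) ⟩
    ∑[ i < 16 ] (k i * (B i x * B i y))                      ≡⟨ ∑-cong (λ i → ∑-* (B i x * B i y) (λ z → B i z * Q z)) ⟩
    ∑[ i < 16 ] ∑[ z < n ] (B i z * Q z * (B i x * B i y))   ≡⟨ ∑-comm (λ i z → B i z * Q z * (B i x * B i y)) ⟩
    ∑[ z < n ] ∑[ i < 16 ] (B i z * Q z * (B i x * B i y))   ≡⟨ ∑-cong (λ z → trans
         (∑-cong (λ i → arr (B i z) (Q z) (B i x) (B i y))) (sym (*-∑ (Q z) (λ i → B i x * B i y * B i z)))) ⟩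
    ∑[ z < n ] (Q z * ∑[ i < 16 ] (B i x * B i y * B i z))   ≤⟨ ∑-mono point ⟩
    ∑ Q ∎
    where
    open ≤-Reasoning
    arr : ∀ a b c d → a * b * (c * d) ≡ b * (c * d * a)
    arr = solve-∀
    point : ∀ z → Q z * ∑[ i < 16 ] (B i x * B i y * B i z) ≤ Q z
    point z with bitβ P j₀ z
    ... | inj₁ e rewrite e = z≤n
    ... | inj₂ e = ≤-trans (*-monoʳ-≤ (Q z) (trip′ x y z x≢y (Q≢O ex e) (Q≢O ey e))) (≤-reflexive (*-identityʳ (Q z)))

  cov₂ : ∀ C → (∀ (w : Fin 16 → ℕ) → ∑[ i < 16 ] (k i * w i) ≤ ∑ Q → ∑[ i < 16 ] (k i * k i * w i) ≤ C) →
         Cov 2 (λ i → k i * k i) Bo O C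
  cov₂ C h x ex y ey with ∖-1 {f = O} {x} {y} ey
  ... | x≢y , ey′ = ≤-trans
    (≤-reflexive (∑-cong (λ i → trans (cong (k i * k i * Bo i x *_) (∖-≢ (Bo i) x≢y)) (*-assoc (k i * k i) (Bo i x) (Bo i y)))))
    (h (λ i → Bo i x * Bo i y) (through-pair x y ex ey′ x≢y))

  cov₃ : Cov 3 (λ _ → 1) Bo O 1
  cov₃ x ex y ey z ez with ∖-1 {f = O} {x} {y} ey | ∖-1 {f = O ∖ x} {y} {z} ez
  ... | x≢y , _ | y≢z , ez′ with ∖-1 {f = O} {x} {z} ez′
  ...   | x≢z , _ = ≤-trans (∑-mono λ i → *-mono-≤ (*-mono-≤ (≤-trans (≤-reflexive (*-identityˡ _)) (Bo≤B i x))
            (≤-trans (≤-reflexive (∖-≢ (Bo i) x≢y)) (Bo≤B i y)))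
            (≤-trans (≤-reflexive (trans (∖-≢ (Bo i ∖ x) y≢z) (∖-≢ (Bo i) x≢z))) (Bo≤B i z))) (trip′ x y z x≢y x≢z y≢z)

  -- Summing `block-weight` over the sixteen other blocks leaves ordered pairs of `O`, weighted by
  -- k², and ordered triples of `O`. A pair carries weight at most `C`, and a triple lies in at most
  -- one block.
  total : ∀ C → Cov 2 (λ i → k i * k i) Bo O C →
          24 * ∑[ i < 16 ] ∑ (B i) ≤ 16 * 72 + (3 * (C * falling 2 (∑ O)) + falling 3 (∑ O))
  total C cov = begin
    24 * ∑[ i < 16 ] ∑ (B i)                       ≡⟨ *-∑ 24 (λ i → ∑ (B i)) ⟩
    ∑[ i < 16 ] (24 * ∑ (B i))                     ≤⟨ ∑-mono weight ⟩
    ∑[ i < 16 ] (72 + (3 * u i + v i))               ≡⟨ ∑-linear 72 3 u v ⟩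
    16 * 72 + (3 * ∑ u + ∑ v)                       ≤⟨ +-monoʳ-≤ (16 * 72) (+-mono-≤
        (*-monoʳ-≤ 3 (Cov-bound 2 (λ i → k i * k i) Bo O C bitBo bitO subBo cov))
        (≤-trans (≤-reflexive (∑-cong (λ i → sym (*-identityˡ (v i)))))
                 (≤-trans (Cov-bound 3 (λ _ → 1) Bo O 1 bitBo bitO subBo cov₃) (≤-reflexive (*-identityˡ _))))) ⟩
    16 * 72 + (3 * (C * falling 2 (∑ O)) + falling 3 (∑ O))   ∎
    where
    open ≤-Reasoning
    u v : Fin 16 → ℕ
    u i = k i * k i * falling 2 (o i)
    v i = falling 3 (o i)
    weight : ∀ i → 24 * ∑ (B i) ≤ 72 + (3 * u i + v i)
    weight i = subst (λ z → 24 * z ≤ 72 + (3 * u i + v i)) (sym (B≡k+o i)) (block-weight (k i) (o i) (k≤2 i) (≤-trans (o≤O i) O≤4))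

  doubled : ∀ (w : Fin 16 → ℕ) → ∑[ i < 16 ] (k i * w i) ≤ ∑ Q → ∑[ i < 16 ] (k i * k i * w i) ≤ 2 * ∑ Q
  doubled w h = ≤-trans (∑-mono λ i → ≤-trans (*-monoˡ-≤ (w i) (square≤double (k≤2 i))) (≤-reflexive (*-assoc 2 (k i) (w i))))
    (≤-trans (≤-reflexive (sym (*-∑ 2 (λ i → k i * w i)))) (*-monoʳ-≤ 2 h))

  case-q : ∀ q p → q + p ≡ 9 → p ≤ 4 → ∑ Q ≡ q → ∑ O ≡ p → size β ≤ 67
  case-q q p q+p p≤4 eq ep = subst (_≤ 67) (sym (∑-punchIn (λ j → ∑ (β j)) j₀)) (finish p q+p p≤4 ep)
    where
    general : ∀ {s} C → Cov 2 (λ i → k i * k i) Bo O C → 16 * 72 + (3 * (C * falling 2 p) + falling 3 p) < 24 * suc s →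
              q + s ≤ 67 → ∑ Q + ∑[ i < 16 ] ∑ (B i) ≤ 67
    general {s} C cov lt h = ≤-trans (+-mono-≤ (≤-reflexive eq)
      (≤-by-scaling 24 (subst (λ z → 24 * ∑[ i < 16 ] ∑ (B i) ≤ 16 * 72 + (3 * (C * falling 2 z) + falling 3 z)) ep (total C cov)) lt)) h
    via-double : ∀ {s} → 16 * 72 + (3 * (2 * q * falling 2 p) + falling 3 p) < 24 * suc s →
              q + s ≤ 67 → ∑ Q + ∑[ i < 16 ] ∑ (B i) ≤ 67
    via-double = general (2 * q) (cov₂ (2 * q) λ w h → subst (λ z → ∑[ i < 16 ] (k i * k i * w i) ≤ 2 * z) eq (doubled w h))
    finish : ∀ p′ → q + p′ ≡ 9 → p′ ≤ 4 → ∑ O ≡ p′ → ∑ Q + ∑[ i < 16 ] ∑ (B i) ≤ 67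
    -- A block of size 5 needs the parity gain: with 10 in place of 9 the other sixteen blocks would
    -- be bounded by 64 instead of 62, and the total by 69.
    finish 4 e _ ep′ with refl ← +-cancelʳ-≡ 4 q 5 e | refl ← trans (sym ep) ep′ =
      general {62} 9 (cov₂ 9 λ w h → squares≤9 k w k≤2 (≤-trans h (≤-reflexive eq))) (<ᵇ⇒< _ _ tt) (≤ᵇ⇒≤ _ _ tt)
    finish 3 e _ ep′ with refl ← +-cancelʳ-≡ 3 q 6 e | refl ← trans (sym ep) ep′ =
      via-double {57} (<ᵇ⇒< _ _ tt) (≤ᵇ⇒≤ _ _ tt)
    finish 2 e _ ep′ with refl ← +-cancelʳ-≡ 2 q 7 e | refl ← trans (sym ep) ep′ =
      via-double {60} (<ᵇ⇒< _ _ tt) (≤ᵇ⇒≤ _ _ tt)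
    finish 1 e _ ep′ with refl ← +-cancelʳ-≡ 1 q 8 e | refl ← trans (sym ep) ep′ =
      via-double {50} (<ᵇ⇒< _ _ tt) (≤ᵇ⇒≤ _ _ tt)
    finish 0 e _ ep′ with refl ← +-cancelʳ-≡ 0 q 9 e | refl ← trans (sym ep) ep′ =
      via-double {50} (<ᵇ⇒< _ _ tt) (≤ᵇ⇒≤ _ _ tt)
    finish (suc (suc (suc (suc (suc _))))) _ (s≤s (s≤s (s≤s (s≤s ())))) _

  size≤67 : size β ≤ 67
  size≤67 = case-q (∑ Q) (∑ O) Q+O≡9 O≤4 refl refl

nine-dichotomy : {β : Fin 17 → Fin n → ℕ} {D : Fin n → ℕ} → Packing β D → ∑ D ≡ 9 →
  size β ≤ 67 ⊎ (∀ j → ∑ (β j) ≤ 4)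
nine-dichotomy {β = β} P e with F.any? (λ j → 5 ≤? ∑ (β j))
... | yes (j , h) = inj₁ (LargeBlock.size≤67 P e j h)
... | no ¬h       = inj₂ λ j → s≤s⁻¹ (≰⇒> λ h → ¬h (j , h))

nine-bound : {β : Fin 17 → Fin n → ℕ} {D : Fin n → ℕ} → Packing β D → ∑ D ≡ 9 → size β ≤ 68
nine-bound P e with nine-dichotomy P e
... | inj₁ h = ≤-trans h (n≤1+n 67)
... | inj₂ h = ≤-trans (∑-mono h) (≤-reflexive (∑-const 17 4))

nine-tight : {β : Fin 17 → Fin n → ℕ} {D : Fin n → ℕ} → Packing β D → ∑ D ≡ 9 → 68 ≤ size β →
  ∀ j → ∑ (β j) ≡ 4
nine-tight {β = β} P e big with nine-dichotomy P e
... | inj₁ h = ⊥-elim (<⇒≱ (s≤s h) big)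
... | inj₂ h = ∑-tight h (≤-trans (≤-reflexive (∑-const 17 4)) big)

-- Applied with `s` the total size and `c` a bound for what is left after the deletion of any one
-- point: every incidence survives all deletions but one.
average : {β : Fin m → Fin n → ℕ} {D : Fin n → ℕ} → Packing β D → ∀ {s c} →
  (∀ x → D x ≡ 1 → s ≤ c + ∑[ j < m ] β j x) → ∑ D * s ≤ ∑ D * c + size β
average {m} {n} {β} {D} P {s} {c} h = begin
  ∑ D * s                                         ≡⟨ ∑-* s D ⟩
  ∑[ x < n ] (D x * s)                            ≤⟨ ∑-mono point ⟩
  ∑[ x < n ] (D x * c + ∑[ j < m ] β j x)         ≡⟨ ∑-+ (λ x → D x * c) (λ x → ∑[ j < m ] β j x) ⟩
  ∑[ x < n ] (D x * c) + ∑[ x < n ] ∑[ j < m ] β j x ≡⟨ cong₂ _+_ (sym (∑-* c D)) (∑-comm (λ x j → β j x)) ⟩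
  ∑ D * c + size β                                ∎
  where
  open ≤-Reasoning
  point : ∀ x → D x * s ≤ D x * c + ∑[ j < m ] β j x
  point x with bitD P x
  ... | inj₁ e rewrite e = z≤n
  ... | inj₂ e = subst (λ d → d * s ≤ d * c + ∑[ j < m ] β j x) (sym e)
                   (subst₂ _≤_ (sym (*-identityˡ s)) (cong (_+ ∑[ j < m ] β j x) (sym (*-identityˡ c))) (h x e))

-- Suppose the size exceeds 74. If the deletion of some x left 68, all remaining blocks would have
-- size 4; those through x would use disjoint sets of 4 · 3 ordered pairs out of 9 · 8, so there
-- would be at most 6 of them and the total would be at most 74. Hence every deletion leaves at most
-- 67, and averaging gives 9 · size ≤ 670 < 9 · 75.
ten-bound : {β : Fin 17 → Fin n → ℕ} {D : Fin n → ℕ} → Packing β D → ∑ D ≡ 10 → size β ≤ 74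
ten-bound {n} {β} {D} P e with size β ≤? 74
... | yes h = h
... | no ¬h = ≤-by-scaling 9 {size β} {74} {670}
    (+-cancelʳ-≤ (size β) _ _ (≤-trans (≤-reflexive (+-comm (9 * size β) (size β)))
      (subst (λ z → z * size β ≤ z * 67 + size β) {∑ D} {10} e (average P point))))
    (≤ᵇ⇒≤ _ _ tt)
  where
  r : Fin n → ℕ
  r x = ∑[ j < 17 ] β j x
  point : ∀ x → D x ≡ 1 → size β ≤ 67 + r x
  point x ex with size (λ j → β j ∖ x) ≤? 67
  ... | yes h = ≤-trans (≤-reflexive (trans (size-delete β x) (+-comm (r x) _))) (+-monoˡ-≤ (r x) h)
  ... | no ¬h′ = ⊥-elim (¬h (≤-trans (≤-reflexive (size-delete β x))
          (+-mono-≤ (≤-by-scaling 12 {r x} {6} {72} r12 (≤ᵇ⇒≤ _ _ tt)) (nine-bound P′ e′))))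
    where
    P′ = delete P x
    e′ = sum-delete {D = D} e ex
    four : ∀ j → ∑ (β j ∖ x) ≡ 4
    four = nine-tight P′ e′ (≰⇒> ¬h′)
    r12 : 12 * r x ≤ 72
    r12 = begin
      12 * r x                                                 ≡⟨ *-comm 12 (r x) ⟩
      r x * 12                                                 ≡⟨ ∑-* 12 (λ j → β j x) ⟩
      ∑[ j < 17 ] (β j x * 12)                                 ≡⟨ ∑-cong (λ j → cong (λ z → β j x * falling 2 z) (sym (four j))) ⟩
      ∑[ j < 17 ] (β j x * falling 2 (∑ (β j ∖ x)))                 ≤⟨ Cov-bound 2 (λ j → β j x) (λ j → β j ∖ x) (D ∖ x) 1
                                                                   (bitβ P′) (bitD P′) (sub P′) cov ⟩
      1 * falling 2 (∑ (D ∖ x))                                     ≡⟨ cong (λ z → 1 * falling 2 z) e′ ⟩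
      72                                                       ∎
      where
      open ≤-Reasoning
      cov : Cov 2 (λ j → β j x) (λ j → β j ∖ x) (D ∖ x) 1
      cov y ey z ez with ∖-1 {f = D} {x} {y} ey | ∖-1 {f = D ∖ x} {y} {z} ez
      ... | x≢y , _ | y≢z , ez′ with ∖-1 {f = D} {x} {z} ez′
      ...   | x≢z , _ = ≤-trans (∑-mono λ j → *-mono-≤ (*-monoʳ-≤ (β j x) (∖-≤ (β j) x y))
                          (≤-trans (∖-≤ (β j ∖ x) y z) (∖-≤ (β j) x z))) (trip P x y z x≢y x≢z y≢z)

-- Averaging over deletions again. Since 74 + 7 i = 7 (10 + i) + 4, the quotient of (11 + i)(74 + 7
-- i) by 10 + i is 74 + 7 (i + 1) with remainder 4, which rounding discards; hence 7 for each
-- further point.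
large-bound : ∀ i {β : Fin 17 → Fin n → ℕ} {D : Fin n → ℕ} → Packing β D → ∑ D ≡ 10 + i → size β ≤ 74 + 7 * i
large-bound zero P e = ten-bound P e
large-bound {n} (suc i) {β} {D} P e = ≤-by-scaling (10 + i) {size β} {74 + 7 * suc i} {(11 + i) * (74 + 7 * i)}
    (+-cancelʳ-≤ (size β) _ _ (≤-trans (≤-reflexive (+-comm ((10 + i) * size β) (size β))) averaged))
    (subst ((11 + i) * (74 + 7 * i) <_) (arith i) (m<m+n _ (s≤s z≤n)))
  where
  arith : ∀ i → (11 + i) * (74 + 7 * i) + suc (5 + i) ≡ (10 + i) * suc (74 + 7 * suc i)
  arith = solve-∀
  averaged : (11 + i) * size β ≤ (11 + i) * (74 + 7 * i) + size β
  averaged = subst (λ z → z * size β ≤ z * (74 + 7 * i) + size β) {∑ D} {11 + i} (trans e (+-suc 10 i)) (average P λ x ex →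
    ≤-trans (≤-reflexive (trans (size-delete β x) (+-comm (∑[ j < 17 ] β j x) _)))
      (+-monoˡ-≤ _ (large-bound i (delete P x) (sum-delete {D = D} (trans e (+-suc 10 i)) ex))))

-- Neighbourhoods in a two-colouring of K₁₈

∑-∖∖ : (f : Fin n → ℕ) {v j : Fin n} → v ≢ j → ∑ f ≡ f v + (f j + ∑ (f ∖ v ∖ j))
∑-∖∖ f {v} {j} p = trans (∑-∖ f v) (cong (f v +_) (trans (∑-∖ (f ∖ v) j) (cong (_+ ∑ (f ∖ v ∖ j)) (∖-≢ f p))))

∖-cong : {f g : Fin n → ℕ} {v j : Fin n} → (∀ w → v ≢ w → j ≢ w → f w ≡ g w) →
  ∀ w → (f ∖ v ∖ j) w ≡ (g ∖ v ∖ j) w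
∖-cong {f = f} {g} {v} {j} h w = case ((j ≟ w) ,′ (v ≟ w)) of λ where
  (yes refl , _)       → trans (∖-self (f ∖ v) j) (sym (∖-self (g ∖ v) j))
  (no _ , yes refl)    → cong (ne j v *_) (trans (∖-self f v) (sym (∖-self g v)))
  (no p , no q)        → cong (λ z → ne j w * (ne v w * z)) (h w q p)

deg : (Fin 18 → Fin 18 → ℕ) → Fin 18 → ℕ
deg e v = ∑ (e v)

codeg : (Fin 18 → Fin 18 → ℕ) → Fin 18 → Fin 18 → ℕ
codeg e v j = ∑[ w < 18 ] (e v w * e j w)

codegs : (Fin 18 → Fin 18 → ℕ) → Fin 18 → ℕ
codegs e v = ∑[ i < 17 ] codeg e v (punchIn v i)

record Graph (e : Fin 18 → Fin 18 → ℕ) : Set where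
  field
    bit  : ∀ x y → IsBit (e x y)
    symm : ∀ x y → e x y ≡ e y x
    irr  : ∀ x → e x x ≡ 0
    k33  : ∀ x y z → x ≢ y → x ≢ z → y ≢ z → ∑[ w < 18 ] (e x w * e y w * e z w) ≤ 2
open Graph

module _ {e : Fin 18 → Fin 18 → ℕ} (G : Graph e) (v : Fin 18) where

  blocks : Fin 17 → Fin 18 → ℕ
  blocks i x = e v x * e (punchIn v i) x

  blocks-packing : Packing blocks (e v)
  blocks-packing = record
    { bitβ = λ i x → bit-* (bit G v x) (bit G _ x)
    ; bitD = bit G v
    ; sub  = λ i x q → cong (_* e (punchIn v i) x) q
    ; pair = λ i j i≢j → ≤-trans (≤-reflexive (∑-cong (λ x → merge (bit G v x) (e (punchIn v i) x) (e (punchIn v j) x))))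
        (k33 G v (punchIn v i) (punchIn v j) (F.punchInᵢ≢i v i ∘ sym) (F.punchInᵢ≢i v j ∘ sym) (i≢j ∘ F.punchIn-injective v i j))
    ; trip = triple
    }
    where
    merge : ∀ {a} → IsBit a → ∀ b c → a * b * (a * c) ≡ a * b * c
    merge (inj₁ refl) b c = refl
    merge (inj₂ refl) b c = cong (1 * b *_) (*-identityˡ c)
    triple : ∀ x y z → x ≢ y → x ≢ z → y ≢ z → ∑[ i < 17 ] (blocks i x * blocks i y * blocks i z) ≤ 1
    triple x y z p q r with bit G v x
    ... | inj₁ a = ≤-trans (≤-reflexive (∑-zero λ i → cong (λ t → t * e (punchIn v i) x * blocks i y * blocks i z) a)) z≤n
    ... | inj₂ a with bit G v y
    ...   | inj₁ b = ≤-trans (≤-reflexive (∑-zero λ i → trans (cong (λ t → blocks i x * (t * e (punchIn v i) y) * blocks i z) b)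
                                                          (cong (_* blocks i z) (*-zeroʳ (blocks i x))))) z≤n
    ...   | inj₂ b with bit G v z
    ...     | inj₁ c = ≤-trans (≤-reflexive (∑-zero λ i → trans (cong (λ t → blocks i x * blocks i y * (t * e (punchIn v i) z)) c)
                                                            (*-zeroʳ (blocks i x * blocks i y)))) z≤n
    -- All three points are neighbours of v, so v is one of their at most two common neighbours and
    -- only one is left for the blocks.
    ...     | inj₂ c = +-cancelˡ-≤ 1 _ _ (≤-trans (≤-reflexive (sym whole)) (k33 G x y z p q r))
      where
      f : Fin 18 → ℕ
      f j = e x j * e y j * e z j
      one : ∀ {a} → a ≡ 1 → ∀ b → b ≡ a * b
      one refl b = sym (*-identityˡ b)
      whole : ∑ f ≡ 1 + ∑[ i < 17 ] (blocks i x * blocks i y * blocks i z)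
      whole = trans (∑-punchIn f v) (cong₂ _+_
        (cong₂ _*_ (cong₂ _*_ (trans (symm G x v) a) (trans (symm G y v) b)) (trans (symm G z v) c))
        (∑-cong λ i → cong₂ _*_ (cong₂ _*_ (trans (symm G x _) (one a _)) (trans (symm G y _) (one b _)))
                                 (trans (symm G z _) (one c _))))

  codegs≤68 : deg e v ≡ 9 → codegs e v ≤ 68
  codegs≤68 = nine-bound blocks-packing

  codegs-tight : deg e v ≡ 9 → 68 ≤ codegs e v → ∀ j → v ≢ j → codeg e v j ≡ 4
  codegs-tight d h j v≢j = subst (λ z → codeg e v z ≡ 4) (F.punchIn-punchOut v≢j)
    (nine-tight blocks-packing d h (punchOut v≢j))

  codegs-large : ∀ i → deg e v ≡ 10 + i → codegs e v ≤ 74 + 7 * i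
  codegs-large i = large-bound i blocks-packing

  -- Both sides count the walks of length two from v; `deg e v` of them return to v.
  codegs+deg : codegs e v + deg e v ≡ ∑[ w < 18 ] (e v w * deg e w)
  codegs+deg = begin
    codegs e v + deg e v                        ≡⟨ +-comm (codegs e v) (deg e v) ⟩
    deg e v + codegs e v                        ≡⟨ cong (_+ codegs e v) (∑-cong (λ w → sym (bit-idem (bit G v w)))) ⟩
    codeg e v v + codegs e v                    ≡⟨ sym (∑-punchIn (codeg e v) v) ⟩
    ∑[ j < 18 ] ∑[ w < 18 ] (e v w * e j w)     ≡⟨ ∑-comm (λ j w → e v w * e j w) ⟩
    ∑[ w < 18 ] ∑[ j < 18 ] (e v w * e j w)     ≡⟨ ∑-cong (λ w → trans (sym (*-∑ (e v w) (λ j → e j w)))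
                                                     (cong (e v w *_) (∑-cong (λ j → symm G j w)))) ⟩
    ∑[ w < 18 ] (e v w * deg e w)               ∎
    where open ≡-Reasoning

-- Double counting over pairs of selected blocks, with r² ≥ 5 r - 6 at every point.
johnson : {e : Fin 18 → Fin 18 → ℕ} → Graph e → (b : Fin 18) (t : Fin 18 → ℕ) → (∀ a → IsBit (t a)) → t b ≡ 0 →
  4 * ∑[ a < 18 ] (t a * codeg e b a) ≤ 2 * (∑ t * (∑ t ∸ 1)) + 6 * deg e b
johnson {e} G b t bt tb = +-cancelˡ-≤ M _ _ (begin
  M + 4 * M                                       ≡⟨ cong (5 *_) M≡∑r ⟩
  5 * ∑ r                                         ≡⟨ *-∑ 5 r ⟩
  ∑[ x < 18 ] (5 * r x)                           ≤⟨ ∑-mono point ⟩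
  ∑[ x < 18 ] (r x * r x + 6 * e b x)             ≡⟨ ∑-+ (λ x → r x * r x) (λ x → 6 * e b x) ⟩
  ∑[ x < 18 ] (r x * r x) + ∑[ x < 18 ] (6 * e b x) ≤⟨ +-mono-≤ squares (≤-reflexive (sym (*-∑ 6 (e b)))) ⟩
  M + 2 * (∑ t * (∑ t ∸ 1)) + 6 * deg e b         ≡⟨ +-assoc M _ _ ⟩
  M + (2 * (∑ t * (∑ t ∸ 1)) + 6 * deg e b)       ∎)
  where
  open ≤-Reasoning
  M = ∑[ a < 18 ] (t a * codeg e b a)
  β : Fin 18 → Fin 18 → ℕ
  β a x = e b x * e a x
  r : Fin 18 → ℕ
  r x = ∑[ a < 18 ] (t a * β a x)
  M≡∑r : M ≡ ∑ r
  M≡∑r = trans (∑-cong (λ a → *-∑ (t a) (β a))) (∑-comm (λ a x → t a * β a x))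
  quad : ∀ s → 5 * s ≤ s * s + 6
  quad 0 = z≤n
  quad 1 = ≤ᵇ⇒≤ _ _ tt
  quad 2 = ≤ᵇ⇒≤ _ _ tt
  quad (suc (suc (suc s))) = subst (5 * (3 + s) ≤_) (sym (arith s)) (m≤m+n _ _)
    where
    arith : ∀ s → (3 + s) * (3 + s) + 6 ≡ 5 * (3 + s) + (s * s + s)
    arith = solve-∀
  point : ∀ x → 5 * r x ≤ r x * r x + 6 * e b x
  point x with bit G b x
  ... | inj₁ q = ≤-trans (≤-reflexive (trans (cong (5 *_) r0) (*-zeroʳ 5))) z≤n
    where
    r0 : r x ≡ 0
    r0 = ∑-zero λ a → trans (cong (λ z → t a * (z * e a x)) q) (*-zeroʳ (t a))
  ... | inj₂ q = ≤-trans (quad (r x)) (≤-reflexive (cong (λ z → r x * r x + 6 * z) (sym q)))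
  meet : ∀ a c → a ≢ c → t a ≡ 1 → t c ≡ 1 → ∑[ x < 18 ] (β a x * β c x) ≤ 2
  meet a c a≢c ta tc = ≤-trans (∑-mono (λ x → merge (bit G b x) (e a x) (e c x)))
    (k33 G b a c (λ { refl → 0≢1+n (trans (sym tb) ta) }) (λ { refl → 0≢1+n (trans (sym tb) tc) }) a≢c)
    where
    merge : ∀ {s} → IsBit s → ∀ u w → s * u * (s * w) ≤ s * u * w
    merge (inj₁ refl) u w = z≤n
    merge (inj₂ refl) u w = ≤-reflexive (cong (1 * u *_) (*-identityˡ w))
  squares : ∑[ x < 18 ] (r x * r x) ≤ M + 2 * (∑ t * (∑ t ∸ 1))
  squares = begin
    ∑[ x < 18 ] (r x * r x)
      ≡⟨ ∑-cong (λ x → trans (∑-* (r x) (λ a → t a * β a x)) (∑-cong λ a → *-∑ (t a * β a x) (λ c → t c * β c x))) ⟩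
    ∑[ x < 18 ] ∑[ a < 18 ] ∑[ c < 18 ] (t a * β a x * (t c * β c x))
      ≡⟨ ∑-comm (λ x a → ∑[ c < 18 ] (t a * β a x * (t c * β c x))) ⟩
    ∑[ a < 18 ] ∑[ x < 18 ] ∑[ c < 18 ] (t a * β a x * (t c * β c x))
      ≡⟨ ∑-cong (λ a → ∑-comm (λ x c → t a * β a x * (t c * β c x))) ⟩
    ∑[ a < 18 ] ∑[ c < 18 ] ∑[ x < 18 ] (t a * β a x * (t c * β c x))
      ≡⟨ ∑-cong (λ a → trans (∑-cong (λ c → trans (∑-cong (λ x → arr (t a) (β a x) (t c) (β c x)))
           (trans (sym (*-∑ (t a) (λ x → t c * (β a x * β c x)))) (cong (t a *_) (sym (*-∑ (t c) (λ x → β a x * β c x)))))))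
           (sym (*-∑ (t a) (λ c → t c * ∑[ x < 18 ] (β a x * β c x))))) ⟩
    ∑[ a < 18 ] (t a * ∑[ c < 18 ] (t c * ∑[ x < 18 ] (β a x * β c x)))
      ≤⟨ ∑-mono row ⟩
    ∑[ a < 18 ] (t a * codeg e b a + t a * (2 * (∑ t ∸ 1)))
      ≡⟨ ∑-+ (λ a → t a * codeg e b a) (λ a → t a * (2 * (∑ t ∸ 1))) ⟩
    M + ∑[ a < 18 ] (t a * (2 * (∑ t ∸ 1)))
      ≡⟨ cong (M +_) (trans (sym (∑-* (2 * (∑ t ∸ 1)) t)) (arr′ (∑ t) (∑ t ∸ 1))) ⟩
    M + 2 * (∑ t * (∑ t ∸ 1)) ∎
    where
    arr : ∀ p q u w → p * q * (u * w) ≡ p * (u * (q * w))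
    arr = solve-∀
    arr′ : ∀ p q → p * (2 * q) ≡ 2 * (p * q)
    arr′ = solve-∀
    row : ∀ a → t a * ∑[ c < 18 ] (t c * ∑[ x < 18 ] (β a x * β c x)) ≤ t a * codeg e b a + t a * (2 * (∑ t ∸ 1))
    row a with bt a
    ... | inj₁ q rewrite q = z≤n
    ... | inj₂ q = ≤-trans (*-monoʳ-≤ (t a) inner) (≤-reflexive (*-distribˡ-+ (t a) _ _))
      where
      f : Fin 18 → ℕ
      f c = t c * ∑[ x < 18 ] (β a x * β c x)
      fa : f a ≡ codeg e b a
      fa = trans (cong₂ _*_ q (∑-cong λ x → bit-idem (bit-* (bit G b x) (bit G a x)))) (*-identityˡ _)
      rest : ∀ c → (f ∖ a) c ≤ 2 * (t ∖ a) c
      rest c = case ((a ≟ c) ,′ bt c) of λ where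
        (yes refl , _) → ≤-trans (≤-reflexive (∖-self f a)) z≤n
        (no a≢c , inj₁ q′) → ≤-trans (≤-reflexive (trans (∖-≢ f a≢c) (cong (_* ∑[ x < 18 ] (β a x * β c x)) q′))) z≤n
        (no a≢c , inj₂ q′) → ≤-trans (≤-reflexive (trans (∖-≢ f a≢c) (trans (cong (_* ∑[ x < 18 ] (β a x * β c x)) q′) (*-identityˡ _))))
                (≤-trans (meet a c a≢c q q′) (≤-reflexive (sym (cong (2 *_) (trans (∖-≢ t a≢c) q′)))))
      t∖a : ∑ (t ∖ a) ≡ ∑ t ∸ 1
      t∖a = sym (trans (cong (_∸ 1) (∑-∖ t a)) (cong (λ z → z + ∑ (t ∖ a) ∸ 1) q))
      inner : ∑ f ≤ codeg e b a + 2 * (∑ t ∸ 1)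
      inner = ≤-trans (≤-reflexive (∑-∖ f a)) (+-mono-≤ (≤-reflexive fa)
        (≤-trans (∑-mono rest) (≤-reflexive (trans (sym (*-∑ 2 (t ∖ a))) (cong (2 *_) t∖a)))))

-- Degree sequences

nth : List ℕ → ℕ → ℕ
nth []       _       = 0
nth (x ∷ xs) zero    = x
nth (x ∷ xs) (suc i) = nth xs i

-- cP q is the maximum over d ≥ 9 of (8 + q) d + 4 + [d = 9] - d² (or 0 if that is negative),
-- cQ q the minimum over d ≤ 8 of d² + 149 - (8 + q) d.
cP cQ : ℕ → ℕ
cP = nth (0 ∷ 5 ∷ 14 ∷ 23 ∷ 32 ∷ 41 ∷ 50 ∷ 59 ∷ 68 ∷ 77 ∷ 86 ∷ 95 ∷ 104 ∷ 114 ∷ 125 ∷ 136 ∷ 148 ∷ 160 ∷ 173 ∷ [])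
cQ = nth (133 ∷ 129 ∷ 124 ∷ 119 ∷ 113 ∷ 107 ∷ 100 ∷ 93 ∷ 85 ∷ 77 ∷ 69 ∷ 61 ∷ 53 ∷ 45 ∷ 37 ∷ 29 ∷ 21 ∷ 13 ∷ 5 ∷ [])

δ₉ : ℕ → ℕ
δ₉ 9 = 1
δ₉ _ = 0

forAll? : ∀ N (P : ℕ → Set) → (∀ x → Dec (P x)) → Dec (∀ (i : Fin N) → P (toℕ i))
forAll? N P P? = F.all? {P = λ i → P (toℕ i)} (λ i → P? (toℕ i))

below : ∀ N (P : ℕ → Set) (P? : ∀ x → Dec (P x)) → {True (forAll? N P P?)} → ∀ {x} → x < N → P x
below N P P? {t} h = subst P (F.toℕ-fromℕ< h) (toWitness {a? = forAll? N P P?} t (fromℕ< h))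

below₂ : ∀ M N (P : ℕ → ℕ → Set) (P? : ∀ x y → Dec (P x y)) →
  {True (forAll? M (λ x → ∀ (j : Fin N) → P x (toℕ j)) (λ x → forAll? N (P x) (P? x)))} →
  ∀ {x y} → x < M → y < N → P x y
below₂ M N P P? {t} {x} h h′ = subst (P x) (F.toℕ-fromℕ< h′)
  (below M (λ x → ∀ (j : Fin N) → P x (toℕ j)) (λ x → forAll? N (P x) (P? x)) {t} h (fromℕ< h′))

-- What the summed estimates leave if exactly q vertices have degree at most 8: each of these causes
-- a deficit of at least `cQ q`, and each of the others makes up for at most `cP q`.
Balanced : ℕ → Set
Balanced q = q * cQ q ≤ (18 ∸ q) * cP q

balanced : ∀ {q} → q < 19 → Balanced q → q ≡ 0 ⊎ q ≡ 6 ⊎ q ≡ 8 ⊎ q ≡ 9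
balanced = below 19 _ λ q → ((q * cQ q) ≤? ((18 ∸ q) * cP q)) →-dec ((q ℕ.≟ 0) ⊎-dec ((q ℕ.≟ 6) ⊎-dec ((q ℕ.≟ 8) ⊎-dec (q ℕ.≟ 9))))

cap-P : ∀ {q d} → q < 19 → d < 18 → 9 ≤ d → (8 + q) * d + (4 + δ₉ d) ≤ d * d + cP q
cap-P = below₂ 19 18 _ λ q d → (9 ≤? d) →-dec (((8 + q) * d + (4 + δ₉ d)) ≤? (d * d + cP q))

cap-Q : ∀ {q d} → q < 19 → d < 18 → d ≤ 8 → (8 + q) * d + cQ q ≤ d * d + 149
cap-Q = below₂ 19 18 _ λ q d → (d ≤? 8) →-dec (((8 + q) * d + cQ q) ≤? (d * d + 149))

tight-P : ∀ {q d} → q < 19 → d < 18 → Balanced q → 9 ≤ d →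
  d * d + cP q ≤ (8 + q) * d + (4 + δ₉ d) → d ≡ 9 × 1 ≤ q
tight-P = below₂ 19 18 _ λ q d → ((q * cQ q) ≤? ((18 ∸ q) * cP q)) →-dec ((9 ≤? d) →-dec (((d * d + cP q) ≤? ((8 + q) * d + (4 + δ₉ d))) →-dec ((d ℕ.≟ 9) ×-dec (1 ≤? q))))

-- For q = 6, 8, 9 this is the minimiser of d² - (8 + q) d over d ≤ 8: half of 8 + q, cut off at 8.
d₀ : ℕ → ℕ
d₀ 6 = 7
d₀ _ = 8

tight-Q : ∀ {q d} → q < 19 → d < 18 → Balanced q → 1 ≤ q → d ≤ 8 →
  d * d + 149 ≤ (8 + q) * d + cQ q → d ≡ d₀ q
tight-Q = below₂ 19 18 _ λ q d → ((q * cQ q) ≤? ((18 ∸ q) * cP q)) →-dec ((1 ≤? q) →-dec ((d ≤? 8) →-dec (((d * d + 149) ≤? ((8 + q) * d + cQ q)) →-dec (d ℕ.≟ d₀ q))))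

module _ {E Ē : Fin 18 → Fin 18 → ℕ} (G : Graph E) (Ḡ : Graph Ē)
  (comp : ∀ x y → x ≢ y → E x y + Ē x y ≡ 1) where

  comp-ne : ∀ v w → E v w + Ē v w ≡ ne v w
  comp-ne v w = case v ≟ w of λ where
    (yes refl) → trans (cong₂ _+_ (irr G v) (irr Ḡ v)) (sym (ne-refl v))
    (no v≢w)   → trans (comp v w v≢w) (sym (ne-≢ v≢w))

  ∑-comp : ∀ v (c : Fin 18 → ℕ) → ∑[ w < 18 ] (E v w * c w) + ∑[ w < 18 ] (Ē v w * c w) + c v ≡ ∑ c
  ∑-comp v c = begin
    ∑[ w < 18 ] (E v w * c w) + ∑[ w < 18 ] (Ē v w * c w) + c v
      ≡⟨ cong (_+ c v) (sym (∑-+ (λ w → E v w * c w) (λ w → Ē v w * c w))) ⟩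
    ∑[ w < 18 ] (E v w * c w + Ē v w * c w) + c v
      ≡⟨ cong (_+ c v) (∑-cong (λ w → trans (sym (*-distribʳ-+ (c w) (E v w) (Ē v w))) (cong (_* c w) (comp-ne v w)))) ⟩
    ∑ (c ∖ v) + c v  ≡⟨ +-comm (∑ (c ∖ v)) (c v) ⟩
    c v + ∑ (c ∖ v)  ≡⟨ sym (∑-∖ c v) ⟩
    ∑ c              ∎
    where open ≡-Reasoning

  deg+deg : ∀ v → deg E v + deg Ē v ≡ 17
  deg+deg v = suc-injective (begin
    suc (deg E v + deg Ē v)  ≡⟨ sym (+-comm (deg E v + deg Ē v) 1) ⟩
    deg E v + deg Ē v + 1    ≡⟨ cong₂ (λ a b → a + b + 1) (∑-cong λ w → sym (*-identityʳ (E v w))) (∑-cong λ w → sym (*-identityʳ (Ē v w))) ⟩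
    ∑[ w < 18 ] (E v w * 1) + ∑[ w < 18 ] (Ē v w * 1) + 1  ≡⟨ ∑-comp v (λ _ → 1) ⟩
    ∑[ w < 18 ] 1            ≡⟨ ∑-const 18 1 ⟩
    18                       ∎)
    where open ≡-Reasoning

  -- Inclusion and exclusion on the 16 vertices other than v and j: those outside both
  -- `E`-neighbourhoods are the common `Ē`-neighbours. An `E`-edge between v and j is counted in
  -- both degrees, hence the last term.
  codeg-complement : ∀ v j → v ≢ j → codeg Ē v j + deg E v + deg E j ≡ 16 + codeg E v j + 2 * E v j
  codeg-complement v j v≢j = +-cancelʳ-≡ 2 _ _ (begin
    codeg Ē v j + deg E v + deg E j + 2
      ≡⟨ cong (λ z → z + deg E j + 2) (sym (∑-+ (λ w → Ē v w * Ē j w) (E v))) ⟩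
    ∑[ w < 18 ] (Ē v w * Ē j w + E v w) + deg E j + 2
      ≡⟨ cong (_+ 2) (sym (∑-+ (λ w → Ē v w * Ē j w + E v w) (E j))) ⟩
    ∑ f + 2
      ≡⟨ cong (_+ 2) (∑-∖∖ f v≢j) ⟩
    f v + (f j + ∑ (f ∖ v ∖ j)) + 2
      ≡⟨ cong₂ (λ a b → a + (b + ∑ (f ∖ v ∖ j)) + 2) fv fj ⟩
    E v j + (E v j + ∑ (f ∖ v ∖ j)) + 2
      ≡⟨ cong (λ z → E v j + (E v j + z) + 2) (∑-cong (∖-cong {f = f} {g} point)) ⟩
    E v j + (E v j + ∑ (g ∖ v ∖ j)) + 2
      ≡⟨ arr (E v j) (∑ (g ∖ v ∖ j)) ⟩
    1 + (1 + ∑ (g ∖ v ∖ j)) + 2 * E v j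
      ≡⟨ cong (_+ 2 * E v j) (sym (trans (∑-∖∖ g v≢j) (cong₂ (λ a b → a + (b + ∑ (g ∖ v ∖ j))) gv gj))) ⟩
    ∑ g + 2 * E v j
      ≡⟨ cong (_+ 2 * E v j) (trans (∑-+ (λ _ → 1) (λ w → E v w * E j w)) (cong (_+ codeg E v j) (∑-const 18 1))) ⟩
    18 + codeg E v j + 2 * E v j
      ≡⟨ arr′ (codeg E v j) (2 * E v j) ⟩
    16 + codeg E v j + 2 * E v j + 2 ∎)
    where
    open ≡-Reasoning
    arr : ∀ a b → a + (a + b) + 2 ≡ 1 + (1 + b) + 2 * a
    arr = solve-∀
    arr′ : ∀ a b → 18 + a + b ≡ 16 + a + b + 2
    arr′ = solve-∀
    f g : Fin 18 → ℕ
    f w = Ē v w * Ē j w + E v w + E j w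
    g w = 1 + E v w * E j w
    fv : f v ≡ E v j
    fv = trans (cong₂ (λ a b → a * Ē j v + b + E j v) (irr Ḡ v) (irr G v)) (symm G j v)
    fj : f j ≡ E v j
    fj = trans (cong₂ (λ a b → Ē v j * a + E v j + b) (irr Ḡ j) (irr G j)) (trans (+-identityʳ _) (cong (_+ E v j) (*-zeroʳ (Ē v j))))
    gv : g v ≡ 1
    gv = cong (λ a → 1 + a * E j v) (irr G v)
    gj : g j ≡ 1
    gj = trans (cong (λ a → 1 + E v j * a) (irr G j)) (cong suc (*-zeroʳ (E v j)))
    bits : ∀ {a ā b b̄} → IsBit a → IsBit b → a + ā ≡ 1 → b + b̄ ≡ 1 → ā * b̄ + a + b ≡ 1 + a * b
    bits (inj₁ refl) (inj₁ refl) refl refl = refl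
    bits (inj₁ refl) (inj₂ refl) refl refl = refl
    bits (inj₂ refl) (inj₁ refl) refl refl = refl
    bits (inj₂ refl) (inj₂ refl) refl refl = refl
    point : ∀ w → v ≢ w → j ≢ w → f w ≡ g w
    point w p q = bits (bit G v w) (bit G j w) (comp v w p) (comp j w q)

  nsum : Fin 18 → ℕ
  nsum v = ∑[ w < 18 ] (E v w * deg E w)

  -- Writing `deg Ē w` as 17 - `deg E w` turns the sum over the `Ē`-neighbours into 17 (17 -
  -- `deg E v`) minus their part of `∑ (deg E)`; so 289 is 17².
  nsum-complement : ∀ v → ∑[ w < 18 ] (Ē v w * deg Ē w) + 16 * deg E v + ∑ (deg E) ≡ nsum v + 289
  nsum-complement v = begin
    N̄ + 16 * deg E v + ∑ (deg E)                          ≡⟨ cong (N̄ + 16 * deg E v +_) (sym (∑-comp v (deg E))) ⟩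
    N̄ + 16 * deg E v + (nsum v + X + deg E v)     ≡⟨ arr N̄ (deg E v) (nsum v) X ⟩
    nsum v + (17 * deg E v + (X + N̄))             ≡⟨ cong (λ z → nsum v + (17 * deg E v + z)) X+N̄ ⟩
    nsum v + (17 * deg E v + deg Ē v * 17)        ≡⟨ cong (nsum v +_) (trans (arr′ (deg E v) (deg Ē v)) (cong (17 *_) (deg+deg v))) ⟩
    nsum v + 289                                  ∎
    where
    open ≡-Reasoning
    N̄ = ∑[ w < 18 ] (Ē v w * deg Ē w)
    X = ∑[ w < 18 ] (Ē v w * deg E w)
    arr : ∀ a d n x → a + 16 * d + (n + x + d) ≡ n + (17 * d + (x + a))
    arr = solve-∀
    arr′ : ∀ a b → 17 * a + b * 17 ≡ 17 * (a + b)
    arr′ = solve-∀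
    X+N̄ : X + N̄ ≡ deg Ē v * 17
    X+N̄ = trans (sym (∑-+ (λ w → Ē v w * deg E w) (λ w → Ē v w * deg Ē w)))
      (trans (∑-cong λ w → trans (sym (*-distribˡ-+ (Ē v w) (deg E w) (deg Ē w))) (cong (Ē v w *_) (deg+deg w)))
             (sym (∑-* 17 (Ē v))))

  ∑-nsum : ∑ nsum ≡ ∑[ v < 18 ] (deg E v * deg E v)
  ∑-nsum = trans (∑-comm (λ v w → E v w * deg E w))
    (∑-cong λ w → trans (sym (∑-* (deg E w) (λ v → E v w))) (cong (_* deg E w) (∑-cong λ v → symm G v w)))

∑-positive : (f : Fin n → ℕ) → 1 ≤ ∑ f → Σ (Fin n) λ x → 1 ≤ f x
∑-positive {n} f h with F.any? (λ x → 1 ≤? f x)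
... | yes w = w
... | no ¬w = ⊥-elim (<⇒≱ h (≤-reflexive (∑-zero λ x → n≤0⇒n≡0 (s≤s⁻¹ (≰⇒> λ p → ¬w (x , p))))))

-- N v is the sum of the degrees of the neighbours of v. The packing bounds at v, taken in colour E
-- if d v ≥ 9 and in colour Ē otherwise, bound N v from above; summed over all v and compared with
-- ∑ N = ∑ d², they leave only q = 6, 8 or 9, with equality everywhere.
module Unbalanced {E Ē : Fin 18 → Fin 18 → ℕ} (G : Graph E) (Ḡ : Graph Ē)
  (comp : ∀ x y → x ≢ y → E x y + Ē x y ≡ 1)
  (low-codegs : ∀ v → deg E v ≡ 8 → codegs Ē v ≤ 67) where

  d κ π N : Fin 18 → ℕ
  d v = deg E v
  κ v = ⟦ does (d v ≤? 8) ⟧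
  π v = ⟦ not (does (d v ≤? 8)) ⟧
  N   = nsum G Ḡ comp

  p q Δ : ℕ
  p = ∑ π
  q = ∑ κ
  Δ = ∑ d

  p+q : p + q ≡ 18
  p+q = trans (sym (∑-+ π κ)) (trans (∑-cong (λ v → flip-bit (does (d v ≤? 8)))) (∑-const 18 1))
    where
    flip-bit : ∀ b → ⟦ not b ⟧ + ⟦ b ⟧ ≡ 1
    flip-bit true  = refl
    flip-bit false = refl

  q<19 : q < 19
  q<19 = s≤s (≤-trans (m≤n+m q p) (≤-reflexive p+q))

  d<18 : ∀ v → d v < 18
  d<18 v = s≤s (≤-trans (m≤m+n (d v) (deg Ē v)) (≤-reflexive (deg+deg G Ḡ comp v)))

  data Side (v : Fin 18) : Set where
    high : 9 ≤ d v → π v ≡ 1 → κ v ≡ 0 → Side v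
    low  : d v ≤ 8 → π v ≡ 0 → κ v ≡ 1 → Side v

  side : ∀ v → Side v
  side v with d v ≤? 8
  ... | yes h = low h (cong (λ b → ⟦ not b ⟧) (dec-true (d v ≤? 8) h)) (cong ⟦_⟧ (dec-true (d v ≤? 8) h))
  ... | no h  = high (≰⇒> h) (cong (λ b → ⟦ not b ⟧) (dec-false (d v ≤? 8) h)) (cong ⟦_⟧ (dec-false (d v ≤? 8) h))

  -- At degree 10 + i this is 74 + 7 i plus the degree. At degree 9 the formula 4 + 8 d falls one
  -- short of 68 + 9, which `δ₉` makes up.
  high-bound : ∀ v → 9 ≤ d v → N v ≤ 4 + 8 * d v + δ₉ (d v)
  high-bound v h with m≤n⇒∃[o]m+o≡n h
  ... | zero , e = subst (λ z → N v ≤ 4 + 8 * z + δ₉ z) {9} {d v} e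
          (≤-trans (≤-reflexive (sym (codegs+deg G v))) (+-mono-≤ (codegs≤68 G v (sym e)) (≤-reflexive (sym e))))
  ... | suc i , e = subst (λ z → N v ≤ 4 + 8 * z + δ₉ z) {10 + i} {d v} e
          (≤-trans (≤-reflexive (sym (codegs+deg G v))) (≤-trans (+-mono-≤ (codegs-large G v i (sym e)) (≤-reflexive (sym e)))
            (≤-reflexive (trans (arith i) (sym (+-identityʳ _))))))
    where
    arith : ∀ i → 74 + 7 * i + (10 + i) ≡ 4 + 8 * (10 + i)
    arith = solve-∀

  -- If v has 9 + o neighbours in `Ē`, the packing bounds merge into 67 + 7 o; for o = 0 this is
  -- `low-codegs`. Passing to the complement turns 289 - 140 into 149.
  low-bound : ∀ v → d v ≤ 8 → N v + 149 ≤ Δ + 8 * d v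
  low-bound v h with m≤n⇒∃[o]m+o≡n h
  ... | o , e = +-cancelʳ-≤ 140 _ _ (begin
      N v + 149 + 140                            ≡⟨ +-assoc (N v) 149 140 ⟩
      N v + 289                                  ≡⟨ sym (nsum-complement G Ḡ comp v) ⟩
      ∑[ w < 18 ] (Ē v w * deg Ē w) + 16 * d v + Δ ≡⟨ cong (λ z → z + 16 * d v + Δ) (sym (codegs+deg Ḡ v)) ⟩
      codegs Ē v + deg Ē v + 16 * d v + Δ       ≤⟨ +-monoˡ-≤ Δ (+-monoˡ-≤ (16 * d v) (+-mono-≤ (bound o e) (≤-reflexive ē))) ⟩
      67 + 7 * o + (9 + o) + 16 * d v + Δ       ≡⟨ arith o (d v) Δ ⟩
      76 + 8 * (d v + o) + 8 * d v + Δ          ≡⟨ cong (λ z → 76 + 8 * z + 8 * d v + Δ) {d v + o} {8} e ⟩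
      140 + 8 * d v + Δ                         ≡⟨ arith′ (8 * d v) Δ ⟩
      Δ + 8 * d v + 140                         ∎)
    where
    open ≤-Reasoning
    arith : ∀ o d t → 67 + 7 * o + (9 + o) + 16 * d + t ≡ 76 + 8 * (d + o) + 8 * d + t
    arith = solve-∀
    arith′ : ∀ d t → 140 + d + t ≡ t + d + 140
    arith′ = solve-∀
    ē : deg Ē v ≡ 9 + o
    ē = +-cancelˡ-≡ (d v) _ _ (trans (deg+deg G Ḡ comp v) (sym (trans (arith″ (d v) o) (cong (9 +_) e))))
      where
      arith″ : ∀ d o → d + (9 + o) ≡ 9 + (d + o)
      arith″ = solve-∀
    bound : ∀ o → d v + o ≡ 8 → codegs Ē v ≤ 67 + 7 * o
    bound zero e = low-codegs v (trans (sym (+-identityʳ (d v))) e)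
    bound (suc i) e = ≤-trans (codegs-large Ḡ v i (+-cancelˡ-≡ (d v) _ _ (trans (deg+deg G Ḡ comp v) (sym (trans (arith″ (d v) i) (cong (9 +_) e))))))
        (≤-reflexive (arith‴ i))
      where
      arith″ : ∀ d i → d + (10 + i) ≡ 9 + (d + suc i)
      arith″ = solve-∀
      arith‴ : ∀ i → 74 + 7 * i ≡ 67 + 7 * suc i
      arith‴ = solve-∀

  -- Each low vertex brings a whole `Δ` into its upper bound. Spreading `q * Δ` as `q * d v` over
  -- all vertices leaves at each vertex an inequality in its own degree alone, governed by d² - (8 +
  -- q) d; `cP` and `cQ` are the resulting extreme values.
  f g : Fin 18 → ℕ
  f v = N v + q * d v + κ v * cQ q
  g v = d v * d v + (π v * cP q + κ v * Δ)

  high-gap : ∀ v → 9 ≤ d v → N v + q * d v ≤ (8 + q) * d v + (4 + δ₉ (d v))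
  high-gap v h = ≤-trans (+-monoˡ-≤ (q * d v) (high-bound v h)) (≤-reflexive (arith (δ₉ (d v)) (d v) q))
    where
    arith : ∀ z d q → 4 + 8 * d + z + q * d ≡ (8 + q) * d + (4 + z)
    arith = solve-∀

  low-gap : ∀ v → d v ≤ 8 → N v + q * d v + cQ q + 149 ≤ Δ + ((8 + q) * d v + cQ q)
  low-gap v h = ≤-trans (≤-reflexive (arith (N v) (q * d v) (cQ q)))
    (≤-trans (+-monoˡ-≤ (q * d v + cQ q) (low-bound v h)) (≤-reflexive (arith′ Δ (d v) q (cQ q))))
    where
    arith : ∀ n x c → n + x + c + 149 ≡ n + 149 + (x + c)
    arith = solve-∀
    arith′ : ∀ t d q c → t + 8 * d + (q * d + c) ≡ t + ((8 + q) * d + c)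
    arith′ = solve-∀

  high-values : ∀ v → π v ≡ 1 → κ v ≡ 0 → f v ≡ N v + q * d v × g v ≡ d v * d v + cP q
  high-values v a b = trans (cong (λ z → N v + q * d v + z * cQ q) b) (+-identityʳ _)
    , cong (d v * d v +_) (trans (cong₂ (λ x y → x * cP q + y * Δ) a b) (trans (+-identityʳ _) (*-identityˡ (cP q))))

  low-values : ∀ v → π v ≡ 0 → κ v ≡ 1 → f v ≡ N v + q * d v + cQ q × g v ≡ d v * d v + Δ
  low-values v a b = cong (N v + q * d v +_) (trans (cong (_* cQ q) b) (*-identityˡ (cQ q)))
    , cong (d v * d v +_) (trans (cong₂ (λ x y → x * cP q + y * Δ) a b) (*-identityˡ Δ))

  f≤g : ∀ v → f v ≤ g v
  f≤g v with side v
  ... | high h a b = subst₂ _≤_ (sym (proj₁ (high-values v a b))) (sym (proj₂ (high-values v a b)))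
          (≤-trans (high-gap v h) (cap-P q<19 (d<18 v) h))
  ... | low h a b = subst₂ _≤_ (sym (proj₁ (low-values v a b))) (sym (proj₂ (low-values v a b)))
          (+-cancelʳ-≤ 149 _ _ (≤-trans (low-gap v h) (≤-trans (+-monoʳ-≤ Δ (cap-Q q<19 (d<18 v) h)) (≤-reflexive (arith Δ (d v * d v))))))
    where
    arith : ∀ t x → t + (x + 149) ≡ x + t + 149
    arith = solve-∀

  D₂ : ℕ
  D₂ = ∑[ v < 18 ] (d v * d v)

  ∑f : ∑ f ≡ D₂ + q * Δ + q * cQ q
  ∑f = trans (∑-+ (λ v → N v + q * d v) (λ v → κ v * cQ q)) (cong₂ _+_
    (trans (∑-+ N (λ v → q * d v)) (cong₂ _+_ (∑-nsum G Ḡ comp) (sym (*-∑ q d)))) (sym (∑-* (cQ q) κ)))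

  ∑g : ∑ g ≡ D₂ + q * Δ + (18 ∸ q) * cP q
  ∑g = trans (∑-+ (λ v → d v * d v) (λ v → π v * cP q + κ v * Δ)) (trans (cong (D₂ +_)
    (trans (∑-+ (λ v → π v * cP q) (λ v → κ v * Δ)) (cong₂ _+_ (sym (∑-* (cP q) π)) (sym (∑-* Δ κ)))))
    (trans (cong (λ z → D₂ + (z * cP q + q * Δ)) (sym (trans (cong (_∸ q) (sym p+q)) (m+n∸n≡m p q)))) (arith D₂ ((18 ∸ q) * cP q) (q * Δ))))
    where
    arith : ∀ a b c → a + (b + c) ≡ a + c + b
    arith = solve-∀

  bal : Balanced q
  bal = +-cancelˡ-≤ (D₂ + q * Δ) _ _ (subst₂ _≤_ ∑f ∑g (∑-mono f≤g))

  module Tight (g≤f : ∀ v → f v ≡ g v) where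

    high-tight : ∀ v → 9 ≤ d v → π v ≡ 1 → κ v ≡ 0 → d v ≡ 9 × 1 ≤ q
    high-tight v h a b = tight-P q<19 (d<18 v) bal h
      (≤-trans (≤-reflexive (trans (sym (proj₂ (high-values v a b))) (trans (sym (g≤f v)) (proj₁ (high-values v a b))))) (high-gap v h))

    high-N : ∀ v → 9 ≤ d v → π v ≡ 1 → κ v ≡ 0 → N v ≡ 77
    high-N v h a b = ≤-antisym (subst (λ z → N v ≤ 4 + 8 * z + δ₉ z) {d v} {9} e (high-bound v h))
        (+-cancelʳ-≤ (q * 9) 77 (N v) (≤-trans (≤-trans (≤-reflexive (arith q)) cap) (≤-reflexive tight)))
      where
      e : d v ≡ 9
      e = proj₁ (high-tight v h a b)
      arith : ∀ q → 77 + q * 9 ≡ (8 + q) * 9 + 5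
      arith = solve-∀
      cap : (8 + q) * 9 + 5 ≤ 81 + cP q
      cap = subst (λ z → (8 + q) * z + (4 + δ₉ z) ≤ z * z + cP q) {d v} {9} e (cap-P q<19 (d<18 v) h)
      tight : 81 + cP q ≡ N v + q * 9
      tight = subst (λ z → z * z + cP q ≡ N v + q * z) {d v} {9} e
        (trans (sym (proj₂ (high-values v a b))) (trans (sym (g≤f v)) (proj₁ (high-values v a b))))

    low-tight : 1 ≤ q → ∀ v → d v ≤ 8 → π v ≡ 0 → κ v ≡ 1 → d v ≡ d₀ q × N v + 149 ≡ Δ + 8 * d v
    low-tight 1≤q v h a b = tight-Q q<19 (d<18 v) bal 1≤q h
        (+-cancelˡ-≤ Δ _ _ (≤-trans (≤-reflexive (trans (arith Δ (d v * d v)) (cong (_+ 149) (sym e)))) (low-gap v h)))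
      , ≤-antisym (low-bound v h) (+-cancelʳ-≤ (q * d v + cQ q) _ _ (begin
          Δ + 8 * d v + (q * d v + cQ q)    ≡⟨ arith₁ Δ (d v) q (cQ q) ⟩
          Δ + ((8 + q) * d v + cQ q)        ≤⟨ +-monoʳ-≤ Δ (cap-Q q<19 (d<18 v) h) ⟩
          Δ + (d v * d v + 149)             ≡⟨ trans (arith Δ (d v * d v)) (cong (_+ 149) (sym e)) ⟩
          N v + q * d v + cQ q + 149         ≡⟨ arith₂ (N v) (q * d v) (cQ q) ⟩
          N v + 149 + (q * d v + cQ q)       ∎))
      where
      open ≤-Reasoning
      arith : ∀ t x → t + (x + 149) ≡ x + t + 149
      arith = solve-∀
      arith₁ : ∀ t d q c → t + 8 * d + (q * d + c) ≡ t + ((8 + q) * d + c)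
      arith₁ = solve-∀
      arith₂ : ∀ n x c → n + x + c + 149 ≡ n + 149 + (x + c)
      arith₂ = solve-∀
      e : N v + q * d v + cQ q ≡ d v * d v + Δ
      e = trans (sym (proj₁ (low-values v a b))) (trans (g≤f v) (proj₂ (low-values v a b)))

    -- Equality leaves high vertices of degree 9 with all codegrees 4, and low vertices of degree
    -- `d₀ q`. The degree sum over the `Ē`-neighbours of a low vertex b then determines how many of
    -- them are low, and so the number `ρ` of high `E`-neighbours of b. Each of the latter gives a
    -- block of size `13 ∸ d₀ q` on the `D₀` neighbours of b in `Ē`, too large for `johnson`.
    module AtLow (1≤q : 1 ≤ q) (b : Fin 18) (hb : d b ≤ 8) (πb : π b ≡ 0) (κb : κ b ≡ 1)
      (D₀ o : ℕ) (d₀+D₀ : d₀ q + D₀ ≡ 17) (D₀≡8+o : D₀ ≡ 8 + o) where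

      db : d b ≡ d₀ q
      db = proj₁ (low-tight 1≤q b hb πb κb)

      d̄-low : ∀ v → d v ≡ d₀ q → deg Ē v ≡ D₀
      d̄-low v e = +-cancelˡ-≡ (d₀ q) _ _ (trans (cong (_+ deg Ē v) (sym e)) (trans (deg+deg G Ḡ comp v) (sym d₀+D₀)))

      nA nB ρ : ℕ
      nA = ∑[ w < 18 ] (Ē b w * π w)
      nB = ∑[ w < 18 ] (Ē b w * κ w)
      ρ  = ∑[ w < 18 ] (E b w * π w)

      d̄ : ∀ w → deg Ē w ≡ 8 + κ w * o
      d̄ w with side w
      ... | high h a c = trans (+-cancelˡ-≡ 9 _ _ (trans (cong (_+ deg Ē w) (sym (proj₁ (high-tight w h a c)))) (deg+deg G Ḡ comp w)))
                           (cong (λ z → 8 + z * o) (sym c))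
      ... | low h a c = trans (d̄-low w (proj₁ (low-tight 1≤q w h a c))) (trans D₀≡8+o (cong (8 +_) (trans (sym (*-identityˡ o)) (cong (_* o) (sym c)))))

      N̄ : 8 * D₀ + nB * o + 8 * d₀ q ≡ 140
      N̄ = +-cancelʳ-≡ (8 * d₀ q + Δ + 149) _ _ (begin
        8 * D₀ + nB * o + 8 * d₀ q + (8 * d₀ q + Δ + 149)
          ≡⟨ arith (8 * D₀ + nB * o) (d₀ q) Δ ⟩
        8 * D₀ + nB * o + 16 * d₀ q + Δ + 149
          ≡⟨ cong₂ (λ x y → x + 16 * y + Δ + 149) (sym expand) (sym db) ⟩
        ∑[ w < 18 ] (Ē b w * deg Ē w) + 16 * d b + Δ + 149
          ≡⟨ cong (_+ 149) (nsum-complement G Ḡ comp b) ⟩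
        N b + 289 + 149
          ≡⟨ arith′ (N b) ⟩
        N b + 149 + 289
          ≡⟨ cong (_+ 289) (proj₂ (low-tight 1≤q b hb πb κb)) ⟩
        Δ + 8 * d b + 289
          ≡⟨ cong (λ z → Δ + 8 * z + 289) db ⟩
        Δ + 8 * d₀ q + 289
          ≡⟨ arith″ Δ (d₀ q) ⟩
        140 + (8 * d₀ q + Δ + 149) ∎)
        where
        open ≡-Reasoning
        arith : ∀ a d t → a + 8 * d + (8 * d + t + 149) ≡ a + 16 * d + t + 149
        arith = solve-∀
        arith′ : ∀ n → n + 289 + 149 ≡ n + 149 + 289
        arith′ = solve-∀
        arith″ : ∀ t d → t + 8 * d + 289 ≡ 140 + (8 * d + t + 149)
        arith″ = solve-∀
        arr : ∀ e k → e * (8 + k * o) ≡ 8 * e + e * k * o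
        arr e k = arr′ e k o
          where
          arr′ : ∀ e k o → e * (8 + k * o) ≡ 8 * e + e * k * o
          arr′ = solve-∀
        expand : ∑[ w < 18 ] (Ē b w * deg Ē w) ≡ 8 * D₀ + nB * o
        expand = trans (∑-cong λ w → trans (cong (Ē b w *_) (d̄ w)) (arr (Ē b w) (κ w)))
          (trans (∑-+ (λ w → 8 * Ē b w) (λ w → Ē b w * κ w * o))
            (cong₂ _+_ (trans (sym (*-∑ 8 (Ē b))) (cong (8 *_) (d̄-low b db))) (sym (∑-* o (λ w → Ē b w * κ w)))))

      nA+nB : nA + nB ≡ D₀
      nA+nB = trans (sym (∑-+ (λ w → Ē b w * π w) (λ w → Ē b w * κ w)))
        (trans (∑-cong λ w → trans (sym (*-distribˡ-+ (Ē b w) (π w) (κ w))) (trans (cong (Ē b w *_) (one (does (d w ≤? 8)))) (*-identityʳ (Ē b w))))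
          (d̄-low b db))
        where
        one : ∀ c → ⟦ not c ⟧ + ⟦ c ⟧ ≡ 1
        one true  = refl
        one false = refl

      ρ+nA : ρ + nA ≡ p
      ρ+nA = trans (sym (+-identityʳ (ρ + nA))) (trans (cong (ρ + nA +_) (sym πb)) (∑-comp G Ḡ comp b π))

      t : Fin 18 → ℕ
      t a = E b a * π a

      bit-t : ∀ a → IsBit (t a)
      bit-t a = bit-* (bit G b a) (⟦⟧-bit _)

      block-size : ∀ a → t a * codeg Ē b a ≡ t a * (13 ∸ d₀ q)
      block-size a with bit-t a
      ... | inj₁ z = trans (cong (_* codeg Ē b a) z) (sym (cong (_* (13 ∸ d₀ q)) z))
      ... | inj₂ z with side a
      ...   | low h πa κa with () ← trans (sym z) (trans (cong (E b a *_) πa) (*-zeroʳ (E b a)))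
      ...   | high h πa κa = cong (t a *_) (trans (sym (m+n∸n≡m (codeg Ē b a) (d₀ q))) (cong (_∸ d₀ q) (+-cancelʳ-≡ 9 _ _ eq)))
        where
        da : d a ≡ 9
        da = proj₁ (high-tight a h πa κa)
        a≢b : a ≢ b
        a≢b refl = 0≢1+n (trans (sym πb) πa)
        full : 68 ≤ codegs E a
        full = +-cancelʳ-≤ 9 _ _ (≤-reflexive (trans (sym (high-N a h πa κa)) (trans (sym (codegs+deg G a)) (cong (codegs E a +_) da))))
        comm : codeg E b a ≡ codeg E a b
        comm = ∑-cong λ w → *-comm (E b w) (E a w)
        -- Both sides are 16 + 4 + 2: the codegree 4 comes from tightness at a, the 2 from the
        -- `E`-edge between a and b.
        eq : codeg Ē b a + d₀ q + 9 ≡ 13 + 9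
        eq = trans (cong₂ (λ x y → codeg Ē b a + x + y) (sym db) (sym da)) (trans (codeg-complement G Ḡ comp b a (a≢b ∘ sym))
          (cong₂ (λ x y → 16 + x + 2 * y) (trans comm (codegs-tight G a da full b a≢b)) (m*n≡1⇒m≡1 (E b a) (π a) z)))

      bound : 4 * (ρ * (13 ∸ d₀ q)) ≤ 2 * (ρ * (ρ ∸ 1)) + 6 * D₀
      bound = subst₂ (λ x y → 4 * x ≤ 2 * (ρ * (ρ ∸ 1)) + 6 * y)
        (trans (∑-cong block-size) (sym (∑-* (13 ∸ d₀ q) t))) (d̄-low b db)
        (johnson Ḡ b t bit-t (trans (cong (E b b *_) πb) (*-zeroʳ (E b b))))

    low-vertex : 1 ≤ q → Σ (Fin 18) λ b → d b ≤ 8 × π b ≡ 0 × κ b ≡ 1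
    low-vertex 1≤q with ∑-positive κ 1≤q
    ... | b , h with side b
    ...   | low h′ a c = b , h′ , a , c
    ...   | high _ _ c with () ← ≤-trans h (≤-reflexive c)

    refute : ∀ {q₀ p₀ D₀ o nB nA ρ : ℕ} → q ≡ q₀ → 1 ≤ q₀ → d₀ q₀ + D₀ ≡ 17 → D₀ ≡ 8 + o → p₀ + q₀ ≡ 18 →
      (∀ x → 8 * D₀ + x * o + 8 * d₀ q₀ ≡ 140 → x ≡ nB) → nA + nB ≡ D₀ → ρ + nA ≡ p₀ →
      ¬ (4 * (ρ * (13 ∸ d₀ q₀)) ≤ 2 * (ρ * (ρ ∸ 1)) + 6 * D₀) → ⊥
    refute {q₀} {p₀} {D₀} {o} {nB} {nA} {ρ} eq 1≤q₀ e₁ e₂ e₃ e₄ e₅ e₆ no-go = no-go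
      (subst₂ (λ x y → 4 * (x * (13 ∸ d₀ y)) ≤ 2 * (x * (x ∸ 1)) + 6 * D₀) ρ≡ eq A.bound)
      where
      1≤q = subst (1 ≤_) (sym eq) 1≤q₀
      b = low-vertex 1≤q
      module A = AtLow 1≤q (proj₁ b) (proj₁ (proj₂ b)) (proj₁ (proj₂ (proj₂ b))) (proj₂ (proj₂ (proj₂ b)))
                   D₀ o (subst (λ z → d₀ z + D₀ ≡ 17) (sym eq) e₁) e₂
      nB≡ : A.nB ≡ nB
      nB≡ = e₄ A.nB (subst (λ z → 8 * D₀ + A.nB * o + 8 * d₀ z ≡ 140) eq A.N̄)
      nA≡ : A.nA ≡ nA
      nA≡ = +-cancelʳ-≡ nB _ _ (trans (cong (A.nA +_) (sym nB≡)) (trans A.nA+nB (sym e₅)))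
      p≡ : p ≡ p₀
      p≡ = +-cancelʳ-≡ q₀ _ _ (trans (cong (p +_) (sym eq)) (trans p+q (sym e₃)))
      ρ≡ : A.ρ ≡ ρ
      ρ≡ = +-cancelʳ-≡ nA _ _ (trans (cong (A.ρ +_) (sym nA≡)) (trans A.ρ+nA (trans p≡ (sym e₆))))

  contradiction : ⊥
  contradiction = [ zero-case , [ six , [ eight , nine ]′ ]′ ]′ special
    where
    special : q ≡ 0 ⊎ q ≡ 6 ⊎ q ≡ 8 ⊎ q ≡ 9
    special = balanced q<19 bal
    module Tg (e : q * cQ q ≡ (18 ∸ q) * cP q) = Tight
      (∑-tight f≤g (≤-reflexive (trans ∑g (trans (cong (D₂ + q * Δ +_) (sym e)) (sym ∑f)))))
    zero-case : q ≡ 0 → ⊥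
    zero-case e with side zero
    ... | low _ _ c = <⇒≱ (≤-trans (≤-reflexive (sym c)) (∑≥term κ zero)) (≤-reflexive e)
    -- For q = 0 the balance reads 0 = 0, so equality would have to hold at every vertex; no degree
    -- from 9 on attains it, which `tight-P` records as `1 ≤ q`.
    ... | high h a c = <⇒≱ (proj₂ (Tg.high-tight (subst (λ z → z * cQ z ≡ (18 ∸ z) * cP z) (sym e) refl) zero h a c)) (≤-reflexive e)
    solve₁ : ∀ c x y → c + x * 1 + 64 ≡ c + y + 64 → x ≡ y
    solve₁ c x y h = trans (sym (*-identityʳ x)) (+-cancelˡ-≡ c _ _ (+-cancelʳ-≡ 64 _ _ h))
    solve₂ : ∀ c x y → c + x * 2 + 56 ≡ c + y * 2 + 56 → x ≡ y
    solve₂ c x y h = *-cancelʳ-≡ x y 2 (+-cancelˡ-≡ c _ _ (+-cancelʳ-≡ 56 _ _ h))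
    six : q ≡ 6 → ⊥
    -- The values are those of q, p, `D₀`, o, `nB`, `nA` and `ρ`. The refuted instance of `johnson`
    -- is 96 ≤ 84 here, 100 ≤ 94 for q = 8 and 80 ≤ 78 for q = 9.
    six e = Tg.refute (subst (λ z → z * cQ z ≡ (18 ∸ z) * cP z) (sym e) refl) {6} {12} {10} {2} {2} {8} {4}
      e (s≤s z≤n) refl refl refl (λ x → solve₂ 80 x 2) refl refl (λ h → ≤⇒≤ᵇ h)
    eight : q ≡ 8 → ⊥
    eight e = Tg.refute (subst (λ z → z * cQ z ≡ (18 ∸ z) * cP z) (sym e) refl) {8} {10} {9} {1} {4} {5} {5}
      e (s≤s z≤n) refl refl refl (λ x → solve₁ 72 x 4) refl refl (λ h → ≤⇒≤ᵇ h)
    nine : q ≡ 9 → ⊥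
    nine e = Tg.refute (subst (λ z → z * cQ z ≡ (18 ∸ z) * cP z) (sym e) refl) {9} {9} {9} {1} {4} {5} {4}
      e (s≤s z≤n) refl refl refl (λ x → solve₁ 72 x 4) refl refl (λ h → ≤⇒≤ᵇ h)

-- If both a (in E) and b (in Ē) attain the bound 68, all codegrees at a and b are 4, and
-- codeg-complement fails modulo 2 for the pair a, b.
two-graphs : {E Ē : Fin 18 → Fin 18 → ℕ} → Graph E → Graph Ē → (∀ x y → x ≢ y → E x y + Ē x y ≡ 1) → ⊥
two-graphs {E} {Ē} G Ḡ comp with F.any? (λ a → (deg E a ℕ.≟ 9) ×-dec (68 ≤? codegs E a))
... | no ¬a = Unbalanced.contradiction Ḡ G (λ x y x≢y → trans (+-comm (Ē x y) (E x y)) (comp x y x≢y))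
        λ v e → s≤s⁻¹ (≰⇒> λ h → ¬a (v , +-cancelʳ-≡ 8 _ _ (trans (cong (deg E v +_) (sym e)) (deg+deg G Ḡ comp v)) , h))
... | yes (a , da , ha) with F.any? (λ b → (deg Ē b ℕ.≟ 9) ×-dec (68 ≤? codegs Ē b))
...   | no ¬b = Unbalanced.contradiction G Ḡ comp
        λ v e → s≤s⁻¹ (≰⇒> λ h → ¬b (v , +-cancelˡ-≡ 8 _ _ (trans (cong (_+ deg Ē v) (sym e)) (deg+deg G Ḡ comp v)) , h))
...   | yes (b , db , hb) = odd (bit G a b) parity-eq
  where
  db′ : deg E b ≡ 8
  db′ = +-cancelʳ-≡ 9 _ _ (trans (cong (deg E b +_) (sym db)) (deg+deg G Ḡ comp b))
  a≢b : a ≢ b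
  a≢b refl with () ← trans (sym da) db′
  parity-eq : 4 + 9 + 8 ≡ 16 + 4 + 2 * E a b
  parity-eq = trans (sym (cong₂ _+_ (cong₂ _+_ (trans (∑-cong λ w → *-comm (Ē a w) (Ē b w)) (codegs-tight Ḡ b db hb a (a≢b ∘ sym))) da) db′))
    (trans (codeg-complement G Ḡ comp a b a≢b) (cong (λ z → 16 + z + 2 * E a b) (codegs-tight G a da ha b a≢b)))
  odd : ∀ {e} → IsBit e → 4 + 9 + 8 ≡ 16 + 4 + 2 * e → ⊥
  odd (inj₁ refl) ()
  odd (inj₂ refl) ()

-- From two-colourings without monochromatic K₃,₃ to pairs of graphs

Distinct : (Fin m → Fin n) → Set
Distinct {m} h = ∀ (i j : Fin m) → i ≢ j → h i ≢ h j

opaque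
  pick : ∀ m (f : Fin n → ℕ) → (∀ x → IsBit (f x)) → m ≤ ∑ f →
    Σ (Fin m → Fin n) λ h → Distinct h × (∀ i → f (h i) ≡ 1)
  pick zero f b h = (λ ()) , (λ ()) , (λ ())
  pick {n} (suc m) f b h with ∑-positive f (≤-trans (s≤s z≤n) h)
  ... | x , 1≤fx with pick m (f ∖ x) (∖-bit x b)
                       (s≤s⁻¹ (≤-trans h (≤-trans (≤-reflexive (∑-∖ f x)) (+-monoˡ-≤ _ (bit-≤1 (b x))))))
  ...   | h′ , d , e = h″ , distinct , ones
    where
    h″ : Fin (suc m) → Fin n
    h″ zero    = x
    h″ (suc i) = h′ i
    distinct : Distinct h″
    distinct zero    zero    p = ⊥-elim (p refl)
    distinct zero    (suc j) p = proj₁ (∖-1 {f = f} {x} {h′ j} (e j))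
    distinct (suc i) zero    p = proj₁ (∖-1 {f = f} {x} {h′ i} (e i)) ∘ sym
    distinct (suc i) (suc j) p = d i j (p ∘ cong suc)
    ones : ∀ i → f (h″ i) ≡ 1
    ones zero    = ≤-antisym (bit-≤1 (b x)) 1≤fx
    ones (suc i) = proj₂ (∖-1 {f = f} {x} {h′ i} (e i))

triple : Fin n → Fin n → Fin n → Fin 3 → Fin n
triple x y z zero             = x
triple x y z (suc zero)       = y
triple x y z (suc (suc zero)) = z

triple-distinct : {x y z : Fin n} → x ≢ y → x ≢ z → y ≢ z → Distinct (triple x y z)
triple-distinct p q r zero             zero             i = ⊥-elim (i refl)
triple-distinct p q r zero             (suc zero)       i = p
triple-distinct p q r zero             (suc (suc zero)) i = q
triple-distinct p q r (suc zero)       zero             i = p ∘ sym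
triple-distinct p q r (suc zero)       (suc zero)       i = ⊥-elim (i refl)
triple-distinct p q r (suc zero)       (suc (suc zero)) i = r
triple-distinct p q r (suc (suc zero)) zero             i = q ∘ sym
triple-distinct p q r (suc (suc zero)) (suc zero)       i = r ∘ sym
triple-distinct p q r (suc (suc zero)) (suc (suc zero)) i = ⊥-elim (i refl)

triple-all : {P : Fin n → Set} {x y z : Fin n} → P x → P y → P z → ∀ i → P (triple x y z i)
triple-all p q r zero             = p
triple-all p q r (suc zero)       = q
triple-all p q r (suc (suc zero)) = r

NoK33 : (Fin n → Fin n → Set) → Set
NoK33 {n} R = ∀ (u v : Fin 3 → Fin n) → Distinct u → Distinct v → (∀ i j → u i ≢ v j) → (∀ i j → R (u i) (v j)) → ⊥

ramsey : (r : Fin 18 → Fin 18 → Bool) → (∀ x y → x ≢ y → r x y ≡ r y x) →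
  (∀ s → NoK33 (λ x y → r x y ≡ s)) → ⊥
ramsey r r-sym noK = two-graphs (graph true) (graph false) λ x y x≢y → comp x y x≢y (r x y)
  where
  is : Bool → Bool → ℕ
  is s b = ⟦ does (b Bool.≟ s) ⟧
  -- The diagonal is masked, since the values of `r` there are arbitrary.
  e : Bool → Fin 18 → Fin 18 → ℕ
  e s x y = ne x y * is s (r x y)
  comp : ∀ x y → x ≢ y → ∀ b → ne x y * is true b + ne x y * is false b ≡ 1
  comp x y x≢y true  rewrite ne-≢ x≢y = refl
  comp x y x≢y false rewrite ne-≢ x≢y = refl
  is-1 : ∀ s b → is s b ≡ 1 → b ≡ s
  is-1 true true _ = refl
  is-1 false false _ = refl
  ne-sym : ∀ {x y : Fin 18} → x ≢ y → ne x y ≡ ne y x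
  ne-sym p = trans (ne-≢ p) (sym (ne-≢ (p ∘ sym)))
  edge : ∀ s {x y} → e s x y ≡ 1 → x ≢ y × r x y ≡ s
  edge s {x} {y} p = ne-1 (m*n≡1⇒m≡1 (ne x y) _ p) , is-1 s (r x y) (m*n≡1⇒n≡1 (ne x y) _ p)
  graph : ∀ s → Graph (e s)
  graph s = record
    { bit  = e-bit
    ; symm = λ x y → case x ≟ y of λ where
        (yes refl) → refl
        (no p)     → cong₂ (λ a b → a * is s b) (ne-sym p) (r-sym x y p)
    ; irr  = λ x → cong (_* is s (r x x)) (ne-refl x)
    ; k33  = λ x y z p q t → s≤s⁻¹ (≰⇒> λ h → found x y z p q t (pick 3 _ (λ w → bit-* (bit-* (e-bit x w) (e-bit y w)) (e-bit z w)) h))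
    }
    where
    e-bit : ∀ x y → IsBit (e s x y)
    e-bit x y = bit-* (ne-bit x y) (⟦⟧-bit _)
    found : ∀ x y z → x ≢ y → x ≢ z → y ≢ z →
      (Σ (Fin 3 → Fin 18) λ h → Distinct h × (∀ i → e s x (h i) * e s y (h i) * e s z (h i) ≡ 1)) → ⊥
    found x y z p q t (h , d , o) = noK s (triple x y z) h (triple-distinct p q t) d
      (λ i j → proj₁ (adj i j)) (λ i j → proj₂ (adj i j))
      where
      adj : ∀ i j → triple x y z i ≢ h j × r (triple x y z i) (h j) ≡ s
      adj i j = triple-all {P = λ a → a ≢ h j × r a (h j) ≡ s}
        (edge s (m*n≡1⇒m≡1 (e s x (h j)) (e s y (h j)) xy)) (edge s (m*n≡1⇒n≡1 (e s x (h j)) (e s y (h j)) xy))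
        (edge s (m*n≡1⇒n≡1 (e s x (h j) * e s y (h j)) (e s z (h j)) (o j))) i
        where
        xy : e s x (h j) * e s y (h j) ≡ 1
        xy = m*n≡1⇒m≡1 (e s x (h j) * e s y (h j)) (e s z (h j)) (o j)

-- Colourings without rainbow triangles

private variable
  k : ℕ

-- Decidable subsets and their cardinalities

record Sub (n : ℕ) : Set₁ where
  field
    mem  : Fin n → Set
    mem? : ∀ x → Dec (mem x)
open Sub

infix 4 _∈_ _∉_ _⊆_
_∈_ _∉_ : Fin n → Sub n → Set
x ∈ A = mem A x
x ∉ A = ¬ (x ∈ A)

_⊆_ : Sub n → Sub n → Set
A ⊆ B = ∀ {x} → x ∈ A → x ∈ B

_∪ₛ_ _∩ₛ_ _∖ₛ_ : Sub n → Sub n → Sub n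
A ∪ₛ B = record { mem = λ x → x ∈ A ⊎ x ∈ B ; mem? = λ x → mem? A x ⊎-dec mem? B x }
A ∩ₛ B = record { mem = λ x → x ∈ A × x ∈ B ; mem? = λ x → mem? A x ×-dec mem? B x }
A ∖ₛ B = record { mem = λ x → x ∈ A × x ∉ B ; mem? = λ x → mem? A x ×-dec ¬? (mem? B x) }

⁅_⁆ : Fin n → Sub n
⁅ v ⁆ = record { mem = λ x → v ≡ x ; mem? = v ≟_ }

full : Sub n
full = record { mem = λ _ → Fin 1 ; mem? = λ _ → yes zero }

χ : Sub n → Fin n → ℕ
χ A x = ⟦ does (mem? A x) ⟧

χ-bit : (A : Sub n) → ∀ x → IsBit (χ A x)
χ-bit A x = ⟦⟧-bit _

χ-∈ : (A : Sub n) {x : Fin n} → x ∈ A → χ A x ≡ 1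
χ-∈ A {x} h = cong ⟦_⟧ (dec-true (mem? A x) h)

χ-∉ : (A : Sub n) {x : Fin n} → x ∉ A → χ A x ≡ 0
χ-∉ A {x} h = cong ⟦_⟧ (dec-false (mem? A x) h)

χ-1 : (A : Sub n) {x : Fin n} → χ A x ≡ 1 → x ∈ A
χ-1 A {x} e with mem? A x
... | yes h = h

# : Sub n → ℕ
# A = ∑ (χ A)

χ-mono : (A B : Sub n) {x : Fin n} → (x ∈ A → x ∈ B) → χ A x ≤ χ B x
χ-mono A B {x} h with mem? A x
... | no _  = z≤n
... | yes p = ≤-reflexive (sym (χ-∈ B (h p)))

#-mono : (A B : Sub n) → A ⊆ B → # A ≤ # B
#-mono A B h = ∑-mono λ x → χ-mono A B h

#-strict : (A B : Sub n) → A ⊆ B → ∀ {z} → z ∈ B → z ∉ A → # A < # B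
#-strict A B h {z} zB zA with # B ≤? # A
... | no p  = ≰⇒> p
... | yes p with () ← trans (sym (χ-∉ A zA)) (trans (∑-tight (λ x → χ-mono A B h) p z) (χ-∈ B zB))

#-∪ : (A B : Sub n) → # (A ∪ₛ B) ≤ # A + # B
#-∪ A B = ≤-trans (∑-mono point) (≤-reflexive (∑-+ (χ A) (χ B)))
  where
  point : ∀ x → χ (A ∪ₛ B) x ≤ χ A x + χ B x
  point x with mem? A x | mem? B x
  ... | yes _ | _     = s≤s z≤n
  ... | no _  | yes _ = s≤s z≤n
  ... | no _  | no _  = z≤n

#-split : (A B : Sub n) → # A ≤ # (A ∩ₛ B) + # (A ∖ₛ B)
#-split A B = ≤-trans (∑-mono point) (≤-reflexive (∑-+ (χ (A ∩ₛ B)) (χ (A ∖ₛ B))))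
  where
  point : ∀ x → χ A x ≤ χ (A ∩ₛ B) x + χ (A ∖ₛ B) x
  point x with mem? A x | mem? B x
  ... | no _  | _     = z≤n
  ... | yes _ | yes _ = s≤s z≤n
  ... | yes _ | no _  = s≤s z≤n

#-full : # (full {n}) ≡ n
#-full {n} = trans (∑-const n 1) (*-identityʳ n)

opaque
  #-pick : ∀ m (A : Sub n) → m ≤ # A → Σ (Fin m → Fin n) λ h → Distinct h × (∀ i → h i ∈ A)
  #-pick m A h with pick m (χ A) (χ-bit A) h
  ... | f , d , e = f , d , λ i → χ-1 A (e i)

∑≥distinct : ∀ m (f : Fin n → ℕ) (h : Fin m → Fin n) → Distinct h → (∀ i → f (h i) ≡ 1) → m ≤ ∑ f
∑≥distinct zero f h d e = z≤n
∑≥distinct (suc m) f h d e = ≤-trans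
  (+-mono-≤ (≤-reflexive (sym (e zero))) (∑≥distinct m (f ∖ h zero) (h ∘ suc) (λ i j p → d (suc i) (suc j) (p ∘ F.suc-injective))
    (λ i → trans (∖-≢ f (d zero (suc i) λ ())) (e (suc i)))))
  (≤-reflexive (sym (∑-∖ f (h zero))))

#≥3 : (A : Sub n) {x y z : Fin n} → x ≢ y → x ≢ z → y ≢ z → x ∈ A → y ∈ A → z ∈ A → 3 ≤ # A
#≥3 A p q r x y z = ∑≥distinct 3 (χ A) _ (triple-distinct p q r) (triple-all {P = λ w → χ A w ≡ 1} (χ-∈ A x) (χ-∈ A y) (χ-∈ A z))

#-⁅⁆ : (v : Fin n) → # ⁅ v ⁆ ≤ 1
#-⁅⁆ v with # ⁅ v ⁆ ≤? 1
... | yes h = h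
... | no h with #-pick 2 ⁅ v ⁆ (≰⇒> h)
...   | f , d , e = ⊥-elim (d zero (suc zero) (λ ()) (trans (sym (e zero)) (e (suc zero))))

-- `Q` may quantify over all subsets and is not assumed decidable, so a minimal set is only made
-- available to a refutation. This suffices for the upper bound: rainbow triangles and monochromatic
-- K₃,₃ are decidable, so refuting the absence of both yields one of them.
minimal : ∀ {ℓ} (Q : Sub n → Set ℓ) (A : Sub n) → Q A →
  (∀ B → Q B → (∀ C → Q C → # C < # B → ⊥) → ⊥) → ⊥
minimal Q A qA use = go A qA (<-wellFounded (# A))
  where
  go : ∀ A → Q A → Acc _<_ (# A) → ⊥
  go A qA (acc rs) = use A qA λ C qC lt → go C qC (rs lt)

-- Connectivity in one colour

module Gallai (c : Colouring k n) (no-rainbow : ¬ RainbowTriangle c) where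

  Γ : Fin n → Fin n → Fin k
  Γ = col c

  Γ-sym : ∀ {x y} → x ≢ y → Γ x y ≡ Γ y x
  Γ-sym p = col-sym c _ _ p

  fork : ∀ {x y z a b} → x ≢ y → x ≢ z → y ≢ z → Γ x y ≡ a → Γ x z ≡ b → a ≢ b → Γ y z ≡ a ⊎ Γ y z ≡ b
  fork {x} {y} {z} {a} {b} p q r ea eb a≢b with Γ y z ≟ a | Γ y z ≟ b
  ... | yes e | _     = inj₁ e
  ... | no _  | yes e = inj₂ e
  ... | no ¬a | no ¬b = ⊥-elim (no-rainbow (x , y , z , (p , r , q) ,
          (λ e → ¬a (trans (sym e) ea)) , (λ e → ¬b (trans e eb)) , (λ e → a≢b (trans (sym ea) (trans e eb)))))

  -- A union of components of colour `a` on `W`. Connectivity is expressed through such sets instead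
  -- of paths.
  Closed : Fin k → Sub n → Sub n → Set
  Closed a W A = A ⊆ W × (∀ {x y} → x ∈ A → y ∈ W → y ∉ A → Γ x y ≢ a)

  Connected : Fin k → Sub n → Set₁
  Connected a W = ∀ A → Closed a W A → ∀ {x y} → x ∈ A → y ∈ W → y ∉ A → ⊥

  record Component (a : Fin k) (W : Sub n) (x : Fin n) (A : Sub n) : Set₁ where
    field
      closed : Closed a W A
      centre : x ∈ A
      least  : ∀ B → Closed a W B → x ∈ B → # B < # A → ⊥
  open Component

  component : ∀ a W {x} → x ∈ W → (∀ A → Component a W x A → ⊥) → ⊥
  component a W {x} xW use = minimal (λ A → Closed a W A × x ∈ A) W
    ((id , λ _ yW ¬yW → ⊥-elim (¬yW yW)) , xW)
    λ A (cl , xA) min → use A record { closed = cl ; centre = xA ; least = λ B cl′ xB → min B (cl′ , xB) }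

  module _ {a W x A} (K : Component a W x A) where

    component-⊆ : ∀ B → Closed a W B → x ∈ B → A ⊆ B
    component-⊆ B (B⊆W , clB) xB {y} yA with mem? B y
    ... | yes yB = yB
    ... | no ¬yB = ⊥-elim (least K (A ∩ₛ B) (proj₁ (closed K) ∘ proj₁ , cl) (centre K , xB)
                     (#-strict (A ∩ₛ B) A proj₁ yA (¬yB ∘ proj₂)))
      where
      cl : ∀ {u w} → u ∈ (A ∩ₛ B) → w ∈ W → w ∉ (A ∩ₛ B) → Γ u w ≢ a
      cl {u} {w} (uA , uB) wW ¬w with mem? A w
      ... | no ¬wA = proj₂ (closed K) uA wW ¬wA
      ... | yes wA = clB uB wW (λ wB → ¬w (wA , wB))

    component-disjoint : ∀ B → Closed a W B → x ∉ B → ∀ {y} → y ∈ A → y ∉ B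
    component-disjoint B (B⊆W , clB) ¬xB {y} yA yB = least K (A ∖ₛ B) (proj₁ (closed K) ∘ proj₁ , cl) (centre K , ¬xB)
                     (#-strict (A ∖ₛ B) A proj₁ yA (λ h → proj₂ h yB))
      where
      cl : ∀ {u w} → u ∈ (A ∖ₛ B) → w ∈ W → w ∉ (A ∖ₛ B) → Γ u w ≢ a
      cl {u} {w} (uA , ¬uB) wW ¬w with mem? A w | mem? B w
      ... | no ¬wA | _ = proj₂ (closed K) uA wW ¬wA
      ... | yes wA | no ¬wB = ⊥-elim (¬w (wA , ¬wB))
      ... | yes wA | yes wB = λ e → clB wB (proj₁ (closed K) uA) ¬uB (trans (Γ-sym λ { refl → ¬uB wB }) e)

    -- If u, w in `A` are joined in colour `a`, which y avoids, the triangle y u w forces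
    -- `Γ y u ≡ Γ y w`. So the points of `A` that y sees in the colour of x form a closed set, which
    -- is all of `A` by minimality.
    homogeneous : ∀ {y} → y ∉ A → (∀ {w} → w ∈ A → Γ y w ≢ a) → ∀ {z} → z ∈ A → Γ y z ≡ Γ y x
    homogeneous {y} ¬yA avoid {z} zA with Γ y z ≟ Γ y x
    ... | yes e = e
    ... | no ¬e = ⊥-elim (least K B (proj₁ (closed K) ∘ proj₁ , cl) (centre K , refl) (#-strict B A proj₁ zA (¬e ∘ proj₂)))
      where
      B : Sub n
      B = record { mem = λ w → w ∈ A × Γ y w ≡ Γ y x ; mem? = λ w → mem? A w ×-dec (Γ y w ≟ Γ y x) }
      cl : ∀ {u w} → u ∈ B → w ∈ W → w ∉ B → Γ u w ≢ a
      cl {u} {w} (uA , eu) wW ¬w with mem? A w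
      ... | no ¬wA = proj₂ (closed K) uA wW ¬wA
      ... | yes wA = λ e → [ (λ e′ → avoid uA (trans eu (trans (sym e′) e))) , (λ e′ → avoid wA (trans (sym e′) e)) ]′
              (fork {y} {u} {w} (λ { refl → ¬yA uA }) (λ { refl → ¬yA wA }) (λ { refl → ¬w (uA , eu) }) eu refl
                (λ e′ → ¬w (wA , sym e′)))

  -- If W without v were disconnected in colour a, then v would have an edge of colour a to every
  -- component, which forces all its other edges to have one and the same colour.
  module Removal {W : Sub n} {v : Fin n} (vW : v ∈ W) {a b d : Fin k} (b≢a : b ≢ a) (d≢a : d ≢ a) (b≢d : b ≢ d)
    (Ca : Connected a W) (Cb : Connected b W) (Cd : Connected d W) where

    W′ : Sub n
    W′ = W ∖ₛ ⁅ v ⁆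

    opaque
      -- Otherwise `A` would stay closed when v is put back, against `Ca`.
      touch : ∀ {A} → Closed a W′ A → ∀ {z} → z ∈ A → Σ (Fin n) λ x → x ∈ A × Γ v x ≡ a
      touch {A} (A⊆W′ , cl) {z} zA with F.any? (λ x → mem? A x ×-dec (Γ v x ≟ a))
      ... | yes h = h
      ... | no ¬h = ⊥-elim (Ca A (proj₁ ∘ A⊆W′ , cl′) zA vW (λ vA → proj₂ (A⊆W′ vA) refl))
        where
        cl′ : ∀ {x y} → x ∈ A → y ∈ W → y ∉ A → Γ x y ≢ a
        cl′ {x} {y} xA yW ¬yA with v ≟ y
        ... | yes refl = λ e → ¬h (x , xA , trans (Γ-sym (proj₂ (A⊆W′ xA))) e)
        ... | no v≢y = cl xA (yW , v≢y) ¬yA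

    transfer : ∀ {x z} → x ∈ W′ → z ∈ W′ → x ≢ z → Γ v x ≡ a → Γ v z ≢ a → Γ z x ≢ a → Γ z x ≡ Γ v z
    transfer (_ , v≢x) (_ , v≢z) x≢z ex ez ezx =
      [ id , (λ e → ⊥-elim (ezx e)) ]′ (fork v≢z v≢x (x≢z ∘ sym) refl ex ez)

    outside : ∀ {z A w} → Component a W′ z A → w ∈ W′ → w ∉ A → Γ v w ≢ a → Γ w z ≡ Γ v w
    outside {z} {A} {w} K wW′ ¬wA ew with touch {A} (closed K) (centre K)
    ... | x , xA , ex = trans (sym (homogeneous K ¬wA avoid xA))
            (transfer (proj₁ (closed K) xA) wW′ (λ { refl → ¬wA xA }) ex ew (avoid xA))
      where
      avoid : ∀ {u} → u ∈ A → Γ w u ≢ a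
      avoid {u} uA e = proj₂ (closed K) uA wW′ ¬wA (trans (Γ-sym λ { refl → ¬wA uA }) e)

    -- Take x outside the component with `Γ v x ≡ a`. By `transfer`, z is joined to x and to v in
    -- the same colour, and so is w; and x sees the whole component in one colour.
    inside : ∀ {z A w y} → Component a W′ z A → z ∈ W′ → w ∈ W′ → w ∈ A → y ∈ (W′ ∖ₛ A) →
      Γ v z ≢ a → Γ v w ≢ a → Γ v z ≡ Γ v w
    inside {z} {A} K zW′ wW′ wA yC ez ew with touch {W′ ∖ₛ A} (proj₁ , co-closed) yC
      where
      co-closed : ∀ {u t} → u ∈ (W′ ∖ₛ A) → t ∈ W′ → t ∉ (W′ ∖ₛ A) → Γ u t ≢ a
      co-closed {u} {t} (uW , ¬uA) tW ¬t e = case mem? A t of λ where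
        (yes tA) → proj₂ (closed K) tA uW ¬uA (trans (Γ-sym λ { refl → ¬uA tA }) e)
        (no ¬tA) → ¬t (tW , ¬tA)
    ... | x , (xW , ¬xA) , ex = trans (sym (go zW′ (centre K) ez)) (trans (flip (centre K))
            (trans (sym (homogeneous K ¬xA avoid wA)) (trans (sym (flip wA)) (go wW′ wA ew))))
      where
      flip : ∀ {u} → u ∈ A → Γ u x ≡ Γ x u
      flip uA = Γ-sym λ { refl → ¬xA uA }
      avoid : ∀ {u} → u ∈ A → Γ x u ≢ a
      avoid uA e = proj₂ (closed K) uA xW ¬xA (trans (flip uA) e)
      go : ∀ {u} → u ∈ W′ → u ∈ A → Γ v u ≢ a → Γ u x ≡ Γ v u
      go uW′ uA eu = transfer xW uW′ (λ { refl → ¬xA uA }) ex eu (proj₂ (closed K) uA xW ¬xA)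

    same-colour : ∀ B → Closed a W′ B → ∀ {x₀ y₀} → x₀ ∈ B → y₀ ∈ W′ → y₀ ∉ B →
      ∀ {z w} → z ∈ W′ → w ∈ W′ → Γ v z ≢ a → Γ v w ≢ a → Γ v z ≡ Γ v w
    same-colour B clB {x₀} {y₀} x₀B y₀W′ ¬y₀B {z} {w} zW′ wW′ ez ew with Γ v z ≟ Γ v w
    ... | yes e = e
    ... | no ¬e = ⊥-elim (component a W′ zW′ λ A K → component a W′ wW′ λ A′ K′ → main A K A′ K′)
      where
      main : ∀ A → Component a W′ z A → ∀ A′ → Component a W′ w A′ → ⊥
      main A K A′ K′ with mem? A w
      ... | no ¬wA = ¬e (trans (sym (outside K′ zW′ ¬zA′ ez))
              (trans (Γ-sym λ { refl → ¬wA (centre K) }) (outside K wW′ ¬wA ew)))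
        where
        ¬zA′ : z ∉ A′
        ¬zA′ zA′ = component-disjoint K′ A (closed K) ¬wA zA′ (centre K)
      ... | yes wA with mem? A x₀ | mem? A y₀
      ...   | no ¬x | _     = ¬e (inside K zW′ wW′ wA (proj₁ clB x₀B , ¬x) ez ew)
      ...   | yes x | no ¬y = ¬e (inside K zW′ wW′ wA (y₀W′ , ¬y) ez ew)
      ...   | yes x | yes y with mem? B z
      ...     | yes zB = ¬y₀B (component-⊆ K B clB zB y)
      ...     | no ¬zB = component-disjoint K B clB ¬zB x x₀B

    opaque
      edge-at : ∀ {e x} → Connected e W → x ∈ W′ → Σ (Fin n) λ z → z ∈ W′ × Γ v z ≡ e
      edge-at {e} {x} Ce (xW , v≢x) with F.any? (λ z → mem? W′ z ×-dec (Γ v z ≟ e))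
      ... | yes h = h
      ... | no ¬h = ⊥-elim (Ce ⁅ v ⁆ ((λ { refl → vW }) , λ { refl yW v≢y eq → ¬h (_ , (yW , v≢y) , eq) }) refl xW v≢x)

    connected : Connected a W′
    connected B clB x₀B y₀W′ ¬y₀B with edge-at Cb y₀W′ | edge-at Cd y₀W′
    ... | z , zW′ , ez | w , wW′ , ew = b≢d (trans (sym ez) (trans
            (same-colour B clB x₀B y₀W′ ¬y₀B zW′ wW′ (λ e → b≢a (trans (sym ez) e)) (λ e → d≢a (trans (sym ew) e))) ew))

  -- By `Removal`, vertices can be deleted while all three colours stay connected, until two are
  -- left; their single edge would have both colour `a` and colour `b`.
  at-most-two : ∀ s (W : Sub n) → # W ≡ 2 + s → ∀ {a b d} → a ≢ b → a ≢ d → b ≢ d →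
    Connected a W → Connected b W → Connected d W → ⊥
  at-most-two s W e {a} {b} {d} a≢b a≢d b≢d Ca Cb Cd with #-pick 2 W (subst (2 ≤_) (sym e) (s≤s (s≤s z≤n)))
  ... | h , dist , h∈ = step s e
    where
    v = h zero
    W′ : Sub n
    W′ = W ∖ₛ ⁅ v ⁆
    other : h (suc zero) ∈ W′
    other = h∈ (suc zero) , dist zero (suc zero) (λ ())
    size′ : ∀ s → # W ≡ 2 + s → # W′ ≡ 1 + s
    size′ s e = ≤-antisym
      (s≤s⁻¹ (≤-trans (#-strict W′ W proj₁ (h∈ zero) (λ p → proj₂ p refl)) (≤-reflexive e)))
      (s≤s⁻¹ (≤-trans (≤-reflexive (sym e)) (≤-trans (#-split W ⁅ v ⁆)
        (+-monoˡ-≤ (# W′) (≤-trans (#-mono (W ∩ₛ ⁅ v ⁆) ⁅ v ⁆ proj₂) (#-⁅⁆ v))))))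
    step : ∀ s → # W ≡ 2 + s → ⊥
    step zero e = a≢b (trans (sym (the Ca)) (the Cb))
      where
      the : ∀ {x} → Connected x W → Γ v (h (suc zero)) ≡ x
      the {x} Cx with Γ v (h (suc zero)) ≟ x
      ... | yes p = p
      ... | no ¬p = ⊥-elim (Cx ⁅ v ⁆ ((λ { refl → h∈ zero }) , λ { {_} {y} refl yW v≢y eq →
              ¬p (subst (λ t → Γ v t ≡ x) (only (yW , v≢y)) eq) }) refl (h∈ (suc zero)) (proj₂ other))
        where
        only : ∀ {y} → y ∈ W′ → y ≡ h (suc zero)
        only {y} yW′ with y ≟ h (suc zero)
        ... | yes q = q
        ... | no ¬q = ⊥-elim (<⇒≱ (s≤s (≤-reflexive (size′ 0 e))) (∑≥distinct 2 (χ W′) two two-distinct λ where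
                 zero → χ-∈ W′ yW′
                 (suc zero) → χ-∈ W′ other))
          where
          two : Fin 2 → Fin n
          two zero       = y
          two (suc zero) = h (suc zero)
          two-distinct : Distinct two
          two-distinct zero       zero       p = ⊥-elim (p refl)
          two-distinct zero       (suc zero) p = ¬q
          two-distinct (suc zero) zero       p = ¬q ∘ sym
          two-distinct (suc zero) (suc zero) p = ⊥-elim (p refl)
    step (suc s) e = at-most-two s W′ (size′ (suc s) e) a≢b a≢d b≢d
      (Removal.connected {W} {v} (h∈ zero) (a≢b ∘ sym) (a≢d ∘ sym) b≢d Ca Cb Cd)
      (Removal.connected {W} {v} (h∈ zero) a≢b (b≢d ∘ sym) a≢d Cb Ca Cd)
      (Removal.connected {W} {v} (h∈ zero) a≢d b≢d a≢b Cd Ca Cb)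

#≤1 : (A : Sub n) → (∀ {x y} → x ∈ A → y ∈ A → x ≢ y → ⊥) → # A ≤ 1
#≤1 A h with # A ≤? 1
... | yes p = p
... | no ¬p with #-pick 2 A (≰⇒> ¬p)
...   | f , d , f∈ = ⊥-elim (h (f∈ zero) (f∈ (suc zero)) (d zero (suc zero) (λ ())))

#≤2 : (A : Sub n) → (∀ (f : Fin 3 → Fin n) → Distinct f → (∀ i → f i ∈ A) → ⊥) → # A ≤ 2
#≤2 A h with # A ≤? 2
... | yes p = p
... | no ¬p with #-pick 3 A (≰⇒> ¬p)
...   | f , d , f∈ = ⊥-elim (h f d f∈)

#-nonempty : (A : Sub n) → 1 ≤ # A → Σ (Fin n) (_∈ A)
#-nonempty A h with #-pick 1 A h
... | f , _ , f∈ = f zero , f∈ zero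

#-remove : (A : Sub n) {x : Fin n} → x ∈ A → suc (# (A ∖ₛ ⁅ x ⁆)) ≤ # A
#-remove A xA = #-strict (A ∖ₛ ⁅ _ ⁆) A proj₁ xA (λ p → proj₂ p refl)

-- (α - 3) (β - 3) ≥ 0 turns α β ≤ 2 (α + β) into α + β ≤ 9.
one-is-small : ∀ α β → α * β ≤ 2 * β + 2 * α → 10 ≤ α + β → α ≤ 2 ⊎ β ≤ 2
one-is-small α β h s with α ≤? 2 | β ≤? 2
... | yes p | _ = inj₁ p
... | no _  | yes q = inj₂ q
... | no p  | no q with m≤n⇒∃[o]m+o≡n (≰⇒> p) | m≤n⇒∃[o]m+o≡n (≰⇒> q)
...   | a , refl | b , refl = ⊥-elim (<⇒≱ s (+-cancelʳ-≤ (3 + 2 * a + 2 * b) _ _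
          (≤-trans (m≤m+n _ (a * b)) (≤-trans (≤-reflexive (arith a b)) (≤-trans h (≤-reflexive (arith′ a b)))))))
  where
  arith : ∀ a b → 3 + a + (3 + b) + (3 + 2 * a + 2 * b) + a * b ≡ (3 + a) * (3 + b)
  arith = solve-∀
  arith′ : ∀ a b → 2 * (3 + b) + 2 * (3 + a) ≡ 9 + (3 + 2 * a + 2 * b)
  arith′ = solve-∀

-- The upper bound

module Upper (c : Colouring k n) (no-rainbow : ¬ RainbowTriangle c) (noK : ¬ MonoK33 c)
  (3≤k : 3 ≤ k) (n-large : 2 * k + 14 ≤ n) where

  open Gallai c no-rainbow
  open Component

  star : ∀ a {x y z} → x ≢ y → x ≢ z → y ≢ z → (A : Sub n) →
    (∀ {w} → w ∈ A → (x ≢ w × Γ x w ≡ a) × (y ≢ w × Γ y w ≡ a) × (z ≢ w × Γ z w ≡ a)) → # A ≤ 2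
  star a {x} {y} {z} p q r A h = #≤2 A λ f d f∈ →
    let adj = λ i j → triple-all {P = λ t → t ≢ f j × Γ t (f j) ≡ a} {x} {y} {z}
                (proj₁ (h (f∈ j))) (proj₁ (proj₂ (h (f∈ j)))) (proj₂ (proj₂ (h (f∈ j)))) i
    in noK (triple x y z , f , a , triple-distinct p q r , d , (λ i j → proj₁ (adj i j)) , (λ i j → proj₂ (adj i j)))

  IsModule : Sub n → Set
  IsModule Z = ∀ {y x x′} → y ∉ Z → x ∈ Z → x′ ∈ Z → Γ y x ≡ Γ y x′

  module MinimalModule (Z : Sub n) (isModule : IsModule Z) (Z≥3 : 3 ≤ # Z)
    (least-module : ∀ C → IsModule C × 3 ≤ # C → # C < # Z → ⊥) {z₀ : Fin n} (z₀∈Z : z₀ ∈ Z) where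

    -- Consider the component `A` of x in colour `a`, which contains x′. It is a module, and smaller
    -- than `Z` since `Z` is disconnected in `a`. If z were in it, it would have three vertices,
    -- against minimality; so z lies outside and `homogeneous` applies.
    twin : ∀ {a} → (Connected a Z → ⊥) → ∀ {x x′} → x ∈ Z → x′ ∈ Z → x ≢ x′ → Γ x x′ ≡ a →
      ∀ {z} → z ∈ Z → z ≢ x → z ≢ x′ → Γ z x ≡ Γ z x′ × Γ z x ≢ a
    twin {a} disconnected {x} {x′} xZ x′Z x≢x′ e {z} zZ z≢x z≢x′ with (Γ z x ≟ Γ z x′) ×-dec ¬? (Γ z x ≟ a)
    ... | yes h = h
    ... | no ¬h = ⊥-elim (disconnected λ B clB x₀B y₀Z ¬y₀B → component a Z xZ λ A K → main A K B clB x₀B y₀Z ¬y₀B)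
      where
      main : ∀ A → Component a Z x A → ∀ B → Closed a Z B → ∀ {x₀ y₀} → x₀ ∈ B → y₀ ∈ Z → y₀ ∉ B → ⊥
      main A K B clB {x₀} {y₀} x₀B y₀Z ¬y₀B with mem? A z
      ... | no ¬zA = ¬h (sym (homogeneous K ¬zA avoid x′A) , avoid (centre K))
        where
        avoid : ∀ {u} → u ∈ A → Γ z u ≢ a
        avoid uA e′ = proj₂ (closed K) uA zZ ¬zA (trans (Γ-sym λ { refl → ¬zA uA }) e′)
        x′A : x′ ∈ A
        x′A with mem? A x′
        ... | yes p = p
        ... | no ¬p = ⊥-elim (proj₂ (closed K) (centre K) x′Z ¬p e)
      ... | yes zA = least-module A (A-module , #≥3 A x≢x′ (z≢x ∘ sym) (z≢x′ ∘ sym) (centre K) x′A zA) smaller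
        where
        x′A : x′ ∈ A
        x′A with mem? A x′
        ... | yes p = p
        ... | no ¬p = ⊥-elim (proj₂ (closed K) (centre K) x′Z ¬p e)
        A-module : IsModule A
        A-module {y} ¬yA uA u′A with mem? Z y
        ... | no ¬yZ = isModule ¬yZ (proj₁ (closed K) uA) (proj₁ (closed K) u′A)
        ... | yes yZ = trans (homogeneous K ¬yA avoid uA) (sym (homogeneous K ¬yA avoid u′A))
          where
          avoid : ∀ {u} → u ∈ A → Γ y u ≢ a
          avoid uA e′ = proj₂ (closed K) uA yZ ¬yA (trans (Γ-sym λ { refl → ¬yA uA }) e′)
        smaller : # A < # Z
        smaller with mem? A x₀ | mem? A y₀
        ... | no ¬p | _     = #-strict A Z (proj₁ (closed K)) (proj₁ clB x₀B) ¬p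
        ... | yes _ | no ¬q = #-strict A Z (proj₁ (closed K)) y₀Z ¬q
        ... | yes p | yes q with mem? B x
        ...   | yes xB = ⊥-elim (¬y₀B (component-⊆ K B clB xB q))
        ...   | no ¬xB = ⊥-elim (component-disjoint K B clB ¬xB p x₀B)

    another : (r : Fin k) → Σ (Fin k) (r ≢_)
    another r = go 3≤k r
      where
      go : ∀ {k} → 3 ≤ k → (r : Fin k) → Σ (Fin k) (r ≢_)
      go (s≤s (s≤s _)) zero    = suc zero , λ ()
      go (s≤s (s≤s _)) (suc _) = zero , λ ()

    two-colours : (∀ r b → r ≢ b → (∀ a → a ≢ r → a ≢ b → Connected a Z → ⊥) → ⊥) → ⊥
    two-colours use with m≤n⇒∃[o]m+o≡n (≤-trans (n≤1+n 2) Z≥3)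
    -- Each call of `use` can only fail through a connected colour different from the two proposed.
    -- Proposing the colours found so far, three calls give three distinct connected colours.
    ... | s , e = use (colour₀ 3≤k) (proj₁ (another _)) (proj₂ (another _)) λ a _ _ Ca →
          use a (proj₁ (another a)) (proj₂ (another a)) λ b b≢a _ Cb →
          use a b (b≢a ∘ sym) λ d d≢a d≢b Cd →
          at-most-two s Z (sym e) (b≢a ∘ sym) (d≢a ∘ sym) (d≢b ∘ sym) Ca Cb Cd
      where
      colour₀ : ∀ {k} → 3 ≤ k → Fin k
      colour₀ (s≤s _) = zero

    T : Fin k → Sub n
    T a = record { mem = λ y → y ∉ Z × Γ y z₀ ≡ a ; mem? = λ y → ¬? (mem? Z y) ×-dec (Γ y z₀ ≟ a) }

    T-col : ∀ {a y x} → y ∈ T a → x ∈ Z → Γ y x ≡ a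
    T-col (¬yZ , e) xZ = trans (isModule ¬yZ xZ z₀∈Z) e

    T≢Z : ∀ {a y x} → y ∈ T a → x ∈ Z → y ≢ x
    T≢Z (¬yZ , _) xZ refl = ¬yZ xZ

    T≤2 : ∀ a → # (T a) ≤ 2
    T≤2 a = #≤2 (T a) λ f d f∈ → <⇒≱ Z≥3 (star a (d zero (suc zero) λ ()) (d zero (suc (suc zero)) λ ()) (d (suc zero) (suc (suc zero)) λ ()) Z
              λ wZ → (T≢Z (f∈ _) wZ , T-col (f∈ _) wZ) , (T≢Z (f∈ _) wZ , T-col (f∈ _) wZ) , (T≢Z (f∈ _) wZ , T-col (f∈ _) wZ))

    module TwoColours (r b : Fin k) (r≢b : r ≢ b) (disconnected : ∀ a → a ≢ r → a ≢ b → Connected a Z → ⊥) where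

      W : Sub n
      W = Z ∪ₛ (T r ∪ₛ T b)

      W≥18 : 18 ≤ # W
      W≥18 = +-cancelʳ-≤ (2 * κ) _ _ (begin
        18 + 2 * κ                                     ≡⟨ arith κ ⟩
        2 * (2 + κ) + 14                               ≡⟨ cong (λ z → 2 * z + 14) (sym k≡) ⟩
        2 * k + 14                                     ≤⟨ n-large ⟩
        n                                              ≡⟨ sym (trans (∑-const n 1) (*-identityʳ n)) ⟩
        ∑[ y < n ] 1                                   ≤⟨ ∑-mono cover ⟩
        ∑[ y < n ] (χ W y + ∑[ a < k ] (w a * χ (T a) y))  ≡⟨ ∑-+ (χ W) _ ⟩
        # W + ∑[ y < n ] ∑[ a < k ] (w a * χ (T a) y)  ≡⟨ cong (# W +_) (∑-comm (λ y a → w a * χ (T a) y)) ⟩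
        # W + ∑[ a < k ] ∑[ y < n ] (w a * χ (T a) y)  ≤⟨ +-monoʳ-≤ (# W) (∑-mono λ a → ≤-trans (≤-reflexive (sym (*-∑ (w a) (χ (T a))))) (*-monoʳ-≤ (w a) (T≤2 a))) ⟩
        # W + ∑[ a < k ] (w a * 2)                     ≡⟨ cong (# W +_) (trans (sym (∑-* 2 w)) (*-comm κ 2)) ⟩
        # W + 2 * κ                                    ∎)
        where
        open ≤-Reasoning
        w : Fin k → ℕ
        w = (λ _ → 1) ∖ r ∖ b
        κ = ∑ w
        arith : ∀ x → 18 + 2 * x ≡ 2 * (2 + x) + 14
        arith = solve-∀
        k≡ : k ≡ 2 + κ
        k≡ = trans (sym (trans (∑-const k 1) (*-identityʳ k))) (trans (∑-∖ (λ _ → 1) r) (cong suc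
               (trans (∑-∖ ((λ _ → 1) ∖ r) b) (cong (_+ κ) (∖-≢ (λ _ → 1) r≢b)))))
        cover : ∀ y → 1 ≤ χ W y + ∑[ a < k ] (w a * χ (T a) y)
        cover y = case mem? W y of λ where
            (yes yW) → ≤-trans (≤-reflexive (sym (χ-∈ W yW))) (m≤m+n (χ W y) _)
            (no ¬yW) → ≤-trans (≤-reflexive (sym (one ¬yW))) (≤-trans (∑≥term (λ a → w a * χ (T a) y) (Γ y z₀)) (m≤n+m _ (χ W y)))
          where
          one : y ∉ W → w (Γ y z₀) * χ (T (Γ y z₀)) y ≡ 1
          one ¬yW = cong₂ _*_ (trans (∖-≢ ((λ _ → 1) ∖ r) (λ e → ¬yW (inj₂ (inj₂ (¬yW ∘ inj₁ , sym e)))))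
                                     (∖-≢ (λ _ → 1) (λ e → ¬yW (inj₂ (inj₁ (¬yW ∘ inj₁ , sym e))))))
                              (χ-∈ (T (Γ y z₀)) (¬yW ∘ inj₁ , refl))

      cross : ∀ {x y} → x ∈ T r → y ∈ T b → Γ x y ≡ r ⊎ Γ x y ≡ b
      cross {x} {y} xT yT = fork (T≢Z xT z₀∈Z ∘ sym) (T≢Z yT z₀∈Z ∘ sym) (λ { refl → r≢b (trans (sym (proj₂ xT)) (proj₂ yT)) })
        (trans (Γ-sym (T≢Z xT z₀∈Z ∘ sym)) (proj₂ xT)) (trans (Γ-sym (T≢Z yT z₀∈Z ∘ sym)) (proj₂ yT)) r≢b

      Third : Fin n → Fin n → Set
      Third x y = Γ x y ≢ r × Γ x y ≢ b

      classify : ∀ x y → (Γ x y ≡ r ⊎ Γ x y ≡ b) ⊎ Third x y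
      classify x y with Γ x y ≟ r | Γ x y ≟ b
      ... | yes p | _     = inj₁ (inj₁ p)
      ... | no _  | yes q = inj₁ (inj₂ q)
      ... | no p  | no q  = inj₂ (p , q)

      -- The twins x, y give `Γ z x ≡ Γ z y` and the twins x, z give `Γ y x ≡ Γ y z`, so all three
      -- edges have one colour; but z must see x and y in a colour other than `Γ x y`.
      twin-unique : ∀ {x y z} → x ∈ Z → y ∈ Z → z ∈ Z → x ≢ y → x ≢ z → y ≢ z → Third x y → Third x z → ⊥
      twin-unique {x} {y} {z} xZ yZ zZ x≢y x≢z y≢z ty tz
        with twin (disconnected _ (proj₁ ty) (proj₂ ty)) xZ yZ x≢y refl zZ (x≢z ∘ sym) (y≢z ∘ sym)
           | twin (disconnected _ (proj₁ tz) (proj₂ tz)) xZ zZ x≢z refl yZ (x≢y ∘ sym) y≢z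
      ... | e , ¬e | e′ , _ = ¬e (trans e (trans (Γ-sym (y≢z ∘ sym)) (trans (sym e′) (Γ-sym (x≢y ∘ sym)))))

      third-Z : ∀ {x y} → x ∈ Z → y ∈ W → x ≢ y → Third x y → y ∈ Z
      third-Z xZ (inj₁ yZ) x≢y t = yZ
      third-Z xZ (inj₂ (inj₁ yT)) x≢y t = ⊥-elim (proj₁ t (trans (Γ-sym x≢y) (T-col yT xZ)))
      third-Z xZ (inj₂ (inj₂ yT)) x≢y t = ⊥-elim (proj₂ t (trans (Γ-sym x≢y) (T-col yT xZ)))

      third-r : ∀ {x y} → x ∈ T r → y ∈ W → x ≢ y → Third x y → y ∈ T r
      third-r xT (inj₁ yZ) x≢y t = ⊥-elim (proj₁ t (T-col xT yZ))
      third-r xT (inj₂ (inj₁ yT)) x≢y t = yT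
      third-r xT (inj₂ (inj₂ yT)) x≢y t = ⊥-elim ([ proj₁ t , proj₂ t ]′ (cross xT yT))

      third-b : ∀ {x y} → x ∈ T b → y ∈ W → x ≢ y → Third x y → y ∈ T b
      third-b xT (inj₁ yZ) x≢y t = ⊥-elim (proj₂ t (T-col xT yZ))
      third-b xT (inj₂ (inj₁ yT)) x≢y t = ⊥-elim ([ proj₁ t ∘ trans (Γ-sym x≢y) , proj₂ t ∘ trans (Γ-sym x≢y) ]′ (cross yT xT))
      third-b xT (inj₂ (inj₂ yT)) x≢y t = yT

      -- No third colour occurs between the parts `Z`, `T r` and `T b`. Within `Z` this is
      -- `twin-unique`, and the other two parts have at most two vertices.
      third-unique : ∀ {x y z} → x ∈ W → y ∈ W → z ∈ W → x ≢ y → x ≢ z → y ≢ z → Third x y → Third x z → ⊥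
      third-unique (inj₁ xZ) yW zW p q s ty tz = twin-unique xZ (third-Z xZ yW p ty) (third-Z xZ zW q tz) p q s ty tz
      third-unique (inj₂ (inj₁ xT)) yW zW p q s ty tz = <⇒≱ (#≥3 (T r) p q s xT (third-r xT yW p ty) (third-r xT zW q tz)) (T≤2 r)
      third-unique (inj₂ (inj₂ xT)) yW zW p q s ty tz = <⇒≱ (#≥3 (T b) p q s xT (third-b xT yW p ty) (third-b xT zW q tz)) (T≤2 b)

      -- A third colour inside Z gives twins x, x′; then nearly all of W has one colour s to
      -- both of them, and W is so sparse in colour s there that it contains a K₃,₃ in the other one.
      module Twins {x x′ : Fin n} (xZ : x ∈ Z) (x′Z : x′ ∈ Z) (x≢x′ : x ≢ x′) (txx′ : Third x x′) where

        alike : ∀ {w} → w ∈ W → w ≢ x → w ≢ x′ → Γ w x ≡ Γ w x′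
        alike (inj₁ wZ) p q = proj₁ (twin (disconnected _ (proj₁ txx′) (proj₂ txx′)) xZ x′Z x≢x′ refl wZ p q)
        alike (inj₂ (inj₁ wT)) p q = trans (T-col wT xZ) (sym (T-col wT x′Z))
        alike (inj₂ (inj₂ wT)) p q = trans (T-col wT xZ) (sym (T-col wT x′Z))

        two-coloured : ∀ {w} → w ∈ W → w ≢ x → w ≢ x′ → Γ w x ≡ r ⊎ Γ w x ≡ b
        two-coloured {w} wW p q with classify w x
        ... | inj₁ h = h
        ... | inj₂ (¬r , ¬b) = ⊥-elim (third-unique (inj₁ xZ) (inj₁ x′Z) wW x≢x′ (p ∘ sym) (q ∘ sym) txx′
                ((λ e → ¬r (trans (Γ-sym p) e)) , (λ e → ¬b (trans (Γ-sym p) e))))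

        N : Fin k → Sub n
        N s = record { mem  = λ w → w ∈ W × w ≢ x × w ≢ x′ × Γ w x ≡ s
                     ; mem? = λ w → mem? W w ×-dec (¬? (w ≟ x) ×-dec (¬? (w ≟ x′) ×-dec (Γ w x ≟ s))) }

        towards : Fin k → Fin n → Sub n
        towards s w = record { mem = λ p → w ≢ p × Γ w p ≡ s ; mem? = λ p → ¬? (w ≟ p) ×-dec (Γ w p ≟ s) }

        -- Otherwise x, x′ and w would have three common neighbours in colour `s`.
        sparse : ∀ s {w} → w ≢ x → w ≢ x′ → # (N s ∩ₛ towards s w) ≤ 2
        sparse s w≢x w≢x′ = star s x≢x′ (w≢x ∘ sym) (w≢x′ ∘ sym) (N s ∩ₛ towards s _) λ where
          ((pW , p≢x , p≢x′ , e) , w≢p , e′) → ((p≢x ∘ sym) , trans (Γ-sym (p≢x ∘ sym)) e) ,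
            ((p≢x′ ∘ sym) , trans (Γ-sym (p≢x′ ∘ sym)) (trans (sym (alike pW p≢x p≢x′)) e)) , (w≢p , e′)

        N-cover : 16 ≤ # (N r) + # (N b)
        N-cover = +-cancelˡ-≤ 2 _ _ (≤-trans W≥18 (≤-trans (#-mono W cover split)
          (≤-trans (#-∪ (⁅ x ⁆ ∪ₛ ⁅ x′ ⁆) (N r ∪ₛ N b)) (+-mono-≤ (≤-trans (#-∪ ⁅ x ⁆ ⁅ x′ ⁆) (+-mono-≤ (#-⁅⁆ x) (#-⁅⁆ x′))) (#-∪ (N r) (N b))))))
          where
          cover : Sub n
          cover = (⁅ x ⁆ ∪ₛ ⁅ x′ ⁆) ∪ₛ (N r ∪ₛ N b)
          split : W ⊆ cover
          split {w} wW with w ≟ x | w ≟ x′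
          ... | yes p | _     = inj₁ (inj₁ (sym p))
          ... | no _  | yes q = inj₁ (inj₂ (sym q))
          ... | no p  | no q  = inj₂ ([ (λ e → inj₁ (wW , p , q , e)) , (λ e → inj₂ (wW , p , q , e)) ]′ (two-coloured wW p q))

        -- Since x sees `N r` and `N b` in different colours, every edge between them has colour `r`
        -- or `b`. By `sparse`, each vertex of `N b` has at most two edges of colour `r` to `N r`,
        -- and each vertex of `N r` at most two of colour `b` to `N b`.
        N-product : # (N r) * # (N b) ≤ 2 * # (N b) + 2 * # (N r)
        N-product = begin
          # (N r) * # (N b)
            ≡⟨ ∑-* (# (N b)) (χ (N r)) ⟩
          ∑[ p < n ] (χ (N r) p * # (N b))
            ≡⟨ ∑-cong (λ p → *-∑ (χ (N r) p) (χ (N b))) ⟩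
          ∑[ p < n ] ∑[ w < n ] (χ (N r) p * χ (N b) w)
            ≤⟨ ∑-mono (λ p → ∑-mono (point p)) ⟩
          ∑[ p < n ] ∑[ w < n ] (χ (N b) w * χ (R w) p + χ (N r) p * χ (S p) w)
            ≡⟨ ∑-cong (λ p → ∑-+ (λ w → χ (N b) w * χ (R w) p) (λ w → χ (N r) p * χ (S p) w)) ⟩
          ∑[ p < n ] (∑[ w < n ] (χ (N b) w * χ (R w) p) + ∑[ w < n ] (χ (N r) p * χ (S p) w))
            ≡⟨ ∑-+ (λ p → ∑[ w < n ] (χ (N b) w * χ (R w) p)) (λ p → ∑[ w < n ] (χ (N r) p * χ (S p) w)) ⟩
          ∑[ p < n ] ∑[ w < n ] (χ (N b) w * χ (R w) p) + ∑[ p < n ] ∑[ w < n ] (χ (N r) p * χ (S p) w)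
            ≤⟨ +-mono-≤ (≤-trans (≤-reflexive (∑-comm (λ p w → χ (N b) w * χ (R w) p))) (rows (N b) R sparse-b))
                        (rows (N r) S sparse-r) ⟩
          2 * # (N b) + 2 * # (N r) ∎
          where
          open ≤-Reasoning
          R S : Fin n → Sub n
          R w = N r ∩ₛ towards r w
          S p = N b ∩ₛ towards b p
          sparse-b : ∀ {w} → w ∈ N b → # (R w) ≤ 2
          sparse-b (_ , p , q , _) = sparse r p q
          sparse-r : ∀ {p} → p ∈ N r → # (S p) ≤ 2
          sparse-r (_ , p , q , _) = sparse b p q
          rows : ∀ (A : Sub n) (X : Fin n → Sub n) → (∀ {w} → w ∈ A → # (X w) ≤ 2) →
            ∑[ w < n ] ∑[ p < n ] (χ A w * χ (X w) p) ≤ 2 * # A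
          rows A X h = ≤-trans (∑-mono λ w → ≤-trans (≤-reflexive (sym (*-∑ (χ A w) (χ (X w))))) (row w)) (≤-reflexive (sym (*-∑ 2 (χ A))))
            where
            row : ∀ w → χ A w * # (X w) ≤ 2 * χ A w
            row w with mem? A w
            ... | no _  = z≤n
            ... | yes p = ≤-trans (≤-reflexive (*-identityˡ _)) (h p)
          point : ∀ p w → χ (N r) p * χ (N b) w ≤ χ (N b) w * χ (R w) p + χ (N r) p * χ (S p) w
          point p w = case ((mem? (N r) p) ,′ (mem? (N b) w)) of λ where
            (no ¬p , _) → ≤-trans (≤-reflexive (cong (_* χ (N b) w) (χ-∉ (N r) ¬p))) z≤n
            (yes _ , no ¬w) → ≤-trans (≤-reflexive (trans (cong (χ (N r) p *_) (χ-∉ (N b) ¬w)) (*-zeroʳ (χ (N r) p)))) z≤n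
            (yes hp@(pW , p≢x , _ , ep) , yes hw@(wW , w≢x , _ , ew)) →
              let p≢w : p ≢ w
                  p≢w = λ { refl → r≢b (trans (sym ep) ew) } in
              ≤-trans (≤-reflexive (cong₂ _*_ (χ-∈ (N r) hp) (χ-∈ (N b) hw)))
                ([ (λ e → ≤-trans (≤-reflexive (sym (cong₂ _*_ (χ-∈ (N b) hw) (χ-∈ (R w) (hp , p≢w ∘ sym , trans (Γ-sym (p≢w ∘ sym)) e))))) (m≤m+n _ _))
                 , (λ e → ≤-trans (≤-reflexive (sym (cong₂ _*_ (χ-∈ (N r) hp) (χ-∈ (S p) (hw , p≢w , e))))) (m≤n+m _ _)) ]′
                 (fork (p≢x ∘ sym) (w≢x ∘ sym) p≢w (trans (Γ-sym (p≢x ∘ sym)) ep) (trans (Γ-sym (w≢x ∘ sym)) ew) r≢b))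

        -- A vertex p of `N s` misses at most four vertices of `N s` in colour `s′`, collected in
        -- `V p`: itself, two by `sparse`, one by `third-unique`. Three arbitrary vertices would
        -- leave only 14 - 12 = 2 common neighbours. But if p and q are not joined in colour `s′`,
        -- they lie in both `V p` and `V q`, whose union has at most 6 elements; and if there is no
        -- such pair, the union has at most 1 + 4. A third vertex then leaves at least 4.
        dense : ∀ s s′ → (∀ {p q} → Γ p q ≢ s → Γ p q ≢ s′ → Third p q) → 14 ≤ # (N s) → ⊥
        dense s s′ is-third N≥14 = first (proj₂ (#-nonempty (N s) (≤-trans (s≤s z≤n) N≥14)))
          where
          V : Fin n → Sub n
          V p = N s ∩ₛ record { mem = λ q → p ≡ q ⊎ Γ p q ≢ s′ ; mem? = λ q → (p ≟ q) ⊎-dec ¬? (Γ p q ≟ s′) }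
          thirds : Fin n → Sub n
          thirds p = record { mem = λ q → q ∈ W × p ≢ q × Γ p q ≢ s × Γ p q ≢ s′
                            ; mem? = λ q → mem? W q ×-dec (¬? (p ≟ q) ×-dec (¬? (Γ p q ≟ s) ×-dec ¬? (Γ p q ≟ s′))) }
          self : ∀ {p} → p ∈ N s → p ∈ V p
          self h = h , inj₁ refl
          V≤4 : ∀ {p} → p ∈ N s → # (V p) ≤ 4
          V≤4 {p} (pW , p≢x , p≢x′ , _) = ≤-trans (#-mono (V p) (⁅ p ⁆ ∪ₛ ((N s ∩ₛ towards s p) ∪ₛ thirds p)) split)
            (≤-trans (#-∪ ⁅ p ⁆ ((N s ∩ₛ towards s p) ∪ₛ thirds p)) (+-mono-≤ (#-⁅⁆ p)
              (≤-trans (#-∪ (N s ∩ₛ towards s p) (thirds p)) (+-mono-≤ (sparse s p≢x p≢x′)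
                (#≤1 (thirds p) λ (yW , p≢y , e₁ , e₂) (zW , p≢z , e₃ , e₄) y≢z →
                  third-unique pW yW zW p≢y p≢z y≢z (is-third e₁ e₂) (is-third e₃ e₄))))))
            where
            split : V p ⊆ (⁅ p ⁆ ∪ₛ ((N s ∩ₛ towards s p) ∪ₛ thirds p))
            split {q} (qN , h) with p ≟ q | Γ p q ≟ s
            ... | yes e | _ = inj₁ e
            ... | no p≢q | yes e = inj₂ (inj₁ (qN , p≢q , e))
            ... | no p≢q | no ¬e = inj₂ (inj₂ (proj₁ qN , p≢q , ¬e , [ (λ e → ⊥-elim (p≢q e)) , id ]′ h))
          last : ∀ {p q} → p ∈ N s → q ∈ N s → p ≢ q → # (V p ∪ₛ V q) ≤ 6 → ⊥
          last {p} {q} pN qN p≢q h = third-step (proj₂ (#-nonempty rest (≤-trans (s≤s z≤n) rest≥8)))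
            where
            rest : Sub n
            rest = N s ∖ₛ (V p ∪ₛ V q)
            rest≥8 : 8 ≤ # rest
            rest≥8 = +-cancelˡ-≤ 6 _ _ (≤-trans N≥14 (≤-trans (#-split (N s) (V p ∪ₛ V q))
              (+-monoˡ-≤ (# rest) (≤-trans (#-mono (N s ∩ₛ (V p ∪ₛ V q)) (V p ∪ₛ V q) proj₂) h))))
            away : ∀ {t u} → u ∈ N s → u ∉ V t → t ≢ u × Γ t u ≡ s′
            away {t} {u} uN ¬uV with t ≟ u | Γ t u ≟ s′
            ... | yes e | _     = ⊥-elim (¬uV (uN , inj₁ e))
            ... | no ne | yes e = ne , e
            ... | no _  | no ¬e = ⊥-elim (¬uV (uN , inj₂ ¬e))
            third-step : ∀ {t} → t ∈ rest → ⊥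
            third-step {t} (tN , ¬tV) = <⇒≱ (≤-trans (n≤1+n 3) final≥4)
                    (star s′ p≢q (proj₁ (away tN (¬tV ∘ inj₁))) (proj₁ (away tN (¬tV ∘ inj₂))) final
                      λ ((uN , ¬uV) , ¬uVt) → away uN (¬uV ∘ inj₁) , away uN (¬uV ∘ inj₂) , away uN ¬uVt)
              where
              final : Sub n
              final = rest ∖ₛ V t
              final≥4 : 4 ≤ # final
              final≥4 = +-cancelˡ-≤ 4 _ _ (≤-trans rest≥8 (≤-trans (#-split rest (V t))
                (+-monoˡ-≤ (# final) (≤-trans (#-mono (rest ∩ₛ V t) (V t) proj₂) (V≤4 tN)))))
          linked : ∀ {p q} → p ∈ N s → q ∈ N s → p ≢ q → Γ p q ≢ s′ → ⊥
          linked {p} {q} pN qN p≢q e = last pN qN p≢q (≤-trans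
                    (≤-trans (#-mono (V p ∪ₛ V q) (V p ∪ₛ ((V q ∖ₛ ⁅ q ⁆) ∖ₛ ⁅ p ⁆)) split) (#-∪ (V p) ((V q ∖ₛ ⁅ q ⁆) ∖ₛ ⁅ p ⁆)))
                    (+-mono-≤ (V≤4 pN) (s≤s⁻¹ (s≤s⁻¹ (≤-trans (s≤s (#-remove (V q ∖ₛ ⁅ q ⁆) (pV , p≢q ∘ sym))) (≤-trans (#-remove (V q) (self qN)) (V≤4 qN)))))))
            where
            pV : p ∈ V q
            pV = pN , inj₂ λ e′ → e (trans (Γ-sym p≢q) e′)
            split : (V p ∪ₛ V q) ⊆ (V p ∪ₛ ((V q ∖ₛ ⁅ q ⁆) ∖ₛ ⁅ p ⁆))
            split {t} (inj₁ tV) = inj₁ tV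
            split {t} (inj₂ tV) = case ((p ≟ t) ,′ (q ≟ t)) of λ where
              (yes refl , _)        → inj₁ (self pN)
              (no _     , yes refl) → inj₁ (qN , inj₂ e)
              (no p≢t   , no q≢t)   → inj₂ ((tV , q≢t) , p≢t)
          first : ∀ {p} → p ∈ N s → ⊥
          first {p} pN = second (proj₂ (#-nonempty (N s ∖ₛ ⁅ p ⁆) nonempty))
            where
            nonempty : 1 ≤ # (N s ∖ₛ ⁅ p ⁆)
            nonempty = ≤-trans (s≤s z≤n) (+-cancelˡ-≤ 1 13 _ (≤-trans N≥14 (≤-trans (#-split (N s) ⁅ p ⁆)
                               (+-monoˡ-≤ _ (≤-trans (#-mono (N s ∩ₛ ⁅ p ⁆) ⁅ p ⁆ proj₂) (#-⁅⁆ p))))))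
            only : V p ⊆ ⁅ p ⁆
            only {t} (tN , h) = case p ≟ t of λ where
              (yes e) → e
              (no ne) → ⊥-elim ([ ne , linked pN tN ne ]′ h)
            second : ∀ {q} → q ∈ (N s ∖ₛ ⁅ p ⁆) → ⊥
            second {q} (qN , p≢q) = last pN qN p≢q (≤-trans (#-∪ (V p) (V q))
                      (≤-trans (+-mono-≤ (≤-trans (#-mono (V p) ⁅ p ⁆ only) (#-⁅⁆ p)) (V≤4 qN)) (n≤1+n 5)))

        contradiction : ⊥
        contradiction =
          [ (λ h → dense b r (λ p q → q , p) (+-cancelˡ-≤ 2 _ _ (≤-trans N-cover (+-monoˡ-≤ (# (N b)) h))))
          , (λ h → dense r b (λ p q → p , q) (+-cancelʳ-≤ 2 _ _ (≤-trans N-cover (+-monoʳ-≤ (# (N r)) h)))) ]′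
          (one-is-small (# (N r)) (# (N b)) N-product (≤-trans (m≤m+n 10 6) N-cover))

      third-free : ∀ {x y} → x ∈ Z → y ∈ Z → x ≢ y → Γ x y ≡ r ⊎ Γ x y ≡ b
      third-free {x} {y} xZ yZ x≢y = [ id , (λ t → ⊥-elim (Twins.contradiction xZ yZ x≢y t)) ]′ (classify x y)

      -- The edges inside T r are recoloured b and those inside T b are recoloured r;
      -- as T r and T b have at most two vertices, no monochromatic K₃,₃ arises.
      data Recoloured (x y : Fin n) : Fin k → Set where
        inside-r : x ∈ T r → y ∈ T r → Recoloured x y b
        inside-b : x ∈ T b → y ∈ T b → Recoloured x y r
        kept     : ¬ (x ∈ T r × y ∈ T r) → ¬ (x ∈ T b × y ∈ T b) → Recoloured x y (Γ x y)

      recolour : ∀ x y → Σ (Fin k) (Recoloured x y)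
      recolour x y = case ((mem? (T r) x ×-dec mem? (T r) y) ,′ (mem? (T b) x ×-dec mem? (T b) y)) of λ where
        (yes (p , q) , _)           → b , inside-r p q
        (no _ , yes (p , q))        → r , inside-b p q
        (no ¬p , no ¬q)             → Γ x y , kept ¬p ¬q

      ρ : Fin n → Fin n → Fin k
      ρ x y = proj₁ (recolour x y)

      apart : ∀ {x} → x ∈ T r → x ∉ T b
      apart p q = r≢b (trans (sym (proj₂ p)) (proj₂ q))

      recoloured-sym : ∀ {x y a a′} → x ≢ y → Recoloured x y a → Recoloured y x a′ → a ≡ a′
      recoloured-sym x≢y (inside-r p q) (inside-r _ _) = refl
      recoloured-sym x≢y (inside-r p q) (inside-b p′ q′) = ⊥-elim (apart p q′)
      recoloured-sym x≢y (inside-r p q) (kept h _) = ⊥-elim (h (q , p))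
      recoloured-sym x≢y (inside-b p q) (inside-r p′ q′) = ⊥-elim (apart q′ p)
      recoloured-sym x≢y (inside-b p q) (inside-b _ _) = refl
      recoloured-sym x≢y (inside-b p q) (kept _ h) = ⊥-elim (h (q , p))
      recoloured-sym x≢y (kept h _) (inside-r p q) = ⊥-elim (h (q , p))
      recoloured-sym x≢y (kept _ h) (inside-b p q) = ⊥-elim (h (q , p))
      recoloured-sym x≢y (kept _ _) (kept _ _) = Γ-sym x≢y

      recoloured-two : ∀ {x y a} → x ∈ W → y ∈ W → x ≢ y → Recoloured x y a → a ≡ r ⊎ a ≡ b
      recoloured-two xW yW x≢y (inside-r _ _) = inj₂ refl
      recoloured-two xW yW x≢y (inside-b _ _) = inj₁ refl
      recoloured-two (inj₁ xZ) (inj₁ yZ) x≢y (kept _ _) = third-free xZ yZ x≢y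
      recoloured-two (inj₁ xZ) (inj₂ (inj₁ yT)) x≢y (kept _ _) = inj₁ (trans (Γ-sym x≢y) (T-col yT xZ))
      recoloured-two (inj₁ xZ) (inj₂ (inj₂ yT)) x≢y (kept _ _) = inj₂ (trans (Γ-sym x≢y) (T-col yT xZ))
      recoloured-two (inj₂ (inj₁ xT)) (inj₁ yZ) x≢y (kept _ _) = inj₁ (T-col xT yZ)
      recoloured-two (inj₂ (inj₂ xT)) (inj₁ yZ) x≢y (kept _ _) = inj₂ (T-col xT yZ)
      recoloured-two (inj₂ (inj₁ xT)) (inj₂ (inj₁ yT)) x≢y (kept h _) = ⊥-elim (h (xT , yT))
      recoloured-two (inj₂ (inj₁ xT)) (inj₂ (inj₂ yT)) x≢y (kept _ _) = cross xT yT
      recoloured-two (inj₂ (inj₂ xT)) (inj₂ (inj₁ yT)) x≢y (kept _ _) =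
        [ (λ e → inj₁ (trans (Γ-sym x≢y) e)) , (λ e → inj₂ (trans (Γ-sym x≢y) e)) ]′ (cross yT xT)
      recoloured-two (inj₂ (inj₂ xT)) (inj₂ (inj₂ yT)) x≢y (kept _ h) = ⊥-elim (h (xT , yT))

      module Monochromatic (s s′ : Fin k) (s≢s′ : s ≢ s′)
        (parts : ∀ {y} → y ∈ W → y ∈ Z ⊎ y ∈ T s′ ⊎ y ∈ T s)
        (view : ∀ {x y a} → Recoloured x y a → a ≡ s → (x ∈ T s′ × y ∈ T s′) ⊎ (¬ (x ∈ T s′ × y ∈ T s′) × Γ x y ≡ s))
        (avoid : ∀ {x y a} → Recoloured x y a → a ≡ s → ¬ (x ∈ T s × y ∈ T s)) where

        reaches : ∀ {x y} → x ∈ T s′ → y ∈ W → y ∉ T s′ → Γ x y ≡ s → y ∈ T s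
        reaches xT yW ¬yT e with parts yW
        ... | inj₁ yZ = ⊥-elim (s≢s′ (trans (sym e) (T-col xT yZ)))
        ... | inj₂ (inj₁ yT) = ⊥-elim (¬yT yT)
        ... | inj₂ (inj₂ yT) = yT

        next : Fin 3 → Fin 3
        next zero    = suc zero
        next (suc _) = zero

        next-≢ : ∀ i → i ≢ next i
        next-≢ zero    ()
        next-≢ (suc _) ()

        -- Without recoloured edges the K₃,₃ would be one of the given colouring. A recoloured edge
        -- uses up both vertices of `T s′`, one on each side. These see `Z` in colour `s′`, so their
        -- other neighbours in the K₃,₃ lie in `T s`, on both sides; but no edge inside `T s` has
        -- colour `s` any more.
        noK33 : ∀ (u v : Fin 3 → Fin n) → (∀ i → u i ∈ W) → (∀ j → v j ∈ W) → Distinct u → Distinct v →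
          (∀ i j → u i ≢ v j) → (∀ i j → ρ (u i) (v j) ≡ s) → ⊥
        noK33 u v uW vW du dv uv e = case F.any? (λ i → F.any? (λ j → mem? (T s′) (u i) ×-dec mem? (T s′) (v j))) of λ where
            (no ¬p) → noK (u , v , s , du , dv , uv , λ i j →
                [ (λ h → ⊥-elim (¬p (i , j , h))) , proj₂ ]′ (view (proj₂ (recolour (u i) (v j))) (e i j)))
            (yes (i , j , uT , vT)) → clash i j uT vT
          where
          clash : ∀ i j → u i ∈ T s′ → v j ∈ T s′ → ⊥
          clash i j uT vT = avoid (proj₂ (recolour (u i′) (v j′))) (e i′ j′) (u′ , v′)
            where
            i′ = next i
            j′ = next j
            v′ : v j′ ∈ T s
            v′ = reaches uT (vW j′) ¬vT ([ (λ h → ⊥-elim (¬vT (proj₂ h))) , proj₂ ]′ (view (proj₂ (recolour (u i) (v j′))) (e i j′)))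
              where
              ¬vT : v j′ ∉ T s′
              ¬vT h = <⇒≱ (#≥3 (T s′) (uv i j) (uv i j′) (dv j j′ (next-≢ j)) uT vT h) (T≤2 s′)
            u′ : u i′ ∈ T s
            u′ = reaches vT (uW i′) ¬uT (trans (Γ-sym (uv i′ j ∘ sym))
                   ([ (λ h → ⊥-elim (¬uT (proj₁ h))) , proj₂ ]′ (view (proj₂ (recolour (u i′) (v j))) (e i′ j))))
              where
              ¬uT : u i′ ∉ T s′
              ¬uT h = <⇒≱ (#≥3 (T s′) (uv i j ∘ sym) (uv i′ j ∘ sym) (du i i′ (next-≢ i)) vT uT h) (T≤2 s′)

      no-b : ∀ (u v : Fin 3 → Fin n) → (∀ i → u i ∈ W) → (∀ j → v j ∈ W) → Distinct u → Distinct v →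
          (∀ i j → u i ≢ v j) → (∀ i j → ρ (u i) (v j) ≡ b) → ⊥
      no-b = Monochromatic.noK33 b r (r≢b ∘ sym) id view avoid
        where
        view : ∀ {x y a} → Recoloured x y a → a ≡ b → (x ∈ T r × y ∈ T r) ⊎ (¬ (x ∈ T r × y ∈ T r) × Γ x y ≡ b)
        view (inside-r p q) e = inj₁ (p , q)
        view (inside-b p q) e = ⊥-elim (r≢b e)
        view (kept h _) e = inj₂ (h , e)
        avoid : ∀ {x y a} → Recoloured x y a → a ≡ b → ¬ (x ∈ T b × y ∈ T b)
        avoid (inside-r p q) e (p′ , _) = apart p p′
        avoid (inside-b p q) e _ = r≢b e
        avoid (kept _ h) e h′ = h h′

      no-r : ∀ (u v : Fin 3 → Fin n) → (∀ i → u i ∈ W) → (∀ j → v j ∈ W) → Distinct u → Distinct v →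
          (∀ i j → u i ≢ v j) → (∀ i j → ρ (u i) (v j) ≡ r) → ⊥
      no-r = Monochromatic.noK33 r b r≢b [ inj₁ , [ inj₂ ∘ inj₂ , inj₂ ∘ inj₁ ]′ ]′ view avoid
        where
        view : ∀ {x y a} → Recoloured x y a → a ≡ r → (x ∈ T b × y ∈ T b) ⊎ (¬ (x ∈ T b × y ∈ T b) × Γ x y ≡ r)
        view (inside-r p q) e = ⊥-elim (r≢b (sym e))
        view (inside-b p q) e = inj₁ (p , q)
        view (kept _ h) e = inj₂ (h , e)
        avoid : ∀ {x y a} → Recoloured x y a → a ≡ r → ¬ (x ∈ T r × y ∈ T r)
        avoid (inside-r p q) e _ = r≢b (sym e)
        avoid (inside-b p q) e (p′ , _) = apart p′ p
        avoid (kept h _) e h′ = h h′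

      impossible : ⊥
      impossible = conclude (#-pick 18 W W≥18)
        where
        conclude : (Σ (Fin 18 → Fin n) λ h → Distinct h × (∀ i → h i ∈ W)) → ⊥
        conclude (h , d , h∈) = ramsey red (λ x y p → cong (λ z → does (z ≟ r)) (recoloured-sym (d x y p) (proj₂ (recolour (h x) (h y))) (proj₂ (recolour (h y) (h x))))) no-mono
          where
          red : Fin 18 → Fin 18 → Bool
          red x y = does (ρ (h x) (h y) ≟ r)
          does-true : ∀ {a : Fin k} → does (a ≟ r) ≡ true → a ≡ r
          does-true {a} e with a ≟ r
          ... | yes p = p
          does-false : ∀ {a : Fin k} → does (a ≟ r) ≡ false → a ≢ r
          does-false {a} e with a ≟ r
          ... | no p = p
          lift : ∀ {u : Fin 3 → Fin 18} → Distinct u → Distinct (h ∘ u)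
          lift du i j p = d _ _ (du i j p)
          no-mono : ∀ s → NoK33 (λ x y → red x y ≡ s)
          no-mono true u v du dv uv e = no-r (h ∘ u) (h ∘ v) (h∈ ∘ u) (h∈ ∘ v) (lift du) (lift dv) (λ i j → d _ _ (uv i j))
            (λ i j → does-true (e i j))
          no-mono false u v du dv uv e = no-b (h ∘ u) (h ∘ v) (h∈ ∘ u) (h∈ ∘ v) (lift du) (lift dv) (λ i j → d _ _ (uv i j))
            (λ i j → [ (λ q → ⊥-elim (does-false (e i j) q)) , id ]′
              (recoloured-two (h∈ (u i)) (h∈ (v j)) (d _ _ (uv i j)) (proj₂ (recolour (h (u i)) (h (v j))))))

  upper : ⊥
  upper = minimal (λ Z → IsModule Z × 3 ≤ # Z) full
    ((λ ¬y _ _ → ⊥-elim (¬y zero)) , ≤-trans (≤-trans (m≤m+n 3 11) (m≤n+m 14 (2 * k))) (≤-trans n-large (≤-reflexive (sym #-full))))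
    λ Z (isModule , Z≥3) least → MinimalModule.two-colours Z isModule Z≥3 least
      (proj₂ (#-nonempty Z (≤-trans (s≤s z≤n) Z≥3)))
      (MinimalModule.TwoColours.impossible Z isModule Z≥3 least (proj₂ (#-nonempty Z (≤-trans (s≤s z≤n) Z≥3))))

-- Decidability of the two alternatives

-- `P` has to respect pointwise equality, because a function is only pointwise equal to its head
-- followed by its tail.
fin-functions? : ∀ m {P : (Fin m → Fin n) → Set} → (∀ {f g} → (∀ i → f i ≡ g i) → P f → P g) →
  (∀ f → Dec (P f)) → Dec (Σ (Fin m → Fin n) P)
fin-functions? zero {P} resp P? with P? (λ ())
... | yes p = yes ((λ ()) , p)
... | no ¬p = no λ (f , p) → ¬p (resp (λ ()) p)
fin-functions? {n} (suc m) {P} resp P? = map′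
  (λ (x , f , p) → x V.∷ f , p)
  (λ (f , p) → f zero , f ∘ suc , resp (λ { zero → refl ; (suc i) → refl }) p)
  (F.any? λ x → fin-functions? m {λ f → P (x V.∷ f)} (λ e → resp λ { zero → refl ; (suc i) → e i }) (λ f → P? (x V.∷ f)))

rainbow? : (c : Colouring k n) → Dec (RainbowTriangle c)
rainbow? c = F.any? λ x → F.any? λ y → F.any? λ z →
  (¬? (x ≟ y) ×-dec (¬? (y ≟ z) ×-dec ¬? (x ≟ z))) ×-dec
  (¬? (col c x y ≟ col c y z) ×-dec (¬? (col c y z ≟ col c x z) ×-dec ¬? (col c x y ≟ col c x z)))

monoK33? : (c : Colouring k n) → Dec (MonoK33 c)
monoK33? c = fin-functions? 3 (λ e (v , a , du , dv , uv , h) → v , a ,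
    (λ i j p q → du i j p (trans (e i) (trans q (sym (e j))))) , dv , (λ i j q → uv i j (trans (e i) q)) ,
    (λ i j → trans (cong (λ t → col c t (v j)) (sym (e i))) (h i j)))
  λ u → fin-functions? 3 (λ e (a , du , dv , uv , h) → a , du ,
    (λ i j p q → dv i j p (trans (e i) (trans q (sym (e j))))) , (λ i j q → uv i j (trans q (sym (e j)))) ,
    (λ i j → trans (cong (col c (u i)) (sym (e j))) (h i j)))
  λ v → F.any? λ a →
    (F.all? λ i → F.all? λ j → ¬? (i ≟ j) →-dec ¬? (u i ≟ u j)) ×-dec
    ((F.all? λ i → F.all? λ j → ¬? (i ≟ j) →-dec ¬? (v i ≟ v j)) ×-dec
    ((F.all? λ i → F.all? λ j → ¬? (u i ≟ v j)) ×-dec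
    (F.all? λ i → F.all? λ j → col c (u i) (v j) ≟ a)))

decide-⊎ : ∀ {A B : Set} → Dec A → Dec B → (¬ A → ¬ B → ⊥) → A ⊎ B
decide-⊎ (yes a) _ h       = inj₁ a
decide-⊎ (no ¬a) (yes b) h = inj₂ b
decide-⊎ (no ¬a) (no ¬b) h = ⊥-elim (h ¬a ¬b)

upper-bound : ∀ k → 3 ≤ k → ∀ n → 2 * k + 14 ≤ n → GRProperty k n
upper-bound k 3≤k n h c _ = decide-⊎ (rainbow? c) (monoK33? c) λ ¬p ¬q → Upper.upper c ¬p ¬q 3≤k h

-- The extremal colouring

opaque
  -- Indicator of the squares modulo 17: colouring x y by qr ∣ x - y ∣ gives the Paley graph.
  qr : ℕ → ℕ
  qr d = ⟦ does (d ∈? (1 ∷ 2 ∷ 4 ∷ 8 ∷ 9 ∷ 13 ∷ 15 ∷ 16 ∷ [])) ⟧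

  qr-bit : ∀ d → IsBit (qr d)
  qr-bit d = ⟦⟧-bit _

-- Vertices 0, …, 16 have level 0, vertices 15 + 2 l and 16 + 2 l have level l ≥ 1.
level : ℕ → ℕ
level t = ⌊ t ∸ 15 /2⌋

hue : ℕ → ℕ → ℕ → ℕ
hue zero    s t = qr ∣ s - t ∣
hue (suc l) s t = 2 + l

colour : ℕ → ℕ → ℕ
colour s t = hue (level s ⊔ level t) s t

colour-sym : ∀ s t → colour s t ≡ colour t s
colour-sym s t rewrite ⊔-comm (level s) (level t) = flip (level t ⊔ level s)
  where
  flip : ∀ l → hue l s t ≡ hue l t s
  flip zero    = cong qr (∣-∣-comm s t)
  flip (suc l) = refl

hue-low : ∀ l s t {a} → hue l s t ≡ a → a ≤ 1 → l ≡ 0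
hue-low zero    s t e h = refl
hue-low (suc l) s t refl (s≤s ())

hue-high : ∀ l s t {m} → hue l s t ≡ 2 + m → l ≡ suc m
hue-high zero s t e with qr-bit ∣ s - t ∣
... | inj₁ q with () ← trans (sym q) e
... | inj₂ q with () ← trans (sym q) e
hue-high (suc l) s t refl = refl

-- A positive level of z, being the highest, determines the colour of both edges at z; otherwise all
-- three vertices have level 0, where only the colours 0 and 1 occur.
no-rainbow-at : ∀ x y z → level x ≤ level z → level y ≤ level z →
  colour x z ≡ colour y z ⊎ (IsBit (colour x z) × IsBit (colour y z) × IsBit (colour x y))
no-rainbow-at x y z p q with level z in e
... | zero rewrite n≤0⇒n≡0 p | n≤0⇒n≡0 q = inj₂ (qr-bit _ , qr-bit _ , qr-bit _)
... | suc l rewrite m≤n⇒m⊔n≡n p | m≤n⇒m⊔n≡n q = inj₁ refl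

pigeonhole : ∀ {a b x y z : ℕ} → x ≡ a ⊎ x ≡ b → y ≡ a ⊎ y ≡ b → z ≡ a ⊎ z ≡ b → x ≢ y → x ≢ z → y ≢ z → ⊥
pigeonhole (inj₁ refl) (inj₁ refl) _           p q r = p refl
pigeonhole (inj₁ refl) (inj₂ refl) (inj₁ refl) p q r = q refl
pigeonhole (inj₁ refl) (inj₂ refl) (inj₂ refl) p q r = r refl
pigeonhole (inj₂ refl) (inj₁ refl) (inj₁ refl) p q r = r refl
pigeonhole (inj₂ refl) (inj₁ refl) (inj₂ refl) p q r = q refl
pigeonhole (inj₂ refl) (inj₂ refl) _           p q r = p refl

no-rainbow : ∀ x y z → colour x y ≢ colour y z → colour y z ≢ colour x z → colour x y ≢ colour x z → ⊥
no-rainbow x y z p q r with ≤-total (level x) (level y) | ≤-total (level y) (level z) | ≤-total (level x) (level z)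
... | _ | inj₁ yz | inj₁ xz = [ q ∘ sym , (λ (a , b , c) → pigeonhole c b a p r q) ]′ (no-rainbow-at x y z xz yz)
... | inj₁ xy | inj₂ zy | _ = [ (λ e → p (trans e (colour-sym z y))) ,
      (λ (a , b , c) → pigeonhole a (subst IsBit (colour-sym z y) b) c p r q) ]′ (no-rainbow-at x z y xy zy)
... | inj₁ xy | inj₁ yz | inj₂ zx = [ q ∘ sym , (λ (a , b , c) → pigeonhole c b a p r q) ]′ (no-rainbow-at x y z (≤-trans xy yz) yz)
... | inj₂ yx | _ | inj₂ zx = [ (λ e → r (trans (colour-sym x y) (trans e (colour-sym z x)))) ,
      (λ (a , b , c) → pigeonhole (subst IsBit (colour-sym y x) a) c (subst IsBit (colour-sym z x) b) p r q) ]′ (no-rainbow-at y z x yx zx)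
... | inj₂ yx | inj₂ zy | inj₁ xz = [ (λ e → p (trans e (colour-sym z y))) ,
      (λ (a , b , c) → pigeonhole a (subst IsBit (colour-sym z y) b) c p r q) ]′ (no-rainbow-at x z y (≤-trans xz zy) zy)

level-0 : ∀ t → level t ≡ 0 → t < 17
level-0 t e = ≰⇒> λ h → <⇒≱ (⌊n/2⌋-mono (∸-monoˡ-≤ 15 h)) (≤-reflexive e)

half-inverse : ∀ x p → ⌊ x /2⌋ ≡ p → x ≡ p + p ⊎ x ≡ suc (p + p)
half-inverse zero          _       refl = inj₁ refl
half-inverse (suc zero)    _       refl = inj₂ refl
half-inverse (suc (suc x)) (suc p) e with half-inverse x p (suc-injective e)
... | inj₁ h = inj₁ (cong suc (trans (cong suc h) (sym (+-suc p p))))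
... | inj₂ h = inj₂ (cong suc (cong suc (trans h (sym (+-suc p p)))))

level-values : ∀ t l → level t ≡ suc l → t ≡ 15 + (suc l + suc l) ⊎ t ≡ 15 + suc (suc l + suc l)
level-values t l e = [ (λ q → inj₁ (trans (sym (m+[n∸m]≡n h)) (cong (15 +_) q))) , (λ q → inj₂ (trans (sym (m+[n∸m]≡n h)) (cong (15 +_) q))) ]′
    (half-inverse (t ∸ 15) (suc l) e)
  where
  h : 15 ≤ t
  h = [ id , (λ t≤15 → ⊥-elim (0≢1+n (trans (sym (cong ⌊_/2⌋ (m≤n⇒m∸n≡0 t≤15))) e))) ]′ (≤-total 15 t)

two-per-level : ∀ {x y z l} → level x ≡ suc l → level y ≡ suc l → level z ≡ suc l → x ≢ y → x ≢ z → y ≢ z → ⊥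
two-per-level {l = l} ex ey ez = pigeonhole (level-values _ l ex) (level-values _ l ey) (level-values _ l ez)

common : ℕ → (x y z w : Fin 17) → Bool
common s x y z w = at x ∧ (at y ∧ at z)
  where
  at : Fin 17 → Bool
  at v = not (does (v ≟ w)) ∧ (qr ∣ toℕ v - toℕ w ∣ ≡ᵇ s)

∧-intro : ∀ {a b} → a ≡ true → b ≡ true → a ∧ b ≡ true
∧-intro refl refl = refl

allᵇ : ∀ n → (Fin n → Bool) → Bool
allᵇ zero    f = true
allᵇ (suc n) f = f zero ∧ allᵇ n (f ∘ suc)

allᵇ-sound : ∀ n (f : Fin n → Bool) → allᵇ n f ≡ true → ∀ i → f i ≡ true
allᵇ-sound (suc n) f e zero with f zero | e
... | true | _ = refl
allᵇ-sound (suc n) f e (suc i) with f zero | e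
... | true | e′ = allᵇ-sound n (f ∘ suc) e′ i

count : ∀ n → (Fin n → Bool) → ℕ
count zero    f = 0
count (suc n) f = ⟦ f zero ⟧ + count n (f ∘ suc)

∑≡count : ∀ n (f : Fin n → Bool) → ∑[ i < n ] ⟦ f i ⟧ ≡ count n f
∑≡count zero    f = ∑-0 _
∑≡count (suc n) f = trans (∑-suc _) (cong (⟦ f zero ⟧ +_) (∑≡count n (f ∘ suc)))

few : ℕ → (x y z : Fin 17) → Bool
few s x y z = does (x ≟ y) ∨ (does (x ≟ z) ∨ (does (y ≟ z) ∨ (count 17 (common s x y z) ≤ᵇ 2)))

few-sound : ∀ s {x y z} → few s x y z ≡ true → x ≢ y → x ≢ z → y ≢ z → count 17 (common s x y z) ≤ 2
few-sound s {x} {y} {z} e p q r = ≤ᵇ⇒≤ _ 2 (subst Bool.T (sym (trans (sym (reduce (dec-false (x ≟ y) p) (dec-false (x ≟ z) q) (dec-false (y ≟ z) r))) e)) tt)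
  where
  reduce : ∀ {a b c d} → a ≡ false → b ≡ false → c ≡ false → a ∨ (b ∨ (c ∨ d)) ≡ d
  reduce refl refl refl = refl

opaque
  unfolding qr

  -- By evaluation over all 17³ triples for each colour: three distinct vertices have at most two
  -- common neighbours, both in the Paley graph and in its complement. Triples with a repeated
  -- vertex pass `few` by default.
  few-all : ∀ s → s ≤ 1 → ∀ x y z → few s x y z ≡ true
  few-all 0 _ x y z = allᵇ-sound 17 (few 0 x y) (allᵇ-sound 17 (λ y → allᵇ 17 (few 0 x y))
    (allᵇ-sound 17 (λ x → allᵇ 17 λ y → allᵇ 17 (few 0 x y)) refl x) y) z
  few-all 1 _ x y z = allᵇ-sound 17 (few 1 x y) (allᵇ-sound 17 (λ y → allᵇ 17 (few 1 x y))
    (allᵇ-sound 17 (λ x → allᵇ 17 λ y → allᵇ 17 (few 1 x y)) refl x) y) z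
  few-all (suc (suc s)) (s≤s ())

paley-K33-free : ∀ s → s ≤ 1 → (u v : Fin 3 → Fin 17) → Distinct u → Distinct v → (∀ i j → u i ≢ v j) →
  (∀ i j → qr ∣ toℕ (u i) - toℕ (v j) ∣ ≡ s) → ⊥
paley-K33-free s h u v du dv uv e = <⇒≱ (≤-trans (∑≥distinct 3 (λ w → ⟦ common s x y z w ⟧) v dv (λ j → cong ⟦_⟧ (hit j)))
    (≤-reflexive (∑≡count 17 (common s x y z))))
  (few-sound s (few-all s h x y z) (du zero (suc zero) λ ()) (du zero (suc (suc zero)) λ ()) (du (suc zero) (suc (suc zero)) λ ()))
  where
  x = u zero
  y = u (suc zero)
  z = u (suc (suc zero))
  eq : ∀ {a} → a ≡ s → (a ≡ᵇ s) ≡ true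
  eq {a} refl = dec-true (a ℕ.≟ a) refl
  hit : ∀ j → common s x y z (v j) ≡ true
  hit j = ∧-intro (at zero) (∧-intro (at (suc zero)) (at (suc (suc zero))))
    where
    at : ∀ i → not (does (u i ≟ v j)) ∧ (qr ∣ toℕ (u i) - toℕ (v j) ∣ ≡ᵇ s) ≡ true
    at i = ∧-intro (cong not (dec-false (u i ≟ v j) (uv i j))) (eq (e i j))

module Lower (k : ℕ) (3≤k : 3 ≤ k) where

  N : ℕ
  -- 17 vertices of level 0 and two for each of the k - 2 higher levels.
  N = 2 * k + 13

  level-bound : ∀ {t} → t < N → 2 + level t ≤ k
  level-bound {t} h = [ high , low ]′ (≤-total 15 t)
    where
    low : t ≤ 15 → 2 + level t ≤ k
    low t≤15 = ≤-trans (≤-reflexive (cong (λ z → 2 + ⌊ z /2⌋) (m≤n⇒m∸n≡0 t≤15))) (≤-trans (n≤1+n 2) 3≤k)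
    high : 15 ≤ t → 2 + level t ≤ k
    high 15≤t = s≤s⁻¹ (*-cancelˡ-< 2 (2 + level t) (suc k) (+-cancelʳ-≤ 12 _ _ (begin
      suc (2 * (2 + level t)) + 12     ≡⟨ arith (level t) ⟩
      17 + (level t + level t)         ≤⟨ +-monoʳ-≤ 17 double ⟩
      17 + (t ∸ 15)                    ≡⟨ cong (2 +_) (m+[n∸m]≡n 15≤t) ⟩
      2 + t                            ≤⟨ s≤s h ⟩
      suc (2 * k + 13)                 ≡⟨ arith′ k ⟩
      2 * suc k + 12                   ∎)))
      where
      open ≤-Reasoning
      arith : ∀ l → suc (2 * (2 + l)) + 12 ≡ 17 + (l + l)
      arith = solve-∀
      arith′ : ∀ k → suc (2 * k + 13) ≡ 2 * suc k + 12
      arith′ = solve-∀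
      double : level t + level t ≤ t ∸ 15
      double = [ (λ e → ≤-reflexive (sym e)) , (λ e → ≤-trans (n≤1+n _) (≤-reflexive (sym e))) ]′ (half-inverse (t ∸ 15) (level t) refl)

  hue-bound : ∀ l s t → 2 + l ≤ k → hue l s t < k
  hue-bound zero    s t h = ≤-trans (s≤s (bit-≤1 (qr-bit ∣ s - t ∣))) h
  hue-bound (suc l) s t h = h

  colour-bound : ∀ {s t} → s < N → t < N → colour s t < k
  colour-bound {s} {t} hs ht = hue-bound (level s ⊔ level t) s t
    ([ (λ e → subst (λ z → 2 + z ≤ k) (sym e) (level-bound hs)) , (λ e → subst (λ z → 2 + z ≤ k) (sym e) (level-bound ht)) ]′
      (⊔-sel (level s) (level t)))

  colouring : Colouring k N
  colouring = record
    { col = λ i j → fromℕ< (colour-bound (F.toℕ<n i) (F.toℕ<n j))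
    ; sym = λ i j _ → F.fromℕ<-cong _ _ (colour-sym (toℕ i) (toℕ j)) _ _
    }

  col-colour : ∀ i j {a} → col colouring i j ≡ a → colour (toℕ i) (toℕ j) ≡ toℕ a
  col-colour i j e = trans (sym (F.toℕ-fromℕ< _)) (cong toℕ e)

  rainbow-free : ¬ RainbowTriangle colouring
  rainbow-free (x , y , z , _ , p , q , r) = no-rainbow (toℕ x) (toℕ y) (toℕ z) (p ∘ lift x y y z) (q ∘ lift y z x z) (r ∘ lift x y x z)
    where
    lift : ∀ i j i′ j′ → colour (toℕ i) (toℕ j) ≡ colour (toℕ i′) (toℕ j′) → col colouring i j ≡ col colouring i′ j′
    lift i j i′ j′ e = F.fromℕ<-cong (colour (toℕ i) (toℕ j)) (colour (toℕ i′) (toℕ j′)) e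
      (colour-bound (F.toℕ<n i) (F.toℕ<n j)) (colour-bound (F.toℕ<n i′) (F.toℕ<n j′))

  K33-free : ¬ MonoK33 colouring
  K33-free (u , v , a , du , dv , uv , e) = go (toℕ a) refl
    where
    U V : Fin 3 → ℕ
    U = toℕ ∘ u
    V = toℕ ∘ v
    same-level : ∀ (w : Fin 3 → Fin N) {l} → Distinct w → (∀ i → level (toℕ (w i)) ≡ suc l) → ⊥
    same-level w d h = two-per-level (h zero) (h (suc zero)) (h (suc (suc zero)))
      (d zero (suc zero) (λ ()) ∘ F.toℕ-injective) (d zero (suc (suc zero)) (λ ()) ∘ F.toℕ-injective)
      (d (suc zero) (suc (suc zero)) (λ ()) ∘ F.toℕ-injective)
    high : ∀ m → toℕ a ≡ 2 + m → ⊥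
    -- If some `u i` is not on level `suc m`, every `v j` has to be; but a positive level holds only
    -- two vertices, so neither side can lie on it entirely.
    high m ea = same-level u du λ i → case level (U i) ℕ.≟ suc m of λ where
        (yes p) → p
        (no ¬p) → ⊥-elim (same-level v dv λ j → [ (λ q → ⊥-elim (¬p (trans (sym q) (top i j)))) , (λ q → trans (sym q) (top i j)) ]′
                             (⊔-sel (level (U i)) (level (V j))))
      where
      top : ∀ i j → level (U i) ⊔ level (V j) ≡ suc m
      top i j = hue-high _ (U i) (V j) (trans (col-colour (u i) (v j) (e i j)) ea)
    low : toℕ a ≤ 1 → ⊥
    low ha = paley-K33-free (toℕ a) ha (λ i → fromℕ< (U<17 i)) (λ j → fromℕ< (V<17 j))
        (λ i j p q → du i j p (F.toℕ-injective (F.fromℕ<-injective _ _ (U<17 i) (U<17 j) q)))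
        (λ i j p q → dv i j p (F.toℕ-injective (F.fromℕ<-injective _ _ (V<17 i) (V<17 j) q)))
        (λ i j q → uv i j (F.toℕ-injective (F.fromℕ<-injective _ _ (U<17 i) (V<17 j) q)))
        (λ i j → trans (cong₂ (λ s t → qr ∣ s - t ∣) (F.toℕ-fromℕ< (U<17 i)) (F.toℕ-fromℕ< (V<17 j)))
          (trans (cong (λ l → hue l (U i) (V j)) (sym (flat i j))) (col-colour (u i) (v j) (e i j))))
      where
      flat : ∀ i j → level (U i) ⊔ level (V j) ≡ 0
      flat i j = hue-low _ (U i) (V j) (col-colour (u i) (v j) (e i j)) ha
      U<17 : ∀ i → U i < 17
      U<17 i = level-0 (U i) (n≤0⇒n≡0 (≤-trans (m≤m⊔n _ (level (V zero))) (≤-reflexive (flat i zero))))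
      V<17 : ∀ j → V j < 17
      V<17 j = level-0 (V j) (n≤0⇒n≡0 (≤-trans (m≤n⊔m (level (U zero)) _) (≤-reflexive (flat zero j))))
    go : ∀ b → toℕ a ≡ b → ⊥
    go 0 e = low (≤-trans (≤-reflexive e) z≤n)
    go 1 e = low (≤-reflexive e)
    go (suc (suc m)) e = high m e

  uses-all : UsesAll colouring
  uses-all a = go (toℕ a) refl
    where
    attained : ∀ s t (hs : s < N) (ht : t < N) → s ≢ t → colour s t ≡ toℕ a → Σ (Fin N) λ i → Σ (Fin N) λ j → i ≢ j × col colouring i j ≡ a
    attained s t hs ht s≢t e = fromℕ< hs , fromℕ< ht , (λ q → s≢t (F.fromℕ<-injective _ _ hs ht q)) ,
      F.toℕ-injective (trans (F.toℕ-fromℕ< _) (trans (cong₂ colour (F.toℕ-fromℕ< hs) (F.toℕ-fromℕ< ht)) e))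
    13≤N : 13 ≤ N
    13≤N = m≤n+m 13 (2 * k)
    go : ∀ b → toℕ a ≡ b → Σ (Fin N) λ i → Σ (Fin N) λ j → i ≢ j × col colouring i j ≡ a
    -- 3 is not a square modulo 17.
    go 0 e = attained 0 3 (≤-trans (s≤s z≤n) 13≤N) (≤-trans (s≤s (s≤s (s≤s (s≤s z≤n)))) 13≤N) (λ ()) (trans qr-3 (sym e))
      where
      opaque
        unfolding qr
        qr-3 : qr 3 ≡ 0
        qr-3 = refl
    go 1 e = attained 0 1 (≤-trans (s≤s z≤n) 13≤N) (≤-trans (s≤s (s≤s z≤n)) 13≤N) (λ ()) (trans qr-1 (sym e))
      where
      opaque
        unfolding qr
        qr-1 : qr 1 ≡ 1
        qr-1 = refl
    -- The second vertex is the first one of level `suc m`.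
    go (suc (suc m)) e = attained 0 (15 + (suc m + suc m)) (≤-trans (s≤s z≤n) 13≤N) fits (λ ()) (trans (cong (λ l → hue l 0 (15 + (suc m + suc m))) (middle m)) (sym e))
      where
      middle : ∀ m → ⌊ suc m + suc m /2⌋ ≡ suc m
      middle m = sym (n≡⌊n+n/2⌋ (suc m))
      fits : 15 + (suc m + suc m) < N
      fits = ≤-trans (≤-trans (m≤m+n _ 1) (≤-reflexive (arith m))) (+-monoˡ-≤ 13 (*-monoʳ-≤ 2 (≤-trans (≤-reflexive (cong suc (sym e))) (F.toℕ<n a))))
        where
        arith : ∀ m → suc (15 + (suc m + suc m)) + 1 ≡ 2 * (3 + m) + 13
        arith = solve-∀

lower-bound : ∀ k → 3 ≤ k → ∀ M → (∀ n → M ≤ n → GRProperty k n) → 2 * k + 14 ≤ M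
lower-bound k 3≤k M h = subst (_≤ M) (sym (+-suc (2 * k) 13))
  (≰⇒> λ M≤N → [ L.rainbow-free , L.K33-free ]′ (h L.N M≤N L.colouring L.uses-all))
  where
  module L = Lower k 3≤k

theorem14 : ∀ (k : ℕ) → 3 ≤ k → GR-K33-is k (2 * k + 14)
theorem14 k 3≤k = upper-bound k 3≤k , lower-bound k 3≤k
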